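{- Let $P$ be a finite poset of height $2$ that has a $k$-partite representation for some integer $k\geq 2$. Then $$\mathrm{La}(n,P)=(1+o(1))\binom{n}{\lfloor n/2\rfloor}\qquad\text{as } n\to\infty.$$
   Context: For posets $P=(P,\le)$ and $P'=(P',\le')$, $P'$ is a (weak) subposet of $P$ if there is an injection $f\colon P'\to P$ such that $u\le' v$ implies $f(u)\le f(v)$. The height of a poset is the maximum size of a chain in it. A family $\mathcal{F}$ of subsets of $[n]=\{1,\dots,n\}$ is $P$-free if $P$ is not a weak subposet of $(\mathcal{F},\subseteq)$; $\mathrm{La}(n,P)$ is the largest size of a $P$-free family of subsets of $[n]$. A height-2 poset $P$ has a $k$-partite representation if there exist an integer $l$ and a family $\mathcal{P}\subseteq\binom{[l]}{k-1}\cup\binom{[l]}{k}$ such that (i) $P$ is a weak subposet of $(\mathcal{P},\subseteq)$, and (ii) the $k$-uniform hypergraph $G(\mathcal{P})$ with vertex set $[l]$ and edge set $\mathcal{P}\cap\binom{[l]}{k}$ is $k$-partite, i.e. $[l]$ can be partitioned into $k$ parts such that every edge meets every part in exactly one vertex. -}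

module Defs where

open import Data.Nat using (ℕ; zero; suc; _+_; _*_; _∸_; _≤_; _≥_; _/_)
open import Data.Nat.Combinatorics using (_C_)
open import Data.Fin using (Fin)
open import Data.Fin.Subset using (Subset; _⊆_; ∣_∣) renaming (_∈_ to _∈ₛ_)
open import Data.List using (List; length)
open import Data.List.Membership.Propositional using (_∈_)
open import Data.List.Relation.Unary.Unique.Propositional using (Unique)
open import Data.Product using (Σ; ∃; ∃-syntax; _×_; _,_)
open import Data.Sum using (_⊎_)
open import Function.Definitions using (Injective)
open import Relation.Binary.Core using (Rel)
open import Relation.Binary.Structures using (IsPartialOrder)
open import Relation.Binary.PropositionalEquality using (_≡_)
open import Relation.Nullary using (¬_)

record FinPoset : Set₁ where
  field
    size : ℕ
    _≤P_ : Rel (Fin size) _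
    isPartialOrder : IsPartialOrder _≡_ _≤P_
open FinPoset public

HasChainOfSize : FinPoset → ℕ → Set
HasChainOfSize P c =
  Σ (Fin c → Fin (size P)) λ f →
    Injective _≡_ _≡_ f ×
    (∀ i j → (_≤P_ P (f i) (f j)) ⊎ (_≤P_ P (f j) (f i)))

HasHeight : FinPoset → ℕ → Set
HasHeight P h = HasChainOfSize P h × (∀ c → HasChainOfSize P c → c ≤ h)

WeakSubposetOfFamily : (P : FinPoset) → (n : ℕ) → List (Subset n) → Set
WeakSubposetOfFamily P n 𝓕 =
  Σ (Fin (size P) → Subset n) λ f →
    Injective _≡_ _≡_ f ×
    (∀ u → f u ∈ 𝓕) ×
    (∀ u v → _≤P_ P u v → f u ⊆ f v)

PFree : (P : FinPoset) → (n : ℕ) → List (Subset n) → Set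
PFree P n 𝓕 = ¬ WeakSubposetOfFamily P n 𝓕

-- The hypergraph G(𝒫) is k-partite: a partition of [l] into k parts
-- (given by c : Fin l → Fin k) such that every edge (member of 𝒫 of size k)
-- meets every part in exactly one vertex.
KPartite : (k l : ℕ) → List (Subset l) → Set
KPartite k l 𝒫 =
  Σ (Fin l → Fin k) λ c →
    ∀ E → E ∈ 𝒫 → ∣ E ∣ ≡ k →
      ∀ (j : Fin k) → Σ (Fin l) λ x →
        (x ∈ₛ E) × (c x ≡ j) × (∀ y → y ∈ₛ E → c y ≡ j → y ≡ x)

HasKPartiteRepresentation : FinPoset → ℕ → Set
HasKPartiteRepresentation P k =
  Σ ℕ λ l → Σ (List (Subset l)) λ 𝒫 →
    (∀ E → E ∈ 𝒫 → (∣ E ∣ ≡ k ∸ 1) ⊎ (∣ E ∣ ≡ k)) ×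
    WeakSubposetOfFamily P l 𝒫 ×
    KPartite k l 𝒫

-- La(n,P) = (1+o(1)) C(n,⌊n/2⌋), with La(n,P) the maximum size of a P-free
-- family, unfolded: for every ε = 1/(m+1) there is N such that for n ≥ N
-- every P-free family has size ≤ (1+ε)·C(n,⌊n/2⌋) and some P-free family
-- has size ≥ (1-ε)·C(n,⌊n/2⌋).
LaAsymptoticallyMiddleBinomial : FinPoset → Set
LaAsymptoticallyMiddleBinomial P =
  ∀ (m : ℕ) → ∃[ N ] ∀ n → n ≥ N →
    (∀ (𝓕 : List (Subset n)) → Unique 𝓕 → PFree P n 𝓕 →
       suc m * length 𝓕 ≤ (2 + m) * (n C (n / 2)))
    ×
    (∃[ 𝓕 ] Unique 𝓕 × PFree P n 𝓕 ×
       (m * (n C (n / 2)) ≤ suc m * length 𝓕))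

module Submission where

open import Defs
open import Data.Nat using (ℕ; _≥_)
open import Data.Nat using (zero; suc; _+_; _*_; _∸_; _^_; _≤_; _<_; z≤n; s≤s; _≤?_; _≟_; _≤ᵇ_; _<ᵇ_; _≡ᵇ_; _!; NonZero; >-nonZero; >-nonZero⁻¹)
open import Data.Nat.Properties
open import Data.Nat.Tactic.RingSolver using (solve-∀)
open import Data.Nat.Combinatorics using (_C_; nCk≡n!/k![n-k]!; k![n∸k]!∣n!; nCn≡1; nCk≡nC[n∸k]; k>n⇒nCk≡0; nCk+nC[k+1]≡[n+1]C[k+1])
open import Data.Nat.DivMod using (_/_; m/n*n≤m; m*n/n≡m; m/n*n≡m; /-monoˡ-≤; m≡m%n+[m/n]*n; m%n<n)
open import Data.Bool using (Bool; true; false; if_then_else_; _∧_; _∨_; not; T)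
open import Data.Bool.ListAction using (all; any)
open import Data.Empty using (⊥; ⊥-elim)
open import Data.Fin as Fin using (Fin; zero; suc; toℕ; _↑ˡ_; _↑ʳ_)
import Data.Fin.Properties as FinP
open import Data.Fin.Properties using (toℕ-injective)
open import Data.Fin.Subset using (Subset; inside; outside; ∣_∣; ⁅_⁆; _∪_; _⊂_) renaming (_⊆_ to _⊆ₛ_; _∈_ to _∈ₛ_; _∉_ to _∉ₛ_)
open import Data.Fin.Subset.Properties using (_∈?_; _⊆?_; p⊂q⇒∣p∣<∣q∣; p⊆q⇒∣p∣≤∣q∣; x∈⁅x⁆; x∈⁅y⁆⇒x≡y; x∈p∪q⁻; p⊆p∪q; q⊆p∪q) renaming (⊆-antisym to ⊆ₛ-antisym; ⊆-refl to ⊆ₛ-refl)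
open import Data.List as List using (List; []; _∷_; _++_; map; concatMap; length; replicate; filter; filterᵇ)
open import Data.List.Properties using (map-++; length-++; length-map; length-replicate; map-∘; map-cong; concatMap-++; concat-++; map-replicate; ++-assoc; ++-identityʳ; ∷-injectiveˡ; ∷-injectiveʳ)
open import Data.List.Membership.Propositional using (_∈_; _∉_; find; lose)
open import Data.List.Membership.Propositional.Properties using (∈-map⁺; ∈-map⁻; ∈-++⁺ˡ; ∈-++⁺ʳ; ∈-++⁻; ∈-concatMap⁻; ∈-lookup; ∈-filter⁻)
open import Data.List.Relation.Binary.Pointwise using (Pointwise; []; _∷_)
open import Data.List.Relation.Binary.Permutation.Propositional using (_↭_; refl; prep; swap; ↭-sym; ↭-refl; ↭-trans; ↭-reflexive; module PermutationReasoning) renaming (trans to transₚ)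
import Data.List.Relation.Binary.Permutation.Propositional.Properties as ↭P
open import Data.List.Relation.Binary.Sublist.Propositional as Sub using (_⊆_; []; _∷_; _∷ʳ_; ⊆-refl; ⊆-trans; minimum)
open import Data.List.Relation.Binary.Sublist.Propositional.Properties using (All-resp-⊆)
open import Data.List.Relation.Unary.All as All using (All; []; _∷_)
open import Data.List.Relation.Unary.AllPairs using ([]; _∷_)
open import Data.List.Relation.Unary.Any as Any using (here; there)
open import Data.List.Relation.Unary.Unique.Propositional using (Unique)
import Data.List.Relation.Unary.Unique.Propositional.Properties as UniqueP
open import Data.Product using (Σ; ∃-syntax; _×_; _,_; proj₁; proj₂)
open import Data.Sum using (_⊎_; inj₁; inj₂)
open import Data.Vec as Vec using (Vec; []; _∷_; here; there; lookup; _[_]≔_; toList)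
open import Data.Vec.Properties using (lookup∘tabulate; lookup∘update′; lookup-map; length-toList; toList∘fromList)
open import Function using (_∘_; const; it)
open import Function.Definitions using (Injective)
open import Relation.Binary.PropositionalEquality using (_≡_; _≢_; refl; sym; trans; cong; cong₂; subst; subst₂; module ≡-Reasoning)
open import Relation.Nullary using (¬_; yes; no; contradiction; ¬?; _×-dec_)
open import Relation.Nullary.Decidable using (decidable-stable)
open import Relation.Unary using (Decidable)

-- A P-free family with more than (1+ε) times the middle binomial coefficient of members has,
-- up to negligible tails, total weight ∑ |A|! (n-|A|)! ≥ (1+ε′) n!, so a random full chain meets
-- it at least 1+ε′ times on average. Hence a positive proportion (by weight) of the members B
-- contain a member reached by removing a random initial segment of B. Applied to many disjoint
-- segments of one B, this yields k disjoint blocks D₁,…,D_k ⊂ B with all B∖D_j in the family,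
-- for a positive proportion of configurations. Fixing the sizes of the D_j and comparing the
-- number of such configurations with the number of members B∖D_j, one finds a set S such that
-- the k-partite hypergraph of tuples (D₁,…,D_k) with S∪D₁∪…∪D_k and all S∪⋃_{i≠j}D_i in the
-- family is dense (Loomis–Whitney). By Erdős's theorem it contains a complete k-partite
-- hypergraph with large parts, hence a copy of the representation of P.
-- Averages over random orderings are sums over all permutations of a list of labels: such a sum
-- depends only on the multiset of labels.

-- The obstacle is the step "fixing the sizes of the D_j". The window of central levels has
-- half-width y of order n, wide enough for crude factorial estimates, so fixing k sizes costs a
-- factor of order y^k in density. Erdős's theorem survives this because its own loss is polynomial,
-- provided that the parts have far more than y vertices. The vertices are therefore whole sets, not
-- elements: the candidates for D_j are y^x subsets of one larger set, all of the prescribed size,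
-- where x is a lower bound for the sizes. As the size is constant, every choice of candidates
-- produces the same multiset of labels, and averages over orderings do not change. Sizes too small
-- for this are treated one at a time. Densities are expressed in ℕ: N ≤ r * c says that c out of N
-- is a proportion of at least 1/r, so r, `G` and the values of `κ` are reciprocals of densities.
-- Sets are two-colourings of an ordering of labels; several colourings of one ordering give
-- correlated sets such as B and B minus D_j, each equidistributed on its own level.

private variable
  A B D : Set

-- Finite sums over lists

ind : Bool → ℕ
ind true = 1
ind false = 0

ind≤1 : ∀ b → ind b ≤ 1
ind≤1 true = ≤-refl
ind≤1 false = z≤n

∑ : List A → (A → ℕ) → ℕ
∑ [] f = 0
∑ (x ∷ xs) f = f x + ∑ xs f

∑-cong∈ : ∀ (xs : List A) {f g : A → ℕ} → (∀ {x} → x ∈ xs → f x ≡ g x) → ∑ xs f ≡ ∑ xs g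
∑-cong∈ [] e = refl
∑-cong∈ (x ∷ xs) e = cong₂ _+_ (e (here refl)) (∑-cong∈ xs (e ∘ there))

∑-cong : ∀ (xs : List A) {f g : A → ℕ} → (∀ x → f x ≡ g x) → ∑ xs f ≡ ∑ xs g
∑-cong xs e = ∑-cong∈ xs (λ {x} _ → e x)

∑-mono∈ : ∀ (xs : List A) {f g : A → ℕ} → (∀ {x} → x ∈ xs → f x ≤ g x) → ∑ xs f ≤ ∑ xs g
∑-mono∈ [] e = z≤n
∑-mono∈ (x ∷ xs) e = +-mono-≤ (e (here refl)) (∑-mono∈ xs (e ∘ there))

∑-mono : ∀ (xs : List A) {f g : A → ℕ} → (∀ x → f x ≤ g x) → ∑ xs f ≤ ∑ xs g
∑-mono xs e = ∑-mono∈ xs (λ {x} _ → e x)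

∑-+ : ∀ (xs : List A) (f g : A → ℕ) → ∑ xs (λ x → f x + g x) ≡ ∑ xs f + ∑ xs g
∑-+ [] f g = refl
∑-+ (x ∷ xs) f g = begin
  (f x + g x) + ∑ xs (λ x → f x + g x) ≡⟨ cong ((f x + g x) +_) (∑-+ xs f g) ⟩
  (f x + g x) + (∑ xs f + ∑ xs g) ≡⟨ +-interchange (f x) (g x) _ _ ⟩
  (f x + ∑ xs f) + (g x + ∑ xs g) ∎
  where
  open ≡-Reasoning
  +-interchange : ∀ a b c d → (a + b) + (c + d) ≡ (a + c) + (b + d)
  +-interchange = solve-∀

∑-* : ∀ c (xs : List A) (f : A → ℕ) → ∑ xs (λ x → c * f x) ≡ c * ∑ xs f
∑-* c [] f = sym (*-zeroʳ c)
∑-* c (x ∷ xs) f = trans (cong (c * f x +_) (∑-* c xs f)) (sym (*-distribˡ-+ c (f x) _))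

∑-const : ∀ (xs : List A) c → ∑ xs (λ _ → c) ≡ length xs * c
∑-const [] c = refl
∑-const (x ∷ xs) c = cong (c +_) (∑-const xs c)

∑-zero : ∀ (xs : List A) → ∑ xs (λ _ → 0) ≡ 0
∑-zero xs = trans (∑-const xs 0) (*-zeroʳ (length xs))

∑-bound : ∀ (xs : List A) (f : A → ℕ) c → (∀ x → f x ≤ c) → ∑ xs f ≤ length xs * c
∑-bound xs f c h = ≤-trans (∑-mono xs h) (≤-reflexive (∑-const xs c))

∑-++ : ∀ (xs ys : List A) (f : A → ℕ) → ∑ (xs ++ ys) f ≡ ∑ xs f + ∑ ys f
∑-++ [] ys f = refl
∑-++ (x ∷ xs) ys f = trans (cong (f x +_) (∑-++ xs ys f)) (sym (+-assoc (f x) _ _))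

∑-map : ∀ (g : A → B) xs (f : B → ℕ) → ∑ (map g xs) f ≡ ∑ xs (f ∘ g)
∑-map g [] f = refl
∑-map g (x ∷ xs) f = cong (f (g x) +_) (∑-map g xs f)

∑-concatMap : ∀ (g : A → List B) xs (f : B → ℕ) → ∑ (concatMap g xs) f ≡ ∑ xs (λ x → ∑ (g x) f)
∑-concatMap g [] f = refl
∑-concatMap g (x ∷ xs) f = trans (∑-++ (g x) _ f) (cong (∑ (g x) f +_) (∑-concatMap g xs f))

∑-swap : ∀ (xs : List A) (ys : List B) (f : A → B → ℕ) →
  ∑ xs (λ x → ∑ ys (f x)) ≡ ∑ ys (λ y → ∑ xs (λ x → f x y))
∑-swap [] ys f = sym (∑-zero ys)
∑-swap (x ∷ xs) ys f = trans (cong (∑ ys (f x) +_) (∑-swap xs ys f)) (sym (∑-+ ys (f x) _))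

∑-↭ : ∀ {xs ys : List A} → xs ↭ ys → ∀ f → ∑ xs f ≡ ∑ ys f
∑-↭ refl f = refl
∑-↭ (prep x p) f = cong (f x +_) (∑-↭ p f)
∑-↭ (swap x y p) f = trans (cong (λ z → f x + (f y + z)) (∑-↭ p f)) (exch (f x) (f y) _)
  where
  exch : ∀ a b c → a + (b + c) ≡ b + (a + c)
  exch = solve-∀
∑-↭ (transₚ p q) f = trans (∑-↭ p f) (∑-↭ q f)

∑-∈ : ∀ {xs : List A} {x} (f : A → ℕ) → x ∈ xs → f x ≤ ∑ xs f
∑-∈ f (here refl) = m≤m+n _ _
∑-∈ f (there i) = ≤-trans (∑-∈ f i) (m≤n+m _ _)

∑-pigeonhole : ∀ (xs : List A) (f g : A → ℕ) → ∑ xs f < ∑ xs g → ∃[ x ] x ∈ xs × f x < g x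
∑-pigeonhole (x ∷ xs) f g h with f x <? g x
... | yes p = x , here refl , p
... | no ¬p with ∑-pigeonhole xs f g (+-cancelˡ-< (g x) _ _ (≤-<-trans (+-monoˡ-≤ _ (≮⇒≥ ¬p)) h))
...   | y , i , q = y , there i , q

∑-pigeonhole-≤ : ∀ (xs : List A) (f g : A → ℕ) → 0 < length xs → ∑ xs f ≤ ∑ xs g → ∃[ x ] x ∈ xs × f x ≤ g x
∑-pigeonhole-≤ xs f g pos h
  with ∑-pigeonhole xs f (λ x → suc (g x)) (≤-<-trans h (subst (∑ xs g <_) (sym eq) (m<n+m _ pos)))
  where
  eq : ∑ xs (λ x → suc (g x)) ≡ length xs + ∑ xs g
  eq = trans (∑-+ xs (λ _ → 1) g) (cong (_+ ∑ xs g) (trans (∑-const xs 1) (*-identityʳ _)))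
... | x , i , s≤s q = x , i , q

-- Orderings of a list, counted with multiplicity

inserts : A → List A → List (List A)
inserts x [] = (x ∷ []) ∷ []
inserts x (y ∷ ys) = (x ∷ y ∷ ys) ∷ map (y ∷_) (inserts x ys)

-- Repeated labels give repeated orderings, so the number of orderings is always the factorial of
-- the length. Counting with multiplicity makes these sums commute with arbitrary, non-injective
-- recolourings.
perms : List A → List (List A)
perms [] = [] ∷ []
perms (x ∷ xs) = concatMap (inserts x) (perms xs)

∑-inserts-map : ∀ (g : A → B) x xs (f : List B → ℕ) →
  ∑ (inserts (g x) (map g xs)) f ≡ ∑ (inserts x xs) (f ∘ map g)
∑-inserts-map g x [] f = refl
∑-inserts-map g x (y ∷ xs) f = cong (f _ +_) (begin
  ∑ (map (g y ∷_) (inserts (g x) (map g xs))) f ≡⟨ ∑-map (g y ∷_) (inserts (g x) (map g xs)) f ⟩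
  ∑ (inserts (g x) (map g xs)) (f ∘ (g y ∷_)) ≡⟨ ∑-inserts-map g x xs _ ⟩
  ∑ (inserts x xs) (f ∘ map g ∘ (y ∷_)) ≡⟨ ∑-map (y ∷_) (inserts x xs) _ ⟨
  ∑ (map (y ∷_) (inserts x xs)) (f ∘ map g) ∎)
  where open ≡-Reasoning

∑-perms-map : ∀ (g : A → B) xs (f : List B → ℕ) → ∑ (perms (map g xs)) f ≡ ∑ (perms xs) (f ∘ map g)
∑-perms-map g [] f = refl
∑-perms-map g (x ∷ xs) f = begin
  ∑ (concatMap (inserts (g x)) (perms (map g xs))) f ≡⟨ ∑-concatMap _ (perms (map g xs)) f ⟩
  ∑ (perms (map g xs)) (λ l → ∑ (inserts (g x) l) f) ≡⟨ ∑-perms-map g xs _ ⟩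
  ∑ (perms xs) (λ l → ∑ (inserts (g x) (map g l)) f) ≡⟨ ∑-cong (perms xs) (λ l → ∑-inserts-map g x l f) ⟩
  ∑ (perms xs) (λ l → ∑ (inserts x l) (f ∘ map g)) ≡⟨ ∑-concatMap _ (perms xs) _ ⟨
  ∑ (perms (x ∷ xs)) (f ∘ map g) ∎
  where open ≡-Reasoning

∑-inserts-comm : ∀ (x y : A) l f →
  ∑ (inserts y l) (λ m → ∑ (inserts x m) f) ≡ ∑ (inserts x l) (λ m → ∑ (inserts y m) f)
∑-inserts-comm x y [] f = lem (f (x ∷ y ∷ [])) (f (y ∷ x ∷ []))
  where
  lem : ∀ a b → (a + (b + 0)) + 0 ≡ (b + (a + 0)) + 0
  lem = solve-∀
∑-inserts-comm {A = A} x y (z ∷ l) f = begin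
  lhs x y ≡⟨ expand x y ⟩
  (a + (b + ∑ (inserts x l) (f ∘ λ m → y ∷ z ∷ m))) + (∑ (inserts y l) (f ∘ λ m → x ∷ z ∷ m) + ∑ (inserts y l) (λ m → ∑ (inserts x m) (f ∘ (z ∷_))))
    ≡⟨ cong (λ q → (a + (b + ∑ (inserts x l) (f ∘ λ m → y ∷ z ∷ m))) + (∑ (inserts y l) (f ∘ λ m → x ∷ z ∷ m) + q)) (∑-inserts-comm x y l (f ∘ (z ∷_))) ⟩
  (a + (b + ∑ (inserts x l) (f ∘ λ m → y ∷ z ∷ m))) + (∑ (inserts y l) (f ∘ λ m → x ∷ z ∷ m) + ∑ (inserts x l) (λ m → ∑ (inserts y m) (f ∘ (z ∷_))))
    ≡⟨ rearr a b _ _ _ ⟩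
  (b + (a + ∑ (inserts y l) (f ∘ λ m → x ∷ z ∷ m))) + (∑ (inserts x l) (f ∘ λ m → y ∷ z ∷ m) + ∑ (inserts x l) (λ m → ∑ (inserts y m) (f ∘ (z ∷_))))
    ≡⟨ expand y x ⟨
  lhs y x ∎
  where
  open ≡-Reasoning
  a b : ℕ
  a = f (x ∷ y ∷ z ∷ l)
  b = f (y ∷ x ∷ z ∷ l)
  lhs : A → A → ℕ
  lhs x y = ∑ (inserts y (z ∷ l)) (λ m → ∑ (inserts x m) f)
  rearr : ∀ a b c d e → (a + (b + c)) + (d + e) ≡ (b + (a + d)) + (c + e)
  rearr = solve-∀
  expand : ∀ x y → lhs x y ≡ (f (x ∷ y ∷ z ∷ l) + (f (y ∷ x ∷ z ∷ l) + ∑ (inserts x l) (f ∘ λ m → y ∷ z ∷ m))) + (∑ (inserts y l) (f ∘ λ m → x ∷ z ∷ m) + ∑ (inserts y l) (λ m → ∑ (inserts x m) (f ∘ (z ∷_))))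
  expand x y = cong₂ _+_
    (cong (f (x ∷ y ∷ z ∷ l) +_) (cong (f (y ∷ x ∷ z ∷ l) +_) (trans (∑-map _ (map (z ∷_) (inserts x l)) f) (∑-map _ (inserts x l) _))))
    (begin
      ∑ (map (z ∷_) (inserts y l)) (λ m → ∑ (inserts x m) f) ≡⟨ ∑-map _ (inserts y l) _ ⟩
      ∑ (inserts y l) (λ m → f (x ∷ z ∷ m) + ∑ (map (z ∷_) (inserts x m)) f) ≡⟨ ∑-+ (inserts y l) _ _ ⟩
      ∑ (inserts y l) (λ m → f (x ∷ z ∷ m)) + ∑ (inserts y l) (λ m → ∑ (map (z ∷_) (inserts x m)) f)
        ≡⟨ cong (∑ (inserts y l) (λ m → f (x ∷ z ∷ m)) +_) (∑-cong (inserts y l) (λ m → ∑-map _ (inserts x m) f)) ⟩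
      ∑ (inserts y l) (f ∘ λ m → x ∷ z ∷ m) + ∑ (inserts y l) (λ m → ∑ (inserts x m) (f ∘ (z ∷_))) ∎)

-- A derivation of `xs ↭ ys` reduces the claim to the exchange of two adjacent labels, which is
-- independence of the order of insertion.
∑-perms-↭ : ∀ {xs ys : List A} → xs ↭ ys → ∀ f → ∑ (perms xs) f ≡ ∑ (perms ys) f
∑-perms-↭ refl f = refl
∑-perms-↭ {xs = x ∷ xs} {ys = _ ∷ ys} (prep x p) f = begin
  ∑ (perms (x ∷ xs)) f ≡⟨ ∑-concatMap _ (perms xs) f ⟩
  ∑ (perms xs) (λ l → ∑ (inserts x l) f) ≡⟨ ∑-perms-↭ p _ ⟩
  ∑ (perms ys) (λ l → ∑ (inserts x l) f) ≡⟨ ∑-concatMap _ (perms ys) f ⟨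
  ∑ (perms (x ∷ ys)) f ∎
  where open ≡-Reasoning
∑-perms-↭ {xs = _ ∷ _ ∷ xs} {ys = _ ∷ _ ∷ ys} (swap x y p) f = begin
  ∑ (perms (x ∷ y ∷ xs)) f ≡⟨ two x y xs ⟩
  ∑ (perms xs) (λ l → ∑ (inserts y l) (λ m → ∑ (inserts x m) f)) ≡⟨ ∑-perms-↭ p _ ⟩
  ∑ (perms ys) (λ l → ∑ (inserts y l) (λ m → ∑ (inserts x m) f)) ≡⟨ ∑-cong (perms ys) (λ l → ∑-inserts-comm x y l f) ⟩
  ∑ (perms ys) (λ l → ∑ (inserts x l) (λ m → ∑ (inserts y m) f)) ≡⟨ two y x ys ⟨
  ∑ (perms (y ∷ x ∷ ys)) f ∎
  where
  open ≡-Reasoning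
  two : ∀ x y xs → ∑ (perms (x ∷ y ∷ xs)) f ≡ ∑ (perms xs) (λ l → ∑ (inserts y l) (λ m → ∑ (inserts x m) f))
  two x y xs = trans (∑-concatMap _ (concatMap (inserts y) (perms xs)) f) (∑-concatMap _ (perms xs) _)
∑-perms-↭ (transₚ p q) f = trans (∑-perms-↭ p f) (∑-perms-↭ q f)

∈-inserts-↭ : ∀ {x : A} {xs l} → l ∈ inserts x xs → l ↭ x ∷ xs
∈-inserts-↭ {xs = []} (here refl) = ↭-refl
∈-inserts-↭ {xs = y ∷ ys} (here refl) = ↭-refl
∈-inserts-↭ {x = x} {xs = y ∷ ys} (there i) with ∈-map⁻ (y ∷_) i
... | m , j , refl = ↭-trans (prep y (∈-inserts-↭ j)) (swap y x ↭-refl)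

∈-perms-↭ : ∀ {xs l : List A} → l ∈ perms xs → l ↭ xs
∈-perms-↭ {xs = []} (here refl) = ↭-refl
∈-perms-↭ {xs = x ∷ xs} i with find (∈-concatMap⁻ (inserts x) {xs = (perms xs)} i)
... | m , j , k = ↭-trans (∈-inserts-↭ k) (prep x (∈-perms-↭ j))

length-inserts : ∀ (x : A) l → length (inserts x l) ≡ suc (length l)
length-inserts x [] = refl
length-inserts x (y ∷ l) = cong suc (trans (length-map _ (inserts x l)) (length-inserts x l))

length≡∑1 : ∀ (xs : List A) → length xs ≡ ∑ xs (λ _ → 1)
length≡∑1 xs = sym (trans (∑-const xs 1) (*-identityʳ _))

length-perms : ∀ (xs : List A) → length (perms xs) ≡ length xs !
length-perms [] = refl
length-perms (x ∷ xs) = begin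
  length (concatMap (inserts x) (perms xs)) ≡⟨ length≡∑1 (concatMap (inserts x) (perms xs)) ⟩
  ∑ (concatMap (inserts x) (perms xs)) (λ _ → 1) ≡⟨ ∑-concatMap _ (perms xs) _ ⟩
  ∑ (perms xs) (λ l → ∑ (inserts x l) (λ _ → 1)) ≡⟨ ∑-cong∈ (perms xs) (λ {l} i → trans (sym (length≡∑1 (inserts x l))) (trans (length-inserts x l) (cong suc (↭P.↭-length (∈-perms-↭ {xs = xs} i))))) ⟩
  ∑ (perms xs) (λ _ → suc (length xs)) ≡⟨ ∑-const (perms xs) _ ⟩
  length (perms xs) * suc (length xs) ≡⟨ cong (_* suc (length xs)) (length-perms xs) ⟩
  (length xs !) * suc (length xs) ≡⟨ *-comm (length xs !) _ ⟩
  suc (length xs) ! ∎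
  where open ≡-Reasoning

-- Sets as Boolean lists, and their weights

eqB : Bool → Bool → Bool
eqB true y = y
eqB false y = not y

eqL : List Bool → List Bool → Bool
eqL [] [] = true
eqL [] (_ ∷ _) = false
eqL (_ ∷ _) [] = false
eqL (x ∷ xs) (y ∷ ys) = eqB x y ∧ eqL xs ys

eqL-refl : ∀ xs → eqL xs xs ≡ true
eqL-refl [] = refl
eqL-refl (true ∷ xs) = eqL-refl xs
eqL-refl (false ∷ xs) = eqL-refl xs

eqL-sound : ∀ xs ys → eqL xs ys ≡ true → xs ≡ ys
eqL-sound [] [] e = refl
eqL-sound (true ∷ xs) (true ∷ ys) e = cong (true ∷_) (eqL-sound xs ys e)
eqL-sound (false ∷ xs) (false ∷ ys) e = cong (false ∷_) (eqL-sound xs ys e)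

mem : List (List Bool) → List Bool → Bool
mem [] s = false
mem (A ∷ F) s = eqL s A ∨ mem F s

mem-sound : ∀ F {s} → mem F s ≡ true → s ∈ F
mem-sound (A ∷ F) {s} e with eqL s A in eq
... | true = here (eqL-sound s A eq)
... | false = there (mem-sound F e)

ind-mem : ∀ {F} → Unique F → ∀ s → ind (mem F s) ≡ ∑ F (ind ∘ eqL s)
ind-mem [] s = refl
ind-mem {A ∷ F} (A∉F ∷ u) s with eqL s A in eq
... | false = ind-mem u s
... | true = cong suc (sym (none F A∉F))
  where
  none : ∀ G → All (A ≢_) G → ∑ G (ind ∘ eqL s) ≡ 0
  none [] _ = refl
  none (B ∷ G) (A≢B ∷ r) with eqL s B in eq′
  ... | false = none G r
  ... | true = ⊥-elim (A≢B (trans (sym (eqL-sound s A eq)) (eqL-sound s B eq′)))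

trues falses : List Bool → ℕ
trues xs = ∑ xs ind
falses xs = ∑ xs (ind ∘ not)

trues+falses : ∀ xs → trues xs + falses xs ≡ length xs
trues+falses [] = refl
trues+falses (true ∷ xs) = cong suc (trues+falses xs)
trues+falses (false ∷ xs) = trans (+-suc _ _) (cong suc (trues+falses xs))

-- The inverse operation to `inserts`; it lets the orderings that equal a given `s` be counted by
-- recursion on the labels.
deletions : Bool → List Bool → List (List Bool)
deletions x [] = []
deletions x (y ∷ s) = (if eqB x y then s ∷ [] else []) ++ map (y ∷_) (deletions x s)

∑-inserts-eqL : ∀ x l s → ∑ (inserts x l) (λ m → ind (eqL m s)) ≡ ∑ (deletions x s) (ind ∘ eqL l)
∑-inserts-eqL x [] [] = refl
∑-inserts-eqL x [] (y ∷ []) with eqB x y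
... | true = refl
... | false = refl
∑-inserts-eqL x [] (y ∷ z ∷ s) with eqB x y
... | true = sym (trans (∑-map (y ∷_) (deletions x (z ∷ s)) _) (∑-zero (deletions x (z ∷ s))))
... | false = sym (trans (∑-map (y ∷_) (deletions x (z ∷ s)) _) (∑-zero (deletions x (z ∷ s))))
∑-inserts-eqL x (z ∷ l) [] = trans (∑-map (z ∷_) (inserts x l) _) (∑-zero (inserts x l))
∑-inserts-eqL x (z ∷ l) (y ∷ s) = begin
  ind (eqB x y ∧ eqL (z ∷ l) s) + ∑ (map (z ∷_) (inserts x l)) (λ m → ind (eqL m (y ∷ s)))
    ≡⟨ cong₂ _+_ (head (eqB x y)) (trans (∑-map (z ∷_) (inserts x l) _) (tail (eqB z y))) ⟩
  ∑ (if eqB x y then s ∷ [] else []) (ind ∘ eqL (z ∷ l)) + ∑ (deletions x s) (λ m → ind (eqL (z ∷ l) (y ∷ m)))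
    ≡⟨ cong (∑ (if eqB x y then s ∷ [] else []) (ind ∘ eqL (z ∷ l)) +_) (∑-map (y ∷_) (deletions x s) _) ⟨
  ∑ (if eqB x y then s ∷ [] else []) (ind ∘ eqL (z ∷ l)) + ∑ (map (y ∷_) (deletions x s)) (ind ∘ eqL (z ∷ l))
    ≡⟨ ∑-++ (if eqB x y then s ∷ [] else []) _ _ ⟨
  ∑ (deletions x (y ∷ s)) (ind ∘ eqL (z ∷ l)) ∎
  where
  open ≡-Reasoning
  head : ∀ b → ind (b ∧ eqL (z ∷ l) s) ≡ ∑ (if b then s ∷ [] else []) (ind ∘ eqL (z ∷ l))
  head true = sym (+-identityʳ _)
  head false = refl
  tail : ∀ b → ∑ (inserts x l) (λ m → ind (b ∧ eqL m s)) ≡ ∑ (deletions x s) (λ m → ind (b ∧ eqL l m))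
  tail true = ∑-inserts-eqL x l s
  tail false = trans (∑-zero (inserts x l)) (sym (∑-zero (deletions x s)))

length-deletions : ∀ x s → length (deletions x s) ≡ ∑ s (ind ∘ eqB x)
length-deletions x [] = refl
length-deletions x (y ∷ s) with eqB x y
... | true = cong suc (trans (length-map _ (deletions x s)) (length-deletions x s))
... | false = trans (length-map _ (deletions x s)) (length-deletions x s)

∈-deletions-↭ : ∀ x s {m} → m ∈ deletions x s → s ↭ x ∷ m
∈-deletions-↭ true (true ∷ s) (here refl) = ↭-refl
∈-deletions-↭ false (false ∷ s) (here refl) = ↭-refl
∈-deletions-↭ true (true ∷ s) (there i) with ∈-map⁻ (true ∷_) i
... | m , j , refl = prep true (∈-deletions-↭ true s j)
∈-deletions-↭ false (false ∷ s) (there i) with ∈-map⁻ (false ∷_) i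
... | m , j , refl = prep false (∈-deletions-↭ false s j)
∈-deletions-↭ true (false ∷ s) i with ∈-map⁻ (false ∷_) i
... | m , j , refl = ↭-trans (prep false (∈-deletions-↭ true s j)) (swap false true ↭-refl)
∈-deletions-↭ false (true ∷ s) i with ∈-map⁻ (true ∷_) i
... | m , j , refl = ↭-trans (prep true (∈-deletions-↭ false s j)) (swap true false ↭-refl)

-- The number of full chains through the set `s`, and equally the number of orderings of the entries
-- of `s`, with multiplicity, that equal `s`.
weight : List Bool → ℕ
weight s = trues s ! * falses s !

∑-perms-eqL-step : ∀ x c s → ∑ (perms (x ∷ c)) (λ l → ind (eqL l s)) ≡
  ∑ (deletions x s) (λ m → ∑ (perms c) (λ l → ind (eqL l m)))
∑-perms-eqL-step x c s = begin
  ∑ (perms (x ∷ c)) (λ l → ind (eqL l s)) ≡⟨ ∑-concatMap (inserts x) (perms c) _ ⟩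
  ∑ (perms c) (λ l → ∑ (inserts x l) (λ m → ind (eqL m s))) ≡⟨ ∑-cong (perms c) (λ l → ∑-inserts-eqL x l s) ⟩
  ∑ (perms c) (λ l → ∑ (deletions x s) (λ m → ind (eqL l m))) ≡⟨ ∑-swap (perms c) (deletions x s) _ ⟩
  ∑ (deletions x s) (λ m → ∑ (perms c) (λ l → ind (eqL l m))) ∎
  where open ≡-Reasoning

-- Every deletion of the first entry of `c` from `s` leaves the same smaller count, and there are
-- `trues s` or `falses s` such deletions; these supply the factors of the two factorials.
∑-perms-eqL : ∀ c s → trues c ≡ trues s → falses c ≡ falses s → ∑ (perms c) (λ l → ind (eqL l s)) ≡ weight s
∑-perms-eqL [] [] _ _ = refl
∑-perms-eqL [] (true ∷ s) () _
∑-perms-eqL [] (false ∷ s) _ ()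
∑-perms-eqL (true ∷ c) s t f = begin
  ∑ (perms (true ∷ c)) (λ l → ind (eqL l s)) ≡⟨ ∑-perms-eqL-step true c s ⟩
  ∑ (deletions true s) (λ m → ∑ (perms c) (λ l → ind (eqL l m)))
    ≡⟨ ∑-cong∈ (deletions true s) (λ {m} i → step m (∈-deletions-↭ true s i)) ⟩
  ∑ (deletions true s) (λ _ → trues c ! * falses c !) ≡⟨ ∑-const (deletions true s) _ ⟩
  length (deletions true s) * (trues c ! * falses c !) ≡⟨ cong (_* (trues c ! * falses c !)) (trans (length-deletions true s) (sym t)) ⟩
  suc (trues c) * (trues c ! * falses c !) ≡⟨ *-assoc (suc (trues c)) (trues c !) _ ⟨
  suc (trues c) ! * falses c ! ≡⟨ cong₂ (λ p q → p ! * q !) t f ⟩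
  weight s ∎
  where
  open ≡-Reasoning
  step : ∀ m → s ↭ true ∷ m → ∑ (perms c) (λ l → ind (eqL l m)) ≡ trues c ! * falses c !
  step m p = trans (∑-perms-eqL c m t′ f′) (cong₂ (λ p q → p ! * q !) (sym t′) (sym f′))
    where
    t′ = suc-injective (trans t (∑-↭ p ind))
    f′ = trans f (∑-↭ p (ind ∘ not))
∑-perms-eqL (false ∷ c) s t f = begin
  ∑ (perms (false ∷ c)) (λ l → ind (eqL l s)) ≡⟨ ∑-perms-eqL-step false c s ⟩
  ∑ (deletions false s) (λ m → ∑ (perms c) (λ l → ind (eqL l m)))
    ≡⟨ ∑-cong∈ (deletions false s) (λ {m} i → step m (∈-deletions-↭ false s i)) ⟩
  ∑ (deletions false s) (λ _ → trues c ! * falses c !) ≡⟨ ∑-const (deletions false s) _ ⟩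
  length (deletions false s) * (trues c ! * falses c !) ≡⟨ cong (_* (trues c ! * falses c !)) (trans (length-deletions false s) (sym f)) ⟩
  suc (falses c) * (trues c ! * falses c !) ≡⟨ rearr (suc (falses c)) (trues c !) (falses c !) ⟩
  trues c ! * suc (falses c) ! ≡⟨ cong₂ (λ p q → p ! * q !) t f ⟩
  weight s ∎
  where
  open ≡-Reasoning
  rearr : ∀ a b c → a * (b * c) ≡ b * (a * c)
  rearr = solve-∀
  step : ∀ m → s ↭ false ∷ m → ∑ (perms c) (λ l → ind (eqL l m)) ≡ trues c ! * falses c !
  step m p = trans (∑-perms-eqL c m t′ f′) (cong₂ (λ p q → p ! * q !) (sym t′) (sym f′))
    where
    t′ = trans t (∑-↭ p ind)
    f′ = suc-injective (trans f (∑-↭ p (ind ∘ not)))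

≡ᵇ-true : ∀ m n → (m ≡ᵇ n) ≡ true → m ≡ n
≡ᵇ-true m n e = ≡ᵇ⇒≡ m n (subst T (sym e) _)

≡ᵇ-refl : ∀ n → (n ≡ᵇ n) ≡ true
≡ᵇ-refl zero = refl
≡ᵇ-refl (suc n) = ≡ᵇ-refl n

≡ᵇ-false : ∀ m n → m ≢ n → (m ≡ᵇ n) ≡ false
≡ᵇ-false m n ne with m ≡ᵇ n in eq
... | false = refl
... | true = ⊥-elim (ne (≡ᵇ-true m n eq))

-- Swapping the sums leaves one count per member: zero off the level of `c`, since orderings keep
-- the number of falses, and `weight s` on it.
density : ∀ {F} n → Unique F → (∀ {s} → s ∈ F → length s ≡ n) → ∀ c → length c ≡ n →
  ∑ (perms c) (ind ∘ mem F) ≡ ∑ F (λ s → ind (falses s ≡ᵇ falses c) * weight s)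
density {F} n u len c lc = begin
  ∑ (perms c) (ind ∘ mem F) ≡⟨ ∑-cong (perms c) (ind-mem u) ⟩
  ∑ (perms c) (λ l → ∑ F (ind ∘ eqL l)) ≡⟨ ∑-swap (perms c) F _ ⟩
  ∑ F (λ s → ∑ (perms c) (λ l → ind (eqL l s))) ≡⟨ ∑-cong∈ F (λ {s} i → each s (len i)) ⟩
  ∑ F (λ s → ind (falses s ≡ᵇ falses c) * weight s) ∎
  where
  open ≡-Reasoning
  zeros : ∀ s → falses s ≢ falses c → ∀ {l} → l ∈ perms c → ind (eqL l s) ≡ 0
  zeros s ne {l} i with eqL l s in eq
  ... | false = refl
  ... | true = ⊥-elim (ne (trans (cong falses (sym (eqL-sound l s eq))) (∑-↭ (∈-perms-↭ {xs = c} i) _)))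
  each : ∀ s → length s ≡ n → ∑ (perms c) (λ l → ind (eqL l s)) ≡ ind (falses s ≡ᵇ falses c) * weight s
  each s ls with falses s ≟ falses c
  ... | yes e = trans (∑-perms-eqL c s (sym t) (sym e))
                  (sym (trans (cong (λ b → ind b * weight s) (trans (cong (_≡ᵇ falses c) e) (≡ᵇ-refl (falses c)))) (*-identityˡ _)))
    where
    t : trues s ≡ trues c
    t = +-cancelʳ-≡ (falses s) _ _ (trans (trues+falses s) (trans ls (trans (sym lc) (trans (sym (trues+falses c)) (cong (trues c +_) (sym e))))))
  ... | no ne = trans (∑-cong∈ (perms c) (zeros s ne)) (trans (∑-zero (perms c))
                  (sym (cong (λ b → ind b * weight s) (≡ᵇ-false _ _ ne))))

weight≤! : ∀ s → weight s ≤ length s !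
weight≤! s = begin
  weight s ≡⟨ ∑-perms-eqL s s refl refl ⟨
  ∑ (perms s) (λ l → ind (eqL l s)) ≤⟨ ∑-bound (perms s) _ 1 (λ l → ind≤1 _) ⟩
  length (perms s) * 1 ≡⟨ trans (*-identityʳ _) (length-perms s) ⟩
  length s ! ∎
  where open ≤-Reasoning

-- Intervals of natural numbers

range : ℕ → ℕ → List ℕ
range s zero = []
range s (suc m) = s ∷ range (suc s) m

range-++ : ∀ s a b → range s (a + b) ≡ range s a ++ range (s + a) b
range-++ s zero b = cong (λ z → range z b) (sym (+-identityʳ s))
range-++ s (suc a) b = cong (s ∷_) (trans (range-++ (suc s) a b) (cong (λ z → range (suc s) a ++ range z b) (sym (+-suc s a))))

length-range : ∀ s m → length (range s m) ≡ m
length-range s zero = refl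
length-range s (suc m) = cong suc (length-range (suc s) m)

∈-range⁻ : ∀ s m {x} → x ∈ range s m → s ≤ x × x < s + m
∈-range⁻ s (suc m) (here refl) = ≤-refl , m<m+n s (s≤s z≤n)
∈-range⁻ s (suc m) {x} (there i) with ∈-range⁻ (suc s) m i
... | a , b = <⇒≤ a , subst (x <_) (sym (+-suc s m)) b

range-unique : ∀ s m → Unique (range s m)
range-unique s zero = []
range-unique s (suc m) = All.tabulate (λ i e → <⇒≢ (proj₁ (∈-range⁻ (suc s) m i)) e) ∷ range-unique (suc s) m

map-range-suc : ∀ s m → range (suc s) m ≡ map suc (range s m)
map-range-suc s zero = refl
map-range-suc s (suc m) = cong (suc s ∷_) (map-range-suc (suc s) m)

map-const∈ : ∀ (f : A → B) {b} xs → (∀ {x} → x ∈ xs → f x ≡ b) → map f xs ≡ replicate (length xs) b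
map-const∈ f [] h = refl
map-const∈ f (x ∷ xs) h = cong₂ _∷_ (h (here refl)) (map-const∈ f xs (h ∘ there))

map-cong∈ : ∀ {f g : A → B} xs → (∀ {x} → x ∈ xs → f x ≡ g x) → map f xs ≡ map g xs
map-cong∈ [] h = refl
map-cong∈ (x ∷ xs) h = cong₂ _∷_ (h (here refl)) (map-cong∈ xs (h ∘ there))

≤ᵇ-true : ∀ {m n} → m ≤ n → (m ≤ᵇ n) ≡ true
≤ᵇ-true {m} {n} h with m ≤ᵇ n in eq
... | true = refl
... | false = ⊥-elim (subst T eq (≤⇒≤ᵇ h))

≤ᵇ-false : ∀ {m n} → n < m → (m ≤ᵇ n) ≡ false
≤ᵇ-false {m} {n} h with m ≤ᵇ n in eq
... | false = refl
... | true = ⊥-elim (<⇒≱ h (≤ᵇ⇒≤ m n (subst T (sym eq) _)))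

∑-replicate : ∀ m (x : A) f → ∑ (replicate m x) f ≡ m * f x
∑-replicate zero x f = refl
∑-replicate (suc m) x f = cong (f x +_) (∑-replicate m x f)

upset-colours : ∀ b r → map (b ≤ᵇ_) (range 0 (b + r)) ≡ replicate b false ++ replicate r true
upset-colours b r = begin
  map (b ≤ᵇ_) (range 0 (b + r)) ≡⟨ cong (map (b ≤ᵇ_)) (range-++ 0 b r) ⟩
  map (b ≤ᵇ_) (range 0 b ++ range b r) ≡⟨ map-++ (b ≤ᵇ_) (range 0 b) (range b r) ⟩
  map (b ≤ᵇ_) (range 0 b) ++ map (b ≤ᵇ_) (range b r)
    ≡⟨ cong₂ _++_ (trans (map-const∈ (b ≤ᵇ_) (range 0 b) (λ i → ≤ᵇ-false (proj₂ (∈-range⁻ 0 b i)))) (cong (λ m → replicate m false) (length-range 0 b)))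
                 (trans (map-const∈ (b ≤ᵇ_) (range b r) (λ i → ≤ᵇ-true (proj₁ (∈-range⁻ b r i)))) (cong (λ m → replicate m true) (length-range b r))) ⟩
  replicate b false ++ replicate r true ∎
  where open ≡-Reasoning

falses-blocks : ∀ b r → falses (replicate b false ++ replicate r true) ≡ b
falses-blocks b r = begin
  ∑ (replicate b false ++ replicate r true) (ind ∘ not) ≡⟨ ∑-++ (replicate b false) _ _ ⟩
  _ ≡⟨ cong₂ _+_ (∑-replicate b false _) (∑-replicate r true _) ⟩
  b * 1 + r * 0 ≡⟨ lem b r ⟩
  b ∎
  where
  open ≡-Reasoning
  lem : ∀ b r → b * 1 + r * 0 ≡ b
  lem = solve-∀

∑-range-≡ᵇ : ∀ a s m → ∑ (range s m) (λ b → ind (a ≡ᵇ b)) ≤ 1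
∑-range-≡ᵇ a s zero = z≤n
∑-range-≡ᵇ a s (suc m) with a ≡ᵇ s in eq
... | false = ∑-range-≡ᵇ a (suc s) m
... | true = s≤s (≤-reflexive (trans (∑-cong∈ (range (suc s) m) (λ i → cong ind (≡ᵇ-false a _ (λ e →
    <⇒≢ (proj₁ (∈-range⁻ (suc s) m i)) (trans (sym (≡ᵇ-true a s eq)) e))))) (∑-zero (range (suc s) m))))

∑-range-+ : ∀ s m d f → ∑ (range s m) (λ b → f (b + d)) ≡ ∑ (range (s + d) m) f
∑-range-+ s zero d f = refl
∑-range-+ s (suc m) d f = cong (f (s + d) +_) (∑-range-+ (suc s) m d f)

∈-range⁺ : ∀ s m {x} → s ≤ x → x < s + m → x ∈ range s m
∈-range⁺ s zero {x} a b = ⊥-elim (<⇒≱ b (subst (_≤ x) (sym (+-identityʳ s)) a))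
∈-range⁺ s (suc m) {x} a b with s ≟ x
... | yes refl = here refl
... | no ne = there (∈-range⁺ (suc s) m (≤∧≢⇒< a ne) (subst (x <_) (+-suc s m) b))

∑-range-≡ᵇ-one : ∀ a s m → s ≤ a → a < s + m → 1 ≤ ∑ (range s m) (λ b → ind (a ≡ᵇ b))
∑-range-≡ᵇ-one a s m p q = ≤-trans (≤-reflexive (cong ind (sym (≡ᵇ-refl a)))) (∑-∈ (λ b → ind (a ≡ᵇ b)) (∈-range⁺ s m p q))

-- Common neighbours in dense bipartite graphs

-- Drop the head if it is at most the average of the tail, otherwise keep it: either way the average
-- over the selected entries does not fall below that of the whole list.
dense-sublist : ∀ (V : List B) (a : B → ℕ) q → q ≤ length V →
  ∃[ Q ] Q ⊆ V × length Q ≡ q × q * ∑ V a ≤ length V * ∑ Q a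
dense-sublist V a zero _ = [] , minimum V , refl , z≤n
dense-sublist (v ∷ V) a (suc q) (s≤s q≤n) with length V ≤? q
... | yes n≤q = v ∷ V , ⊆-refl , cong suc (≤-antisym n≤q q≤n) , ≤-reflexive (cong (λ z → suc z * ∑ (v ∷ V) a) (≤-antisym q≤n n≤q))
... | no n≰q with m≤n⇒∃[o]m+o≡n (≰⇒> n≰q)
...   | j , n≡ with length V * a v ≤? ∑ V a
...     | yes low with dense-sublist V a (suc q) (≰⇒> n≰q)
...       | Q , s , l , h = Q , v ∷ʳ s , l , *-cancelˡ-≤ (length V) {{>-nonZero (≤-<-trans z≤n (≰⇒> n≰q))}} (begin
  length V * (suc q * (a v + ∑ V a)) ≡⟨ e₁ (length V) (suc q) (a v) (∑ V a) ⟩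
  suc q * (length V * a v) + length V * (suc q * ∑ V a) ≤⟨ +-monoˡ-≤ _ (*-monoʳ-≤ (suc q) low) ⟩
  suc (length V) * (suc q * ∑ V a) ≤⟨ *-monoʳ-≤ (suc (length V)) h ⟩
  suc (length V) * (length V * ∑ Q a) ≡⟨ e₂ (length V) (∑ Q a) ⟩
  length V * (suc (length V) * ∑ Q a) ∎)
  where
  open ≤-Reasoning
  e₁ : ∀ n q a s → n * (q * (a + s)) ≡ q * (n * a) + n * (q * s)
  e₁ = solve-∀
  e₂ : ∀ n s → suc n * (n * s) ≡ n * (suc n * s)
  e₂ = solve-∀
dense-sublist (v ∷ V) a (suc q) (s≤s q≤n) | no n≰q | j , n≡ | no high with dense-sublist V a q q≤n
... | Q , s , l , h = v ∷ Q , refl ∷ s , cong suc l , *-cancelˡ-≤ (length V) {{>-nonZero (≤-<-trans z≤n (≰⇒> n≰q))}} (begin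
  length V * (suc q * (a v + ∑ V a)) ≡⟨ cong (λ n → n * (suc q * (a v + ∑ V a))) n≡ ⟨
  (suc q + j) * (suc q * (a v + ∑ V a)) ≡⟨ e₁ q j (a v) (∑ V a) ⟩
  (suc q + j) * (suc q * a v) + suc (suc q + j) * (q * ∑ V a) + suc j * ∑ V a
    ≡⟨ cong (λ n → n * (suc q * a v) + suc n * (q * ∑ V a) + suc j * ∑ V a) n≡ ⟩
  length V * (suc q * a v) + suc (length V) * (q * ∑ V a) + suc j * ∑ V a
    ≤⟨ +-mono-≤ (+-monoʳ-≤ (length V * (suc q * a v)) (*-monoʳ-≤ (suc (length V)) h)) (*-monoʳ-≤ (suc j) (<⇒≤ (≰⇒> high))) ⟩
  length V * (suc q * a v) + suc (length V) * (length V * ∑ Q a) + suc j * (length V * a v)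
    ≡⟨ e₂ (length V) q j (a v) (∑ Q a) ⟩
  length V * (suc (suc q + j) * a v + suc (length V) * ∑ Q a)
    ≡⟨ cong (λ n → length V * (suc n * a v + suc (length V) * ∑ Q a)) n≡ ⟩
  length V * (suc (length V) * a v + suc (length V) * ∑ Q a)
    ≡⟨ cong (length V *_) (*-distribˡ-+ (suc (length V)) (a v) (∑ Q a)) ⟨
  length V * (suc (length V) * (a v + ∑ Q a)) ∎)
  where
  open ≤-Reasoning
  e₁ : ∀ q j a s → (suc q + j) * (suc q * (a + s)) ≡ (suc q + j) * (suc q * a) + suc (suc q + j) * (q * s) + suc j * s
  e₁ = solve-∀
  e₂ : ∀ n q j a s → n * (suc q * a) + suc n * (n * s) + suc j * (n * a) ≡ n * (suc (suc q + j) * a + suc n * s)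
  e₂ = solve-∀

choose : ℕ → List A → List (List A)
choose zero _ = [] ∷ []
choose (suc t) [] = []
choose (suc t) (v ∷ V) = map (v ∷_) (choose t V) ++ choose (suc t) V

∈-choose⁻ : ∀ t (V : List A) {ts} → ts ∈ choose t V → ts ⊆ V × length ts ≡ t
∈-choose⁻ zero V (here refl) = minimum V , refl
∈-choose⁻ (suc t) (v ∷ V) i with ∈-++⁻ (map (v ∷_) (choose t V)) i
... | inj₂ j = let s , l = ∈-choose⁻ (suc t) V j in v ∷ʳ s , l
... | inj₁ j with ∈-map⁻ (v ∷_) j
...   | ts , k , refl = let s , l = ∈-choose⁻ t V k in refl ∷ s , cong suc l

length-choose-≤ : ∀ t (V : List A) → length (choose t V) ≤ length V ^ t
length-choose-≤ zero V = ≤-refl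
length-choose-≤ (suc t) [] = z≤n
length-choose-≤ (suc t) (v ∷ V) = begin
  length (map (v ∷_) (choose t V) ++ choose (suc t) V) ≡⟨ length-++ (map (v ∷_) (choose t V)) ⟩
  length (map (v ∷_) (choose t V)) + length (choose (suc t) V) ≡⟨ cong (_+ length (choose (suc t) V)) (length-map _ (choose t V)) ⟩
  length (choose t V) + length (choose (suc t) V) ≤⟨ +-mono-≤ (length-choose-≤ t V) (length-choose-≤ (suc t) V) ⟩
  suc (length V) * length V ^ t ≤⟨ *-monoʳ-≤ (suc (length V)) (^-monoˡ-≤ t (n≤1+n (length V))) ⟩
  suc (length V) ^ suc t ∎
  where open ≤-Reasoning

length-choose-pos : ∀ t (V : List A) → t ≤ length V → 0 < length (choose t V)
length-choose-pos zero V _ = s≤s z≤n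
length-choose-pos (suc t) (v ∷ V) (s≤s h) = subst (0 <_) (sym (length-++ (map (v ∷_) (choose t V))))
  (<-≤-trans (length-choose-pos t V h) (≤-trans (≤-reflexive (sym (length-map _ (choose t V)))) (m≤m+n _ _)))

choose-all : ∀ t (V : List A) p → t ≤ ∑ V (ind ∘ p) → 1 ≤ ∑ (choose t V) (ind ∘ all p)
choose-all zero V p _ = s≤s z≤n
choose-all (suc t) (v ∷ V) p h = subst (1 ≤_) (sym (trans (∑-++ (map (v ∷_) (choose t V)) _ _)
  (cong (_+ ∑ (choose (suc t) V) (ind ∘ all p)) (∑-map (v ∷_) (choose t V) _)))) (go h)
  where
  go : suc t ≤ ind (p v) + ∑ V (ind ∘ p) → 1 ≤ ∑ (choose t V) (λ ts → ind (p v ∧ all p ts)) + ∑ (choose (suc t) V) (ind ∘ all p)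
  go h with p v
  ... | true = ≤-trans (choose-all t V p (≤-pred h)) (m≤m+n _ _)
  ... | false = ≤-trans (choose-all (suc t) V p h) (m≤n+m _ _)

-- A crude substitute for the convexity of binomial coefficients: a degree of at least `t` yields at
-- least one `t`-subset, and no degree exceeds `length V`. It is affordable because it is applied to
-- a short sublist, of length `2 * t * r`.
degree-bound : ∀ t (V : List A) p → ∑ V (ind ∘ p) ≤ t + length V * ∑ (choose t V) (ind ∘ all p)
degree-bound t V p with t ≤? ∑ V (ind ∘ p)
... | no h = ≤-trans (<⇒≤ (≰⇒> h)) (m≤m+n _ _)
... | yes h = ≤-trans (∑-bound V _ 1 (λ v → ind≤1 (p v))) (≤-trans (*-monoʳ-≤ (length V) (choose-all t V p h)) (m≤n+m _ t))

-- The Kővári–Sós–Turán argument; first passing to a dense sublist of V of bounded length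
-- keeps the loss polynomial in r.
common-neighbours : ∀ (X : List A) (V : List B) (R : A → B → Bool) t r .{{_ : NonZero t}} .{{_ : NonZero r}} →
  length X * length V ≤ r * ∑ X (λ x → ∑ V (ind ∘ R x)) → 2 * t * r ≤ length V →
  ∃[ ts ] ts ⊆ V × length ts ≡ t × length X ≤ 2 * r * (2 * t * r) ^ t * ∑ X (λ x → ind (all (R x) ts))
common-neighbours X V R t r inc big
  with dense-sublist V (λ v → ∑ X (λ x → ind (R x v))) (2 * t * r) big
... | Q , Q⊆V , lQ , dense
  with ∑-pigeonhole-≤ (choose t Q) (λ _ → length X) (λ ts → 2 * r * (2 * t * r) ^ t * ∑ X (λ x → ind (all (R x) ts)))
         (length-choose-pos t Q (subst (t ≤_) (sym lQ) t≤q)) total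
  where
  -- The average degree into `Q` is at least q / r = 2 t, so half of it survives the subtraction of
  -- `t` in `degree-bound`.
  q = 2 * t * r
  I = ∑ Q (λ v → ∑ X (λ x → ind (R x v)))
  S = ∑ (choose t Q) (λ ts → ∑ X (λ x → ind (all (R x) ts)))
  n = length X
  N = length V
  instance
    _ : NonZero (t * r)
    _ = m*n≢0 t r
  tr≤q : t * r ≤ q
  tr≤q = ≤-trans (m≤m+n (t * r) (t * r)) (≤-reflexive (e t r))
    where
    e : ∀ t r → t * r + t * r ≡ 2 * t * r
    e = solve-∀
  t≤q : t ≤ q
  t≤q = ≤-trans (m≤m*n t r) tr≤q
  instance
    _ : NonZero N
    _ = >-nonZero (<-≤-trans (≤-trans (s≤s z≤n) (>-nonZero⁻¹ (t * r))) (≤-trans tr≤q big))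
  open ≤-Reasoning
  inQ : n * q ≤ r * I
  inQ = *-cancelˡ-≤ N (begin
    N * (n * q) ≡⟨ e N n q ⟩
    q * (n * N) ≤⟨ *-monoʳ-≤ q inc ⟩
    q * (r * ∑ X (λ x → ∑ V (ind ∘ R x))) ≡⟨ cong (λ z → q * (r * z)) (∑-swap X V _) ⟩
    q * (r * ∑ V (λ v → ∑ X (λ x → ind (R x v)))) ≡⟨ e′ q r _ ⟩
    r * (q * ∑ V (λ v → ∑ X (λ x → ind (R x v)))) ≤⟨ *-monoʳ-≤ r dense ⟩
    r * (N * I) ≡⟨ e′ r N I ⟩
    N * (r * I) ∎)
    where
    e : ∀ N n q → N * (n * q) ≡ q * (n * N)
    e = solve-∀
    e′ : ∀ q r a → q * (r * a) ≡ r * (q * a)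
    e′ = solve-∀
  I≤ : I ≤ n * t + q * S
  I≤ = begin
    I ≡⟨ ∑-swap Q X _ ⟩
    ∑ X (λ x → ∑ Q (ind ∘ R x)) ≤⟨ ∑-mono X (λ x → degree-bound t Q (R x)) ⟩
    ∑ X (λ x → t + length Q * ∑ (choose t Q) (ind ∘ all (R x))) ≡⟨ ∑-+ X _ _ ⟩
    ∑ X (λ _ → t) + ∑ X (λ x → length Q * ∑ (choose t Q) (ind ∘ all (R x))) ≡⟨ cong₂ _+_ (∑-const X t) (∑-* (length Q) X _) ⟩
    n * t + length Q * ∑ X (λ x → ∑ (choose t Q) (ind ∘ all (R x))) ≡⟨ cong₂ (λ a b → n * t + a * b) lQ (∑-swap X (choose t Q) _) ⟩
    n * t + q * S ∎
  n≤ : n ≤ 2 * r * S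
  n≤ = *-cancelˡ-≤ (t * r) (+-cancelˡ-≤ (t * r * n) _ _ (begin
    t * r * n + t * r * n ≡⟨ e₁ t r n ⟩
    n * q ≤⟨ inQ ⟩
    r * I ≤⟨ *-monoʳ-≤ r I≤ ⟩
    r * (n * t + q * S) ≡⟨ e₂ t r n S ⟩
    t * r * n + t * r * (2 * r * S) ∎))
    where
    e₁ : ∀ t r n → t * r * n + t * r * n ≡ n * (2 * t * r)
    e₁ = solve-∀
    e₂ : ∀ t r n S → r * (n * t + 2 * t * r * S) ≡ t * r * n + t * r * (2 * r * S)
    e₂ = solve-∀
  total : ∑ (choose t Q) (λ _ → length X) ≤ ∑ (choose t Q) (λ ts → 2 * r * (2 * t * r) ^ t * ∑ X (λ x → ind (all (R x) ts)))
  total = begin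
    ∑ (choose t Q) (λ _ → n) ≡⟨ ∑-const (choose t Q) n ⟩
    length (choose t Q) * n ≤⟨ *-mono-≤ (length-choose-≤ t Q) n≤ ⟩
    length Q ^ t * (2 * r * S) ≡⟨ cong (λ z → z ^ t * (2 * r * S)) lQ ⟩
    q ^ t * (2 * r * S) ≡⟨ e (q ^ t) r S ⟩
    2 * r * q ^ t * S ≡⟨ ∑-* (2 * r * q ^ t) (choose t Q) _ ⟨
    ∑ (choose t Q) (λ ts → 2 * r * q ^ t * ∑ X (λ x → ind (all (R x) ts))) ∎
    where
    e : ∀ a r S → a * (2 * r * S) ≡ 2 * r * a * S
    e = solve-∀
... | ts , i , h = let s , l = ∈-choose⁻ t Q i in ts , ⊆-trans s Q⊆V , l , h

-- Dense k-partite hypergraphs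

tuples : List A → ∀ k → List (Vec A k)
tuples V zero = [] ∷ []
tuples V (suc k) = concatMap (λ a → map (a ∷_) (tuples V k)) V

∑-tuples-suc : ∀ (V : List A) k f → ∑ (tuples V (suc k)) f ≡ ∑ V (λ a → ∑ (tuples V k) (λ φ → f (a ∷ φ)))
∑-tuples-suc V k f = trans (∑-concatMap _ V f) (∑-cong V (λ a → ∑-map (a ∷_) (tuples V k) f))

length-tuples : ∀ (V : List A) k → length (tuples V k) ≡ length V ^ k
length-tuples V zero = refl
length-tuples V (suc k) = begin
  length (tuples V (suc k)) ≡⟨ length≡∑1 (tuples V (suc k)) ⟩
  ∑ (tuples V (suc k)) (λ _ → 1) ≡⟨ ∑-tuples-suc V k _ ⟩
  ∑ V (λ _ → ∑ (tuples V k) (λ _ → 1)) ≡⟨ ∑-const V _ ⟩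
  length V * ∑ (tuples V k) (λ _ → 1) ≡⟨ cong (length V *_) (trans (sym (length≡∑1 (tuples V k))) (length-tuples V k)) ⟩
  length V ^ suc k ∎
  where open ≡-Reasoning

fins : ∀ k → List (Fin k)
fins zero = []
fins (suc k) = zero ∷ map suc (fins k)

∈-fins : ∀ {k} (j : Fin k) → j ∈ fins k
∈-fins zero = here refl
∈-fins (suc j) = there (∈-map⁺ suc (∈-fins j))

length-fins : ∀ k → length (fins k) ≡ k
length-fins zero = refl
length-fins (suc k) = cong suc (trans (length-map suc (fins k)) (length-fins k))

∈-tuples⁻ : ∀ {Δ : List A} k {ds : Vec A k} → ds ∈ tuples Δ k → ∀ j → lookup ds j ∈ Δ
∈-tuples⁻ {Δ = Δ} (suc k) i j with find (∈-concatMap⁻ _ {xs = Δ} i)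
... | d , di , q with ∈-map⁻ (d ∷_) q
∈-tuples⁻ (suc k) i zero | d , di , q | ds , ri , refl = di
∈-tuples⁻ (suc k) i (suc j) | d , di , q | ds , ri , refl = ∈-tuples⁻ k ri j

-- A weak form of the Loomis–Whitney inequality. Shadows are counted with the irrelevant
-- coordinate included; some slice in the first coordinate inherits the hypothesis.
dense-of-shadows : ∀ k (V : List A) G (Ed : Vec A k → Bool) (Sh : Fin k → Vec A k → Bool) →
  (∀ j φ a → Ed φ ≡ true → Sh j (φ [ j ]≔ a) ≡ true) →
  ∑ (fins k) (λ j → ∑ (tuples V k) (ind ∘ Sh j)) < G * ∑ (tuples V k) (ind ∘ Ed) →
  length V ^ k ≤ G ^ k * ∑ (tuples V k) (ind ∘ Ed)
dense-of-shadows zero V G Ed Sh proj h with Ed []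
... | true = s≤s z≤n
... | false = contradiction (subst (0 <_) (*-zeroʳ G) h) (λ ())
dense-of-shadows {A = A} (suc k) V G Ed Sh proj h with ∑-pigeonhole V rest (λ a → G * e a) slice
  where
  e : A → ℕ
  e a = ∑ (tuples V k) (λ φ → ind (Ed (a ∷ φ)))
  rest : A → ℕ
  rest a = ∑ (fins k) (λ j → ∑ (tuples V k) (λ φ → ind (Sh (suc j) (a ∷ φ))))
  open ≤-Reasoning
  slice : ∑ V rest < ∑ V (λ a → G * e a)
  slice = begin-strict
    ∑ V rest ≡⟨ ∑-swap V (fins k) _ ⟩
    ∑ (fins k) (λ j → ∑ V (λ a → ∑ (tuples V k) (λ φ → ind (Sh (suc j) (a ∷ φ))))) ≡⟨ ∑-cong (fins k) (λ j → ∑-tuples-suc V k _) ⟨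
    ∑ (fins k) (λ j → ∑ (tuples V (suc k)) (ind ∘ Sh (suc j))) ≡⟨ ∑-map suc (fins k) _ ⟨
    ∑ (map suc (fins k)) (λ j → ∑ (tuples V (suc k)) (ind ∘ Sh j)) ≤⟨ m≤n+m _ _ ⟩
    ∑ (fins (suc k)) (λ j → ∑ (tuples V (suc k)) (ind ∘ Sh j)) <⟨ h ⟩
    G * ∑ (tuples V (suc k)) (ind ∘ Ed) ≡⟨ cong (G *_) (∑-tuples-suc V k _) ⟩
    G * ∑ V e ≡⟨ ∑-* G V e ⟨
    ∑ V (λ a → G * e a) ∎
... | a , _ , sl = begin
    N * N ^ k ≤⟨ *-monoʳ-≤ N (dense-of-shadows k V G (λ φ → Ed (a ∷ φ)) (λ j φ → Sh (suc j) (a ∷ φ)) (λ j φ b → proj (suc j) (a ∷ φ) b) sl) ⟩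
    N * (G ^ k * e) ≡⟨ rearr N (G ^ k) e ⟩
    G ^ k * (N * e) ≤⟨ *-monoʳ-≤ (G ^ k) (≤-trans first (≤-trans (m≤m+n _ _) (<⇒≤ h))) ⟩
    G ^ k * (G * ∑ (tuples V (suc k)) (ind ∘ Ed)) ≡⟨ rearr′ (G ^ k) G _ ⟩
    G ^ suc k * ∑ (tuples V (suc k)) (ind ∘ Ed) ∎
  where
  open ≤-Reasoning
  N = length V
  e = ∑ (tuples V k) (λ φ → ind (Ed (a ∷ φ)))
  rearr : ∀ a b c → a * (b * c) ≡ b * (a * c)
  rearr = solve-∀
  rearr′ : ∀ a b c → a * (b * c) ≡ b * a * c
  rearr′ = solve-∀
  each : ∀ b φ → ind (Ed (a ∷ φ)) ≤ ind (Sh zero (b ∷ φ))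
  each b φ with Ed (a ∷ φ) in eq
  ... | false = z≤n
  ... | true = ≤-reflexive (sym (cong ind (proj zero (a ∷ φ) b eq)))
  -- Direction zero forgets the first coordinate, so each edge of the slice at `a` gives a shadow
  -- for every `b`. Through `h` this compares the slice with the whole hypergraph.
  first : N * e ≤ ∑ (tuples V (suc k)) (ind ∘ Sh zero)
  first = begin
    N * e ≡⟨ ∑-const V e ⟨
    ∑ V (λ _ → e) ≤⟨ ∑-mono V (λ b → ∑-mono (tuples V k) (each b)) ⟩
    ∑ V (λ b → ∑ (tuples V k) (λ φ → ind (Sh zero (b ∷ φ)))) ≡⟨ ∑-tuples-suc V k _ ⟨
    ∑ (tuples V (suc k)) (ind ∘ Sh zero) ∎

-- If the density is 1 / r before an application of `common-neighbours`, it is at least 1 / `κ t r`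
-- afterwards. The value is polynomial in r, of degree t + 1; the exponent `E` depends on this.
κ : ℕ → ℕ → ℕ
κ t r = 2 * r * (2 * t * r) ^ t

κ^ : ℕ → ℕ → ℕ → ℕ
κ^ t zero r = r
κ^ t (suc k) r = κ^ t k (κ t r)

r≤κ : ∀ t r .{{_ : NonZero t}} .{{_ : NonZero r}} → r ≤ κ t r
r≤κ t r = ≤-trans (m≤n*m r 2) (m≤m*n (2 * r) ((2 * t * r) ^ t) {{m^n≢0 (2 * t * r) t {{m*n≢0 (2 * t) r {{m*n≢0 2 t}}}}}})

κ-nonZero : ∀ t r .{{_ : NonZero t}} .{{_ : NonZero r}} → NonZero (κ t r)
κ-nonZero t r = >-nonZero (<-≤-trans (>-nonZero⁻¹ r) (r≤κ t r))

r≤κ^ : ∀ t k r .{{_ : NonZero t}} .{{_ : NonZero r}} → r ≤ κ^ t k r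
r≤κ^ t zero r = ≤-refl
r≤κ^ t (suc k) r = ≤-trans (r≤κ t r) (r≤κ^ t k (κ t r) {{it}} {{κ-nonZero t r}})

all-∈ : ∀ (p : A → Bool) xs → all p xs ≡ true → ∀ {x} → x ∈ xs → p x ≡ true
all-∈ p (x ∷ xs) h i with p x in eq
all-∈ p (x ∷ xs) h (here refl) | true = eq
all-∈ p (x ∷ xs) h (there i) | true = all-∈ p xs h i

-- Erdős's theorem on complete k-partite sub-hypergraphs: one part is split off at a time,
-- the remaining coordinates being regarded as one side of a bipartite graph.
complete-partite : ∀ k (V : List A) t r (Ed : Vec A k → Bool) .{{_ : NonZero t}} .{{_ : NonZero r}} →
  length V ^ k ≤ r * ∑ (tuples V k) (ind ∘ Ed) → 2 * t * κ^ t k r ≤ length V →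
  ∃[ Ts ] (∀ j → lookup {n = k} Ts j ⊆ V × length (lookup Ts j) ≡ t) ×
          (∀ φ → (∀ j → lookup φ j ∈ lookup Ts j) → Ed φ ≡ true)
complete-partite zero V t r Ed h _ with Ed [] in eq
... | true = [] , (λ ()) , λ { [] _ → eq }
... | false = contradiction (subst (1 ≤_) (*-zeroʳ r) h) (λ ())
complete-partite (suc k) V t r Ed h big =
  let ts , ts⊆V , lts , h′ = common-neighbours (tuples V k) V (λ φ a → Ed (a ∷ φ)) t r inc (≤-trans (*-monoʳ-≤ (2 * t) (r≤κ^ t (suc k) r)) big)
      Ts , sub , com = complete-partite k V t (κ t r) (λ φ → all (λ a → Ed (a ∷ φ)) ts) {{it}} {{κ-nonZero t r}}
                         (≤-trans (≤-reflexive (sym (length-tuples V k))) h′) big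
  in ts ∷ Ts , (λ { zero → ts⊆V , lts ; (suc j) → sub j }) ,
     λ { (a ∷ φ) m → all-∈ (λ a → Ed (a ∷ φ)) ts (com φ (m ∘ suc)) (m zero) }
  where
  open ≤-Reasoning
  inc : length (tuples V k) * length V ≤ r * ∑ (tuples V k) (λ φ → ∑ V (λ a → ind (Ed (a ∷ φ))))
  inc = begin
    length (tuples V k) * length V ≡⟨ cong (_* length V) (length-tuples V k) ⟩
    length V ^ k * length V ≡⟨ *-comm (length V ^ k) (length V) ⟩
    length V ^ suc k ≤⟨ h ⟩
    r * ∑ (tuples V (suc k)) (ind ∘ Ed) ≡⟨ cong (r *_) (trans (∑-tuples-suc V k _) (∑-swap V (tuples V k) _)) ⟩
    r * ∑ (tuples V k) (λ φ → ∑ V (λ a → ind (Ed (a ∷ φ)))) ∎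

-- Labelled ground sets: segments, blocks and blow-ups

replicate-+ : ∀ a b (x : A) → replicate (a + b) x ≡ replicate a x ++ replicate b x
replicate-+ zero b x = refl
replicate-+ (suc a) b x = cong (x ∷_) (replicate-+ a b x)

concatMap-↭ : ∀ (f : A → List B) {xs ys} → xs ↭ ys → concatMap f xs ↭ concatMap f ys
concatMap-↭ f refl = ↭-refl
concatMap-↭ f (prep x p) = ↭P.++⁺ˡ (f x) (concatMap-↭ f p)
concatMap-↭ f (swap x y p) = ↭-trans (↭P.shifts (f x) (f y)) (↭P.++⁺ˡ (f y) (↭P.++⁺ˡ (f x) (concatMap-↭ f p)))
concatMap-↭ f (transₚ p q) = ↭-trans (concatMap-↭ f p) (concatMap-↭ f q)

sublist-complement : ∀ {xs ys : List A} → xs ⊆ ys → Unique ys → ∃[ zs ] ys ↭ xs ++ zs × (∀ {z} → z ∈ zs → z ∉ xs)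
sublist-complement [] _ = [] , ↭-refl , λ ()
sublist-complement {xs = xs} (y ∷ʳ s) (y∉ ∷ u) with sublist-complement s u
... | zs , p , d = y ∷ zs , ↭-trans (prep y p) (↭-sym (↭P.shift y xs zs)) , λ
  { (here refl) i → All.lookup y∉ (Sub.lookup s i) refl ; (there i) → d i }
sublist-complement {xs = x ∷ xs} (refl ∷ s) (x∉ ∷ u) with sublist-complement s u
... | zs , p , d = zs , prep x p , λ
  { i (here refl) → All.lookup x∉ (↭P.∈-resp-↭ (↭-sym p) (∈-++⁺ʳ xs i)) refl ; i (there j) → d i j }

Unique-⊆ : ∀ {xs ys : List A} → xs ⊆ ys → Unique ys → Unique xs
Unique-⊆ [] _ = []
Unique-⊆ (y ∷ʳ s) (_ ∷ u) = Unique-⊆ s u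
Unique-⊆ (refl ∷ s) (x∉ ∷ u) = All-resp-⊆ s x∉ ∷ Unique-⊆ s u

-- Labels of ground-set elements relative to a set B of a family: out is the complement of B,
-- and seg v o is the o-th element of the v-th segment, so that cut v d is B without the
-- first d elements of segment v. After colouring, seg j 0 marks the j-th removed block.
data Label : Set where
  out core : Label
  seg : ℕ → ℕ → Label

bump : Label → Label
bump out = out
bump core = core
bump (seg j o) = seg (suc j) o

full : Label → Bool
full out = false
full core = true
full (seg _ _) = true

cut : ℕ → ℕ → Label → Bool
cut v d out = false
cut v d core = true
cut v d (seg u o) = not ((u ≡ᵇ v) ∧ (o <ᵇ d))

off : ℕ → Label → Bool
off j out = false
off j core = true
off j (seg i _) = not (i ≡ᵇ j)

segment : ℕ → ℕ → List Label
segment w v = map (seg v) (range 0 w)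

template : (b M w r : ℕ) → List Label
template b M w r = replicate b out ++ concatMap (segment w) (range 0 M) ++ replicate r core

-- Keeps the `k` segments along which B has been found to descend and numbers them afresh; all other
-- segments merge into the core.
select : ∀ {k} → Vec ℕ k → ℕ → ℕ → Label
select [] v o = core
select (u ∷ us) v o = if v ≡ᵇ u then seg 0 o else bump (select us v o)

relabel : ∀ {k} → Vec ℕ k → Label → Label
relabel us out = out
relabel us core = core
relabel us (seg v o) = select us v o

segments : ℕ → ℕ → List Label
segments w zero = []
segments w (suc k) = segment w 0 ++ map bump (segments w k)

paint : ∀ {k} → Vec ℕ k → ℕ → ℕ → Label
paint [] j o = core
paint (d ∷ ds) zero o = if o <ᵇ d then seg 0 0 else core
paint (d ∷ ds) (suc j) o = bump (paint ds j o)

colour : ∀ {k} → Vec ℕ k → Label → Label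
colour ds out = out
colour ds core = core
colour ds (seg j o) = paint ds j o

blocks : ∀ {k} → Vec ℕ k → List Label
blocks [] = []
blocks (d ∷ ds) = replicate d (seg 0 0) ++ map bump (blocks ds)

-- The multiset of labels after selection and colouring. It remembers the sizes of the blocks but
-- not the segments they came from, so the count `edges` depends on `b` and `ds` only and applies to
-- blow-ups as well.
canonical : ∀ {k} → ℕ → Vec ℕ k → ℕ → List Label
canonical b ds r = replicate b out ++ blocks ds ++ replicate r core

map-concatMap-const : ∀ (f : A → B) (g : D → List A) {c} w xs → (∀ {x} → x ∈ xs → map f (g x) ≡ replicate w c) →
  map f (concatMap g xs) ≡ replicate (length xs * w) c
map-concatMap-const f g w [] h = refl
map-concatMap-const f g {c} w (x ∷ xs) h = trans (map-++ f (g x) _)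
  (trans (cong₂ _++_ (h (here refl)) (map-concatMap-const f g w xs (h ∘ there))) (sym (replicate-+ w (length xs * w) c)))

select-∉ : ∀ {k} (us : Vec ℕ k) v o → v ∉ toList us → select us v o ≡ core
select-∉ [] v o _ = refl
select-∉ (u ∷ us) v o v∉ rewrite ≡ᵇ-false v u (λ e → v∉ (here e)) | select-∉ us v o (v∉ ∘ there) = refl

select-segments : ∀ {k} w (us : Vec ℕ k) → Unique (toList us) →
  map (relabel us) (concatMap (segment w) (toList us)) ≡ segments w k
select-segments w [] _ = refl
select-segments {suc k} w (u ∷ us) (u∉ ∷ un) = trans (map-++ (relabel (u ∷ us)) (segment w u) _) (cong₂ _++_ first rest)
  where
  open ≡-Reasoning
  first : map (relabel (u ∷ us)) (map (seg u) (range 0 w)) ≡ map (seg 0) (range 0 w)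
  first = trans (sym (map-∘ (range 0 w))) (map-cong (λ o → cong (λ z → if z then seg 0 o else bump (select us u o)) (≡ᵇ-refl u)) (range 0 w))
  agree : ∀ vs → (∀ {v} → v ∈ vs → v ≢ u) →
    map (relabel (u ∷ us)) (concatMap (segment w) vs) ≡ map (bump ∘ relabel us) (concatMap (segment w) vs)
  agree [] _ = refl
  agree (v ∷ vs) h = begin
    map (relabel (u ∷ us)) (segment w v ++ concatMap (segment w) vs) ≡⟨ map-++ _ (segment w v) _ ⟩
    map (relabel (u ∷ us)) (segment w v) ++ _ ≡⟨ cong₂ _++_ one (agree vs (h ∘ there)) ⟩
    map (bump ∘ relabel us) (segment w v) ++ _ ≡⟨ map-++ _ (segment w v) _ ⟨
    map (bump ∘ relabel us) (segment w v ++ concatMap (segment w) vs) ∎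
    where
    one : map (relabel (u ∷ us)) (map (seg v) (range 0 w)) ≡ map (bump ∘ relabel us) (map (seg v) (range 0 w))
    one = trans (sym (map-∘ (range 0 w))) (trans (map-cong (λ o → cong (λ z → if z then seg 0 o else bump (select us v o)) (≡ᵇ-false v u (h (here refl)))) (range 0 w)) (map-∘ (range 0 w)))
  rest : map (relabel (u ∷ us)) (concatMap (segment w) (toList us)) ≡ map bump (segments w k)
  rest = begin
    map (relabel (u ∷ us)) (concatMap (segment w) (toList us)) ≡⟨ agree (toList us) (λ i e → All.lookup u∉ i (sym e)) ⟩
    map (bump ∘ relabel us) (concatMap (segment w) (toList us)) ≡⟨ map-∘ (concatMap (segment w) (toList us)) ⟩
    map bump (map (relabel us) (concatMap (segment w) (toList us))) ≡⟨ cong (map bump) (select-segments w us un) ⟩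
    map bump (segments w k) ∎

relabel-template : ∀ {k} b M w r (us : Vec ℕ k) → toList us ⊆ range 0 M →
  ∃[ r′ ] map (relabel us) (template b M w r) ↭ replicate b out ++ segments w k ++ replicate r′ core
relabel-template {k} b M w r us s with sublist-complement s (range-unique 0 M)
... | os , p , d = length os * w + r , (begin
    map (relabel us) (template b M w r) ≡⟨ map-++ _ (replicate b out) _ ⟩
    map (relabel us) (replicate b out) ++ map (relabel us) (concatMap (segment w) (range 0 M) ++ replicate r core)
      ≡⟨ cong₂ _++_ (map-replicate (relabel us) b out) (trans (map-++ _ (concatMap (segment w) (range 0 M)) _) (cong (map (relabel us) (concatMap (segment w) (range 0 M)) ++_) (map-replicate (relabel us) r core))) ⟩
    replicate b out ++ map (relabel us) (concatMap (segment w) (range 0 M)) ++ replicate r core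
      ↭⟨ ↭P.++⁺ˡ (replicate b out) (↭P.++⁺ʳ (replicate r core) middle) ⟩
    replicate b out ++ (segments w k ++ replicate (length os * w) core) ++ replicate r core
      ≡⟨ cong (replicate b out ++_) (trans (++-assoc (segments w k) _ _) (cong (segments w k ++_) (sym (replicate-+ (length os * w) r core)))) ⟩
    replicate b out ++ segments w k ++ replicate (length os * w + r) core ∎)
  where
  open PermutationReasoning
  unique-us : Unique (toList us)
  unique-us = Unique-⊆ s (range-unique 0 M)
  middle : map (relabel us) (concatMap (segment w) (range 0 M)) ↭ segments w k ++ replicate (length os * w) core
  middle = begin
    map (relabel us) (concatMap (segment w) (range 0 M)) ↭⟨ ↭P.map⁺ (relabel us) (concatMap-↭ (segment w) p) ⟩
    map (relabel us) (concatMap (segment w) (toList us ++ os)) ≡⟨ cong (map (relabel us)) (concatMap-++ (segment w) (toList us) os) ⟩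
    map (relabel us) (concatMap (segment w) (toList us) ++ concatMap (segment w) os) ≡⟨ map-++ _ (concatMap (segment w) (toList us)) _ ⟩
    map (relabel us) (concatMap (segment w) (toList us)) ++ map (relabel us) (concatMap (segment w) os)
      ≡⟨ cong₂ _++_ (select-segments w us unique-us) (map-concatMap-const (relabel us) (segment w) w os none) ⟩
    segments w k ++ replicate (length os * w) core ∎
    where
    none : ∀ {v} → v ∈ os → map (relabel us) (segment w v) ≡ replicate w core
    none {v} i = trans (sym (map-∘ (range 0 w))) (trans (map-const∈ _ (range 0 w) (λ {o} _ → select-∉ us v o (d i))) (cong (λ m → replicate m core) (length-range 0 w)))

<ᵇ-true : ∀ {m n} → m < n → (m <ᵇ n) ≡ true
<ᵇ-true = ≤ᵇ-true

<ᵇ-false : ∀ {m n} → n ≤ m → (m <ᵇ n) ≡ false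
<ᵇ-false h = ≤ᵇ-false (s≤s h)

colour-segments : ∀ {k} w (ds : Vec ℕ k) → (∀ j → lookup ds j ≤ w) →
  ∃[ r ] map (colour ds) (segments w k) ↭ blocks ds ++ replicate r core
colour-segments w [] _ = 0 , ↭-refl
colour-segments {suc k} w (d ∷ ds) h with colour-segments w ds (h ∘ suc) | m≤n⇒∃[o]m+o≡n (h zero)
... | r , p | e , d+e≡w = e + r , (begin
    map (colour (d ∷ ds)) (segment w 0 ++ map bump (segments w k)) ≡⟨ map-++ _ (segment w 0) _ ⟩
    map (colour (d ∷ ds)) (segment w 0) ++ map (colour (d ∷ ds)) (map bump (segments w k)) ≡⟨ cong₂ _++_ first rest ⟩
    (replicate d (seg 0 0) ++ replicate e core) ++ map bump (map (colour ds) (segments w k)) ↭⟨ ↭P.++⁺ˡ (replicate d (seg 0 0) ++ replicate e core) (↭P.map⁺ bump p) ⟩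
    (replicate d (seg 0 0) ++ replicate e core) ++ map bump (blocks ds ++ replicate r core) ≡⟨ ++-assoc (replicate d (seg 0 0)) _ _ ⟩
    replicate d (seg 0 0) ++ replicate e core ++ map bump (blocks ds ++ replicate r core)
      ≡⟨ cong (λ z → replicate d (seg 0 0) ++ replicate e core ++ z) (trans (map-++ bump (blocks ds) _) (cong (map bump (blocks ds) ++_) (map-replicate bump r core))) ⟩
    replicate d (seg 0 0) ++ replicate e core ++ map bump (blocks ds) ++ replicate r core ↭⟨ ↭P.++⁺ˡ (replicate d (seg 0 0)) (↭P.shifts (replicate e core) (map bump (blocks ds))) ⟩
    replicate d (seg 0 0) ++ map bump (blocks ds) ++ replicate e core ++ replicate r core
      ≡⟨ trans (cong (λ z → replicate d (seg 0 0) ++ map bump (blocks ds) ++ z) (sym (replicate-+ e r core))) (sym (++-assoc (replicate d (seg 0 0)) _ _)) ⟩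
    blocks (d ∷ ds) ++ replicate (e + r) core ∎)
  where
  open PermutationReasoning
  first : map (colour (d ∷ ds)) (map (seg 0) (range 0 w)) ≡ replicate d (seg 0 0) ++ replicate e core
  first = trans (sym (map-∘ (range 0 w))) (trans (cong (map _) (trans (cong (range 0) (sym d+e≡w)) (range-++ 0 d e)))
    (trans (map-++ _ (range 0 d) (range d e)) (cong₂ _++_
      (trans (map-const∈ _ (range 0 d) (λ {o} i → cong (λ z → if z then seg 0 0 else core) (<ᵇ-true (proj₂ (∈-range⁻ 0 d i))))) (cong (λ m → replicate m (seg 0 0)) (length-range 0 d)))
      (trans (map-const∈ _ (range d e) (λ {o} i → cong (λ z → if z then seg 0 0 else core) (<ᵇ-false (proj₁ (∈-range⁻ d e i))))) (cong (λ m → replicate m core) (length-range d e))))))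
  rest : map (colour (d ∷ ds)) (map bump (segments w k)) ≡ map bump (map (colour ds) (segments w k))
  rest = trans (sym (map-∘ (segments w k))) (trans (map-cong (λ { out → refl ; core → refl ; (seg j o) → refl }) (segments w k)) (map-∘ (segments w k)))

colour-template : ∀ {k} b M w r (us ds : Vec ℕ k) → toList us ⊆ range 0 M → (∀ j → lookup ds j ≤ w) →
  ∃[ r′ ] map (colour ds ∘ relabel us) (template b M w r) ↭ canonical b ds r′
colour-template {k} b M w r us ds s h with relabel-template b M w r us s | colour-segments w ds h
... | r₁ , p | r₂ , q = r₂ + r₁ , (begin
    map (colour ds ∘ relabel us) (template b M w r) ≡⟨ map-∘ (template b M w r) ⟩
    map (colour ds) (map (relabel us) (template b M w r)) ↭⟨ ↭P.map⁺ (colour ds) p ⟩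
    map (colour ds) (replicate b out ++ segments w k ++ replicate r₁ core)
      ≡⟨ trans (map-++ _ (replicate b out) _) (cong₂ _++_ (map-replicate (colour ds) b out) (trans (map-++ _ (segments w k) _) (cong (map (colour ds) (segments w k) ++_) (map-replicate (colour ds) r₁ core)))) ⟩
    replicate b out ++ map (colour ds) (segments w k) ++ replicate r₁ core
      ↭⟨ ↭P.++⁺ˡ (replicate b out) (↭P.++⁺ʳ (replicate r₁ core) q) ⟩
    replicate b out ++ (blocks ds ++ replicate r₂ core) ++ replicate r₁ core
      ≡⟨ cong (replicate b out ++_) (trans (++-assoc (blocks ds) _ _) (cong (blocks ds ++_) (sym (replicate-+ r₂ r₁ core)))) ⟩
    canonical b ds (r₂ + r₁) ∎)
  where open PermutationReasoning

full-select : ∀ {k} (us ds : Vec ℕ k) v o → full (colour ds (select us v o)) ≡ true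
full-select [] [] v o = refl
full-select (u ∷ us) (d ∷ ds) v o with v ≡ᵇ u
... | true with o <ᵇ d
...   | true = refl
...   | false = refl
full-select (u ∷ us) (d ∷ ds) v o | false with select us v o | full-select us ds v o
... | core | _ = refl
... | seg j o′ | e = trans (full-bump (paint ds j o′)) e
  where
  full-bump : ∀ x → full (bump x) ≡ full x
  full-bump out = refl
  full-bump core = refl
  full-bump (seg _ _) = refl

full-colour : ∀ {k} (us ds : Vec ℕ k) x → full (colour ds (relabel us x)) ≡ full x
full-colour us ds out = refl
full-colour us ds core = refl
full-colour us ds (seg v o) = full-select us ds v o

off-zero-bump : ∀ x → off 0 (bump x) ≡ full x
off-zero-bump out = refl
off-zero-bump core = refl
off-zero-bump (seg _ _) = refl

off-suc-bump : ∀ j x → off (suc j) (bump x) ≡ off j x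
off-suc-bump j out = refl
off-suc-bump j core = refl
off-suc-bump j (seg _ _) = refl

colour-bump : ∀ {k} d (ds : Vec ℕ k) x → colour (d ∷ ds) (bump x) ≡ bump (colour ds x)
colour-bump d ds out = refl
colour-bump d ds core = refl
colour-bump d ds (seg j o) = refl

lookup∈toList : ∀ {k} (us : Vec A k) j → lookup us j ∈ toList us
lookup∈toList (u ∷ us) zero = here refl
lookup∈toList (u ∷ us) (suc j) = there (lookup∈toList us j)

off-select : ∀ {k} (us ds : Vec ℕ k) → Unique (toList us) → ∀ j v o →
  off (toℕ j) (colour ds (select us v o)) ≡ cut (lookup us j) (lookup ds j) (seg v o)
off-select (u ∷ us) (d ∷ ds) un zero v o with v ≡ᵇ u
... | true with o <ᵇ d
...   | true = refl
...   | false = refl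
off-select (u ∷ us) (d ∷ ds) un zero v o | false = trans (cong (off 0) (colour-bump d ds (select us v o)))
  (trans (off-zero-bump (colour ds (select us v o))) (full-select us ds v o))
off-select (u ∷ us) (d ∷ ds) (u∉ ∷ un) (suc j) v o with v ≡ᵇ u in eq
... | false = trans (cong (off (suc (toℕ j))) (colour-bump d ds (select us v o)))
  (trans (off-suc-bump (toℕ j) (colour ds (select us v o))) (off-select us ds un j v o))
... | true rewrite ≡ᵇ-false v (lookup us j) (λ e → All.lookup u∉ (lookup∈toList us j) (trans (sym (≡ᵇ-true v u eq)) e)) with o <ᵇ d
...   | true = refl
...   | false = refl

-- `select` stops at the first match, so the entries of `us` must be distinct for position `j` to
-- control exactly the segment `lookup us j`. Then removing block `j` after colouring is a cut of
-- that segment.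
off-colour : ∀ {k} (us ds : Vec ℕ k) → Unique (toList us) → ∀ j x →
  off (toℕ j) (colour ds (relabel us x)) ≡ cut (lookup us j) (lookup ds j) x
off-colour us ds un j out = refl
off-colour us ds un j core = refl
off-colour us ds un j (seg v o) = off-select us ds un j v o

-- The j-th part of the k-partite hypergraph consists of subsets, indexed by I, of a fixed set;
-- an element of that set is labelled col j h, where h says which of the subsets contain it.
data WLabel (I : Set) : Set where
  out core : WLabel I
  col : ℕ → (I → Bool) → WLabel I

wbump : ∀ {I : Set} → WLabel I → WLabel I
wbump out = out
wbump core = core
wbump (col j h) = col (suc j) h

columns : ∀ {I : Set} {k} → Vec (List (I → Bool)) k → List (WLabel I)
columns [] = []
columns (c ∷ cs) = map (col 0) c ++ map wbump (columns cs)

-- An element of part `j` that the chosen subset omits becomes `out`, not `core`: it lies neither in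
-- B nor in any B minus D_i.
pick : ∀ {I : Set} {k} → Vec I k → ℕ → (I → Bool) → Label
pick [] j h = core
pick (a ∷ φ) zero h = if h a then seg 0 0 else out
pick (a ∷ φ) (suc j) h = bump (pick φ j h)

tint : ∀ {I : Set} {k} → Vec I k → WLabel I → Label
tint φ out = out
tint φ core = core
tint φ (col j h) = pick φ j h

map-if-↭ : ∀ (p : A → Bool) (x y : B) xs d e → ∑ xs (ind ∘ p) ≡ d → length xs ≡ d + e →
  map (λ a → if p a then x else y) xs ↭ replicate d x ++ replicate e y
map-if-↭ p x y [] d e refl l = ↭-reflexive (cong (λ m → replicate m y) l)
map-if-↭ p x y (a ∷ xs) d e s l with p a
map-if-↭ p x y (a ∷ xs) (suc d) e s l | true = prep x (map-if-↭ p x y xs d e (suc-injective s) (suc-injective l))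
map-if-↭ p x y (a ∷ xs) d (suc e) s l | false = ↭-trans (prep y (map-if-↭ p x y xs d e s (suc-injective (trans l (+-suc d e))))) (↭-sym (↭P.shift y (replicate d x) (replicate e y)))
map-if-↭ p x y (a ∷ xs) d zero s l | false = ⊥-elim (<⇒≱ (≤-reflexive (trans l (+-identityʳ d))) (≤-trans (≤-reflexive (sym s))
  (≤-trans (∑-bound xs _ 1 (λ a → ind≤1 (p a))) (≤-reflexive (*-identityʳ _)))))

tint-columns : ∀ {I : Set} {k} (cs : Vec (List (I → Bool)) k) (φ : Vec I k) (ds : Vec ℕ k) e →
  (∀ j a → ∑ (lookup cs j) (λ h → ind (h a)) ≡ lookup ds j) → (∀ j → length (lookup cs j) ≡ lookup ds j + e) →
  map (tint φ) (columns cs) ↭ replicate (k * e) out ++ blocks ds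
tint-columns [] [] [] e _ _ = ↭-refl
tint-columns {k = suc k} (c ∷ cs) (a ∷ φ) (d ∷ ds) e s l = begin
  map (tint (a ∷ φ)) (map (col 0) c ++ map wbump (columns cs)) ≡⟨ map-++ _ (map (col 0) c) _ ⟩
  map (tint (a ∷ φ)) (map (col 0) c) ++ map (tint (a ∷ φ)) (map wbump (columns cs)) ≡⟨ cong₂ _++_ (sym (map-∘ c)) rest ⟩
  map (λ h → if h a then seg 0 0 else out) c ++ map bump (map (tint φ) (columns cs))
    ↭⟨ ↭P.++⁺ (map-if-↭ (λ h → h a) (seg 0 0) out c d e (s zero a) (l zero)) (↭P.map⁺ bump (tint-columns cs φ ds e (s ∘ suc) (l ∘ suc))) ⟩
  (replicate d (seg 0 0) ++ replicate e out) ++ map bump (replicate (k * e) out ++ blocks ds)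
    ≡⟨ cong ((replicate d (seg 0 0) ++ replicate e out) ++_) (trans (map-++ bump (replicate (k * e) out) _) (cong (_++ map bump (blocks ds)) (map-replicate bump (k * e) out))) ⟩
  (replicate d (seg 0 0) ++ replicate e out) ++ (replicate (k * e) out ++ map bump (blocks ds)) ≡⟨ ++-assoc (replicate d (seg 0 0)) _ _ ⟩
  replicate d (seg 0 0) ++ replicate e out ++ (replicate (k * e) out ++ map bump (blocks ds)) ≡⟨ cong (replicate d (seg 0 0) ++_) (trans (sym (++-assoc (replicate e out) _ _)) (cong (_++ map bump (blocks ds)) (sym (replicate-+ e (k * e) out)))) ⟩
  replicate d (seg 0 0) ++ replicate (suc k * e) out ++ map bump (blocks ds) ↭⟨ ↭P.shifts (replicate d (seg 0 0)) (replicate (suc k * e) out) ⟩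
  replicate (suc k * e) out ++ blocks (d ∷ ds) ∎
  where
  open PermutationReasoning
  rest : map (tint (a ∷ φ)) (map wbump (columns cs)) ≡ map bump (map (tint φ) (columns cs))
  rest = trans (sym (map-∘ (columns cs))) (trans (map-cong (λ { out → refl ; core → refl ; (col j h) → refl }) (columns cs)) (map-∘ (columns cs)))

wtemplate : ∀ {I : Set} {k} → ℕ → Vec (List (I → Bool)) k → ℕ → List (WLabel I)
wtemplate b cs r = replicate b out ++ columns cs ++ replicate r core

-- All subsets indexed within a part have the same size, so the resulting multiset does not depend
-- on `φ`. Consequently every `φ` is an edge for equally many orderings.
tint-template : ∀ {I : Set} {k} b (cs : Vec (List (I → Bool)) k) r (φ : Vec I k) (ds : Vec ℕ k) e →
  (∀ j a → ∑ (lookup cs j) (λ h → ind (h a)) ≡ lookup ds j) → (∀ j → length (lookup cs j) ≡ lookup ds j + e) →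
  map (tint φ) (wtemplate b cs r) ↭ canonical (b + k * e) ds r
tint-template {k = k} b cs r φ ds e s l = begin
  map (tint φ) (wtemplate b cs r)
    ≡⟨ trans (map-++ _ (replicate b out) _) (cong₂ _++_ (map-replicate (tint φ) b out) (trans (map-++ _ (columns cs) _) (cong (map (tint φ) (columns cs) ++_) (map-replicate (tint φ) r core)))) ⟩
  replicate b out ++ map (tint φ) (columns cs) ++ replicate r core
    ↭⟨ ↭P.++⁺ˡ (replicate b out) (↭P.++⁺ʳ (replicate r core) (tint-columns cs φ ds e s l)) ⟩
  replicate b out ++ (replicate (k * e) out ++ blocks ds) ++ replicate r core
    ≡⟨ trans (cong (replicate b out ++_) (++-assoc (replicate (k * e) out) _ _)) (trans (sym (++-assoc (replicate b out) _ _)) (cong (_++ (blocks ds ++ replicate r core)) (sym (replicate-+ b (k * e) out)))) ⟩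
  canonical (b + k * e) ds r ∎
  where open PermutationReasoning

-- Members met by a random chain, and descents along segments

any-∈ : ∀ (p : A → Bool) {xs x} → x ∈ xs → p x ≡ true → any p xs ≡ true
any-∈ p (here refl) e rewrite e = refl
any-∈ p {y ∷ xs} (there i) e with p y
... | true = refl
... | false = any-∈ p i e

any-false : ∀ (p : A → Bool) {xs x} → any p xs ≡ false → x ∈ xs → p x ≡ false
any-false p {xs} {x} h i with p x in eq
... | false = refl
... | true = trans (sym (any-∈ p i eq)) h

-- All hits but the last are followed by another one, at distance at most `w` because the window has
-- at most `w` + 1 places.
hits-surplus : ∀ (h : ℕ → Bool) w lo m → m ≤ suc w →
  ∑ (range lo m) (ind ∘ h) ≤ 1 + ∑ (range lo m) (λ b → ind (h b ∧ any (λ d → h (b + d)) (range 1 w)))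
hits-surplus h w lo zero _ = z≤n
hits-surplus h w lo (suc m) (s≤s m≤w) with h lo
... | false = hits-surplus h w (suc lo) m (m≤n⇒m≤1+n m≤w)
... | true with any (λ d → h (lo + d)) (range 1 w) in eq
...   | true = s≤s (hits-surplus h w (suc lo) m (m≤n⇒m≤1+n m≤w))
...   | false = s≤s (≤-trans (≤-reflexive (trans (∑-cong∈ (range (suc lo) m) none) (∑-zero (range (suc lo) m)))) z≤n)
  where
  none : ∀ {x} → x ∈ range (suc lo) m → ind (h x) ≡ 0
  none {x} i with ∈-range⁻ (suc lo) m i
  ... | lo<x , x<hi with m≤n⇒∃[o]m+o≡n lo<x
  ...   | o , refl = cong ind (trans (cong h (sym (+-suc lo o))) (any-false (λ d → h (lo + d)) eq
          (∈-range⁺ 1 w (s≤s z≤n) (s≤s (≤-trans (+-cancelˡ-≤ (suc lo) _ _ (subst (_≤ suc lo + m) (sym (+-suc (suc lo) o)) x<hi)) m≤w)))))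

ind-∨ : ∀ a b → ind (a ∨ b) ≤ ind a + ind b
ind-∨ true b = s≤s z≤n
ind-∨ false b = ≤-refl

ind-∧ : ∀ a b → ind (a ∧ b) ≡ ind a * ind b
ind-∧ true b = sym (+-identityʳ _)
ind-∧ false b = refl

any-concatMap : ∀ (p : B → Bool) (f : A → List B) xs → ind (any p (concatMap f xs)) ≤ ∑ xs (λ x → ind (any p (f x)))
any-concatMap p f [] = z≤n
any-concatMap p f (x ∷ xs) = ≤-trans (split (f x)) (+-monoʳ-≤ (ind (any p (f x))) (any-concatMap p f xs))
  where
  split : ∀ ys → ind (any p (ys ++ concatMap f xs)) ≤ ind (any p ys) + ind (any p (concatMap f xs))
  split [] = ≤-refl
  split (y ∷ ys) with p y
  ... | true = s≤s z≤n
  ... | false = split ys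

any-cong∈ : ∀ {p q : A → Bool} xs → (∀ {x} → x ∈ xs → p x ≡ q x) → any p xs ≡ any q xs
any-cong∈ [] h = refl
any-cong∈ (x ∷ xs) h = cong₂ _∨_ (h (here refl)) (any-cong∈ xs (h ∘ there))

all-cong∈ : ∀ {p q : A → Bool} xs → (∀ {x} → x ∈ xs → p x ≡ q x) → all p xs ≡ all q xs
all-cong∈ [] h = refl
all-cong∈ (x ∷ xs) h = cong₂ _∧_ (h (here refl)) (all-cong∈ xs (h ∘ there))

all-map : ∀ (f : A → B) (p : B → Bool) xs → all p (map f xs) ≡ all (p ∘ f) xs
all-map f p [] = refl
all-map f p (x ∷ xs) = cong (p (f x) ∧_) (all-map f p xs)

length-concatMap-const : ∀ (f : A → List B) m xs → (∀ x → length (f x) ≡ m) → length (concatMap f xs) ≡ length xs * m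
length-concatMap-const f m [] h = refl
length-concatMap-const f m (x ∷ xs) h = trans (length-++ (f x)) (cong₂ _+_ (h x) (length-concatMap-const f m xs h))

length-template : ∀ b M w r → length (template b M w r) ≡ b + (M * w + r)
length-template b M w r = trans (length-++ (replicate b out)) (cong₂ _+_ (length-replicate b)
  (trans (length-++ (concatMap (segment w) (range 0 M))) (cong₂ _+_
    (trans (length-concatMap-const (segment w) w (range 0 M) (λ v → trans (length-map (seg v) (range 0 w)) (length-range 0 w))) (cong (_* w) (length-range 0 M)))
    (length-replicate r))))

vsum : ∀ {k} → Vec ℕ k → ℕ
vsum [] = 0
vsum (d ∷ ds) = d + vsum ds

length-blocks : ∀ {k} (ds : Vec ℕ k) → length (blocks ds) ≡ vsum ds
length-blocks [] = refl
length-blocks (d ∷ ds) = trans (length-++ (replicate d (seg 0 0))) (cong₂ _+_ (length-replicate d) (trans (length-map bump (blocks ds)) (length-blocks ds)))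

length-canonical : ∀ {k} b (ds : Vec ℕ k) r → length (canonical b ds r) ≡ b + (vsum ds + r)
length-canonical b ds r = trans (length-++ (replicate b out)) (cong₂ _+_ (length-replicate b)
  (trans (length-++ (blocks ds)) (cong₂ _+_ (length-blocks ds) (length-replicate r))))

-- Reads the positions of a chain as labels of a board with one segment: `b` elements are already
-- removed, and the next `w` are removed in the order of the segment. Cutting the segment then means
-- moving down the chain, see `cut-iota`.
iota-label : ℕ → ℕ → ℕ → Label
iota-label b w x = if x <ᵇ b then out else (if x <ᵇ b + w then seg 0 (x ∸ b) else core)

iota-labels : ∀ b w r → map (iota-label b w) (range 0 (b + (w + r))) ≡ replicate b out ++ segments w 1 ++ replicate r core
iota-labels b w r = begin
  map γ (range 0 (b + (w + r))) ≡⟨ cong (map γ) (trans (range-++ 0 b (w + r)) (cong (range 0 b ++_) (range-++ b w r))) ⟩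
  map γ (range 0 b ++ range b w ++ range (b + w) r) ≡⟨ trans (map-++ γ (range 0 b) _) (cong (map γ (range 0 b) ++_) (map-++ γ (range b w) _)) ⟩
  map γ (range 0 b) ++ map γ (range b w) ++ map γ (range (b + w) r) ≡⟨ cong₂ _++_ p₁ (cong₂ _++_ p₂ p₃) ⟩
  replicate b out ++ segments w 1 ++ replicate r core ∎
  where
  open ≡-Reasoning
  γ = iota-label b w
  p₁ : map γ (range 0 b) ≡ replicate b out
  p₁ = trans (map-const∈ γ (range 0 b) (λ {x} i → cong (λ z → if z then out else (if x <ᵇ b + w then seg 0 (x ∸ b) else core)) (<ᵇ-true (proj₂ (∈-range⁻ 0 b i)))))
         (cong (λ m → replicate m out) (length-range 0 b))
  p₂′ : ∀ {x} → x ∈ range b w → γ x ≡ seg 0 (x ∸ b)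
  p₂′ {x} i rewrite <ᵇ-false (proj₁ (∈-range⁻ b w i)) | <ᵇ-true (proj₂ (∈-range⁻ b w i)) = refl
  shifted : ∀ s m → map (λ x → seg 0 (x ∸ b)) (range (b + s) m) ≡ map (seg 0) (range s m)
  shifted s zero = refl
  shifted s (suc m) = cong₂ _∷_ (cong (seg 0) (m+n∸m≡n b s)) (trans (cong (λ z → map (λ x → seg 0 (x ∸ b)) (range z m)) (sym (+-suc b s))) (shifted (suc s) m))
  p₂ : map γ (range b w) ≡ segments w 1
  p₂ = trans (map-cong∈ (range b w) p₂′) (trans (cong (λ z → map (λ x → seg 0 (x ∸ b)) (range z w)) (sym (+-identityʳ b))) (trans (shifted 0 w) (sym (++-identityʳ (segment w 0)))))
  p₃′ : ∀ {x} → x ∈ range (b + w) r → γ x ≡ core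
  p₃′ {x} i rewrite <ᵇ-false (≤-trans (m≤m+n b w) (proj₁ (∈-range⁻ (b + w) r i))) | <ᵇ-false (proj₁ (∈-range⁻ (b + w) r i)) = refl
  p₃ : map γ (range (b + w) r) ≡ replicate r core
  p₃ = trans (map-const∈ γ (range (b + w) r) p₃′) (cong (λ m → replicate m core) (length-range (b + w) r))

full-iota : ∀ b w x → full (iota-label b w x) ≡ (b ≤ᵇ x)
full-iota b w x with x <? b
... | yes h rewrite <ᵇ-true h | ≤ᵇ-false h = refl
... | no h rewrite <ᵇ-false (≮⇒≥ h) | ≤ᵇ-true (≮⇒≥ h) with x <ᵇ b + w
...   | true = refl
...   | false = refl

cut-iota : ∀ b w d x → d ≤ w → cut 0 d (iota-label b w x) ≡ (b + d ≤ᵇ x)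
cut-iota b w d x d≤w with x <? b
... | yes h rewrite <ᵇ-true h | ≤ᵇ-false (<-≤-trans h (m≤m+n b d)) = refl
... | no h rewrite <ᵇ-false (≮⇒≥ h) with m≤n⇒∃[o]m+o≡n (≮⇒≥ h)
...   | o , refl rewrite m+n∸m≡n b o with b + o <? b + w
...     | yes l rewrite <ᵇ-true l with o <? d
...       | yes q rewrite <ᵇ-true q | ≤ᵇ-false (+-monoʳ-< b q) = refl
...       | no q rewrite <ᵇ-false (≮⇒≥ q) | ≤ᵇ-true (+-monoʳ-≤ b (≮⇒≥ q)) = refl
cut-iota b w d x d≤w | no h | o , refl | no l rewrite <ᵇ-false (≮⇒≥ l) | ≤ᵇ-true (≤-trans (+-monoʳ-≤ b d≤w) (≮⇒≥ l)) = refl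

full-select-one : ∀ v x → full (relabel (v ∷ []) x) ≡ full x
full-select-one v out = refl
full-select-one v core = refl
full-select-one v (seg u o) with u ≡ᵇ v
... | true = refl
... | false = refl

cut-select-one : ∀ v d x → cut 0 d (relabel (v ∷ []) x) ≡ cut v d x
cut-select-one v d out = refl
cut-select-one v d core = refl
cut-select-one v d (seg u o) with u ≡ᵇ v
... | true = refl
... | false = refl

singleton-⊆ : ∀ {x : A} {xs} → x ∈ xs → (x ∷ []) ⊆ xs
singleton-⊆ (here refl) = refl ∷ minimum _
singleton-⊆ (there i) = _ ∷ʳ singleton-⊆ i

falses-canonical-full : ∀ {k} b (ds : Vec ℕ k) r → falses (map full (canonical b ds r)) ≡ b
falses-canonical-full b ds r = begin
  ∑ (map full (canonical b ds r)) (ind ∘ not) ≡⟨ ∑-map full (canonical b ds r) _ ⟩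
  ∑ (canonical b ds r) (ind ∘ not ∘ full) ≡⟨ trans (∑-++ (replicate b out) _ _) (cong (∑ (replicate b out) (ind ∘ not ∘ full) +_) (∑-++ (blocks ds) _ _)) ⟩
  _ ≡⟨ cong₂ _+_ (∑-replicate b out _) (cong₂ _+_ (none ds) (∑-replicate r core _)) ⟩
  b * 1 + (0 + r * 0) ≡⟨ e b r ⟩
  b ∎
  where
  open ≡-Reasoning
  e : ∀ b r → b * 1 + (0 + r * 0) ≡ b
  e = solve-∀
  none : ∀ {k} (ds : Vec ℕ k) → ∑ (blocks ds) (ind ∘ not ∘ full) ≡ 0
  none [] = refl
  none (d ∷ ds) = trans (∑-++ (replicate d (seg 0 0)) _ _) (cong₂ _+_ (trans (∑-replicate d _ _) (*-zeroʳ d))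
    (trans (∑-map bump (blocks ds) _) (trans (∑-cong (blocks ds) (λ { out → refl ; core → refl ; (seg _ _) → refl })) (none ds))))

falses-blocks-off : ∀ {k} (ds : Vec ℕ k) j → ∑ (blocks ds) (ind ∘ not ∘ off (toℕ j)) ≡ lookup ds j
falses-blocks-off (d ∷ ds) zero = trans (∑-++ (replicate d (seg 0 0)) _ _) (trans (cong₂ _+_ (trans (∑-replicate d _ _) (*-identityʳ d))
    (trans (∑-map bump (blocks ds) _) (none ds))) (+-identityʳ d))
  where
  none : ∀ {k} (ds : Vec ℕ k) → ∑ (blocks ds) (ind ∘ not ∘ off 0 ∘ bump) ≡ 0
  none [] = refl
  none (d ∷ ds) = trans (∑-++ (replicate d (seg 0 0)) _ _) (cong₂ _+_ (trans (∑-replicate d _ _) (*-zeroʳ d))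
    (trans (∑-map bump (blocks ds) _) (trans (∑-cong (blocks ds) (λ { out → refl ; core → refl ; (seg _ _) → refl })) (none ds))))
falses-blocks-off (d ∷ ds) (suc j) = trans (∑-++ (replicate d (seg 0 0)) _ _) (cong₂ _+_ (trans (∑-replicate d _ _) (*-zeroʳ d))
    (trans (∑-map bump (blocks ds) _) (trans (∑-cong (blocks ds) (λ x → cong (ind ∘ not) (off-suc-bump (toℕ j) x))) (falses-blocks-off ds j))))

falses-canonical-off : ∀ {k} b (ds : Vec ℕ k) r j → falses (map (off (toℕ j)) (canonical b ds r)) ≡ b + lookup ds j
falses-canonical-off b ds r j = begin
  ∑ (map (off (toℕ j)) (canonical b ds r)) (ind ∘ not) ≡⟨ ∑-map (off (toℕ j)) (canonical b ds r) _ ⟩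
  ∑ (canonical b ds r) f ≡⟨ trans (∑-++ (replicate b out) _ _) (cong (∑ (replicate b out) f +_) (∑-++ (blocks ds) _ _)) ⟩
  _ ≡⟨ cong₂ _+_ (∑-replicate b out f) (cong₂ _+_ (falses-blocks-off ds j) (∑-replicate r core f)) ⟩
  b * 1 + (lookup ds j + r * 0) ≡⟨ e b r (lookup ds j) ⟩
  b + lookup ds j ∎
  where
  open ≡-Reasoning
  f = ind ∘ not ∘ off (toℕ j)
  e : ∀ b r d → b * 1 + (d + r * 0) ≡ b + d
  e = solve-∀

∑-filterᵇ : ∀ (p : A → Bool) xs f → ∑ (filterᵇ p xs) f ≡ ∑ xs (λ x → ind (p x) * f x)
∑-filterᵇ p [] f = refl
∑-filterᵇ p (x ∷ xs) f with p x
... | true = cong₂ _+_ (sym (+-identityʳ (f x))) (∑-filterᵇ p xs f)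
... | false = ∑-filterᵇ p xs f

-- A product of existence statements is bounded by its expansion, with one term for each choice of
-- witnesses.
all-any-tuples : ∀ {k} (Δ : List ℕ) (p : A → ℕ → Bool) (us : Vec A k) →
  ind (all (λ u → any (p u) Δ) (toList us)) ≤ ∑ (tuples Δ k) (λ ds → ind (all (λ j → p (lookup us j) (lookup ds j)) (fins k)))
all-any-tuples Δ p [] = s≤s z≤n
all-any-tuples {k = suc k} Δ p (u ∷ us) = begin
  ind (any (p u) Δ ∧ all (λ u → any (p u) Δ) (toList us)) ≡⟨ ind-∧ (any (p u) Δ) _ ⟩
  ind (any (p u) Δ) * ind (all (λ u → any (p u) Δ) (toList us)) ≤⟨ *-mono-≤ (first Δ) (all-any-tuples Δ p us) ⟩
  ∑ Δ (ind ∘ p u) * rest ≡⟨ *-comm (∑ Δ (ind ∘ p u)) rest ⟩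
  rest * ∑ Δ (ind ∘ p u) ≡⟨ ∑-* rest Δ (ind ∘ p u) ⟨
  ∑ Δ (λ d → rest * ind (p u d)) ≡⟨ ∑-cong Δ inner ⟩
  ∑ Δ (λ d → ∑ (tuples Δ k) (λ ds → ind (all (λ j → p (lookup (u ∷ us) j) (lookup (d ∷ ds) j)) (fins (suc k))))) ≡⟨ ∑-tuples-suc Δ k _ ⟨
  ∑ (tuples Δ (suc k)) (λ ds → ind (all (λ j → p (lookup (u ∷ us) j) (lookup ds j)) (fins (suc k)))) ∎
  where
  open ≤-Reasoning
  rest = ∑ (tuples Δ k) (λ ds → ind (all (λ j → p (lookup us j) (lookup ds j)) (fins k)))
  first : ∀ Δ → ind (any (p u) Δ) ≤ ∑ Δ (ind ∘ p u)
  first [] = z≤n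
  first (d ∷ Δ) = ≤-trans (ind-∨ (p u d) _) (+-monoʳ-≤ (ind (p u d)) (first Δ))
  inner : ∀ d → rest * ind (p u d) ≡ ∑ (tuples Δ k) (λ ds → ind (all (λ j → p (lookup (u ∷ us) j) (lookup (d ∷ ds) j)) (fins (suc k))))
  inner d = trans (*-comm rest (ind (p u d))) (trans (sym (∑-* (ind (p u d)) (tuples Δ k) _)) (∑-cong (tuples Δ k) (λ ds →
    trans (sym (ind-∧ (p u d) _)) (cong (λ z → ind (p u d ∧ z)) (sym (all-map suc _ (fins k)))))))

toVec : ∀ (xs : List A) {k} → length xs ≡ k → ∃[ us ] toList {n = k} us ≡ xs
toVec xs refl = Vec.fromList xs , toList∘fromList xs

mass : List (List Bool) → ℕ
mass F = ∑ F weight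

-- Levels are indexed by the size of the complement, so removing `d` elements leads from level `b`
-- to level `b + d`.
layer : List (List Bool) → ℕ → ℕ
layer F b = ∑ F (λ s → ind (falses s ≡ᵇ b) * weight s)

∑-layer : ∀ F (xs : List ℕ) → ∑ xs (layer F) ≡ ∑ F (λ s → ∑ xs (λ b → ind (falses s ≡ᵇ b)) * weight s)
∑-layer F xs = trans (∑-swap xs F _) (∑-cong F (λ s → trans (∑-cong xs (λ b → *-comm (ind (falses s ≡ᵇ b)) (weight s))) (trans (∑-* (weight s) xs _) (*-comm (weight s) _))))

∑-layer-≤ : ∀ F s m → ∑ (range s m) (layer F) ≤ mass F
∑-layer-≤ F s m = ≤-trans (≤-reflexive (∑-layer F (range s m)))
  (∑-mono F (λ t → ≤-trans (*-monoˡ-≤ (weight t) (∑-range-≡ᵇ (falses t) s m)) (≤-reflexive (*-identityˡ _))))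

∑-layer-≥ : ∀ F s m → (∀ {t} → t ∈ F → s ≤ falses t × falses t < s + m) → mass F ≤ ∑ (range s m) (layer F)
∑-layer-≥ F s m h = ≤-trans
  (∑-mono∈ F (λ {t} i → ≤-trans (≤-reflexive (sym (*-identityˡ (weight t)))) (*-monoˡ-≤ (weight t) (∑-range-≡ᵇ-one (falses t) s m (proj₁ (h i)) (proj₂ (h i))))))
  (≤-reflexive (sym (∑-layer F (range s m))))

module _ (F : List (List Bool)) (n : ℕ) (uniq : Unique F) (len : ∀ {s} → s ∈ F → length s ≡ n) where

  -- Labels and colouring enter only through the number of falses that they produce. This is what
  -- makes chains, boards and blow-ups comparable.
  perms-layer : ∀ {L : Set} (c : List L) (p : L → Bool) b → length c ≡ n → falses (map p c) ≡ b →
    ∑ (perms c) (λ l → ind (mem F (map p l))) ≡ layer F b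
  perms-layer c p b lc fb = trans (sym (∑-perms-map p c (ind ∘ mem F)))
    (trans (density n uniq len (map p c) (trans (length-map p c) lc)) (cong (layer F) fb))

  -- For one ordering `l` and growing `b`, the sets `map (b ≤ᵇ_) l` descend along a full chain that
  -- starts at the whole ground set.
  upset : ℕ → List ℕ → Bool
  upset b l = mem F (map (b ≤ᵇ_) l)

  iota : List ℕ
  iota = range 0 n

  hits : (lo w : ℕ) → List ℕ → ℕ
  hits lo w Δ = ∑ (range lo (suc w)) (λ b → ∑ (perms iota) (λ l → ind (upset b l ∧ any (λ d → upset (b + d) l) Δ)))

  upset-layer : ∀ b → b ≤ n → ∑ (perms iota) (ind ∘ upset b) ≡ layer F b
  upset-layer b b≤n with m≤n⇒∃[o]m+o≡n b≤n
  ... | r , refl = perms-layer iota (b ≤ᵇ_) b (length-range 0 n) (trans (cong falses (upset-colours b r)) (falses-blocks b r))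

  -- The mass counts pairs of an ordering and a member on its chain. Each of the `n !` orderings
  -- loses at most its last hit, and every other hit is charged to a class in `Δs` containing a gap
  -- to a later member.
  mass≤hits : ∀ lo w (Δs : List (List ℕ)) → lo + w ≤ n → (∀ {t} → t ∈ F → lo ≤ falses t × falses t ≤ lo + w) →
    concatMap (λ Δ → Δ) Δs ≡ range 1 w → mass F ≤ n ! + ∑ Δs (hits lo w)
  mass≤hits lo w Δs hi central split = begin
    mass F ≤⟨ ∑-layer-≥ F lo (suc w) (λ {t} i → let a , b = central i in a , subst (falses t <_) (sym (+-suc lo w)) (s≤s b)) ⟩
    ∑ bs (layer F) ≡⟨ ∑-cong∈ bs (λ {b} i → sym (upset-layer b (≤-trans (≤-pred (subst (b <_) (+-suc lo w) (proj₂ (∈-range⁻ lo (suc w) i)))) hi))) ⟩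
    ∑ bs (λ b → ∑ (perms iota) (ind ∘ upset b)) ≡⟨ ∑-swap bs (perms iota) _ ⟩
    ∑ (perms iota) (λ l → ∑ bs (λ b → ind (upset b l))) ≤⟨ ∑-mono (perms iota) (λ l → hits-surplus (λ b → upset b l) w lo (suc w) ≤-refl) ⟩
    ∑ (perms iota) (λ l → 1 + ∑ bs (λ b → ind (upset b l ∧ any (λ d → upset (b + d) l) (range 1 w)))) ≡⟨ ∑-+ (perms iota) _ _ ⟩
    ∑ (perms iota) (λ _ → 1) + ∑ (perms iota) (λ l → ∑ bs (λ b → ind (upset b l ∧ any (λ d → upset (b + d) l) (range 1 w))))
      ≤⟨ +-mono-≤ (≤-reflexive (trans (sym (length≡∑1 (perms iota))) (trans (length-perms iota) (cong _! (length-range 0 n)))))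
                  (∑-mono (perms iota) (λ l → ∑-mono bs (λ b → types b l))) ⟩
    n ! + ∑ (perms iota) (λ l → ∑ bs (λ b → ∑ Δs (λ Δ → ind (upset b l ∧ any (λ d → upset (b + d) l) Δ))))
      ≡⟨ cong (n ! +_) (trans (∑-swap (perms iota) bs _) (trans (∑-cong bs (λ b → ∑-swap (perms iota) Δs _)) (∑-swap bs Δs _))) ⟩
    n ! + ∑ Δs (hits lo w) ∎
    where
    open ≤-Reasoning
    bs = range lo (suc w)
    types : ∀ b l → ind (upset b l ∧ any (λ d → upset (b + d) l) (range 1 w)) ≤ ∑ Δs (λ Δ → ind (upset b l ∧ any (λ d → upset (b + d) l) Δ))
    types b l with upset b l
    ... | false = z≤n
    ... | true = subst (λ R → ind (any (λ d → upset (b + d) l) R) ≤ ∑ Δs (λ Δ → ind (any (λ d → upset (b + d) l) Δ))) split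
                   (any-concatMap (λ d → upset (b + d) l) (λ Δ → Δ) Δs)

  valid : ∀ k → List Label → Bool
  valid k cl = mem F (map full cl) ∧ all (λ j → mem F (map (off (toℕ j)) cl)) (fins k)

  edges : ∀ {k} → ℕ → Vec ℕ k → ℕ
  edges {k} b ds = ∑ (perms (canonical b ds (n ∸ (b + vsum ds)))) (ind ∘ valid k)

  ↭-canonical : ∀ {k} b (ds : Vec ℕ k) {cl r} → length cl ≡ n → cl ↭ canonical b ds r → cl ↭ canonical b ds (n ∸ (b + vsum ds))
  ↭-canonical b ds {cl} {r} lc p = subst (λ r → cl ↭ canonical b ds r) (sym (begin
    n ∸ (b + vsum ds) ≡⟨ cong (_∸ (b + vsum ds)) (trans (trans (sym lc) (↭P.↭-length p)) (trans (length-canonical b ds r) (sym (+-assoc b (vsum ds) r)))) ⟩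
    (b + vsum ds + r) ∸ (b + vsum ds) ≡⟨ m+n∸m≡n (b + vsum ds) r ⟩
    r ∎)) p
    where open ≡-Reasoning

  module _ (lo w M : ℕ) (room : lo + w + M * w ≤ n) where

    slack : ℕ → ℕ
    slack b = n ∸ (b + M * w)

    in-range : ∀ {b} → b ∈ range lo (suc w) → b + M * w ≤ n
    in-range {b} i = ≤-trans (+-monoˡ-≤ (M * w) (≤-pred (subst (b <_) (+-suc lo w) (proj₂ (∈-range⁻ lo (suc w) i))))) room

    board : ℕ → List Label
    board b = template b M w (slack b)

    length-board : ∀ {b} → b ∈ range lo (suc w) → length (board b) ≡ n
    length-board {b} i = trans (length-template b M w (slack b)) (trans (sym (+-assoc b (M * w) (slack b))) (m+[n∸m]≡n (in-range i)))

    descends : List ℕ → List Label → ℕ → Bool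
    descends Δ l v = any (λ d → mem F (map (cut v d) l)) Δ

    -- Seen through one segment, an ordering of the board is a random chain descending from B: the
    -- other segments merge into the core, and `iota-label` gives the positions of a chain the same
    -- multiset of labels.
    segment-hits : ∀ Δ → (∀ {d} → d ∈ Δ → d ≤ w) → ∀ {b} → b ∈ range lo (suc w) → ∀ {v} → v ∈ range 0 M →
      ∑ (perms (board b)) (λ l → ind (mem F (map full l) ∧ descends Δ l v)) ≡
      ∑ (perms iota) (λ l → ind (upset b l ∧ any (λ d → upset (b + d) l) Δ))
    segment-hits Δ Δ≤w {b} bi {v} vi = begin
      ∑ (perms (board b)) (λ l → ind (mem F (map full l) ∧ descends Δ l v))
        ≡⟨ ∑-cong (perms (board b)) (λ l → cong ind (cong₂ _∧_ (cong (mem F) (colour-by (full-select-one v) l)) (any-cong∈ Δ (λ {d} _ → cong (mem F) (colour-by (cut-select-one v d) l))))) ⟩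
      ∑ (perms (board b)) (λ l → f (map (relabel (v ∷ [])) l)) ≡⟨ ∑-perms-map _ (board b) f ⟨
      ∑ (perms (map (relabel (v ∷ [])) (board b))) f ≡⟨ ∑-perms-↭ (↭-trans (proj₂ rel) same) f ⟩
      ∑ (perms (map (iota-label b w) iota)) f ≡⟨ ∑-perms-map _ iota f ⟩
      ∑ (perms iota) (λ l → f (map (iota-label b w) l))
        ≡⟨ ∑-cong (perms iota) (λ l → sym (cong ind (cong₂ _∧_ (cong (mem F) (colour-by (full-iota b w) l)) (any-cong∈ Δ (λ {d} i → cong (mem F) (colour-by (λ x → cut-iota b w d x (Δ≤w i)) l)))))) ⟩
      ∑ (perms iota) (λ l → ind (upset b l ∧ any (λ d → upset (b + d) l) Δ)) ∎
      where
      open ≡-Reasoning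
      f : List Label → ℕ
      f cl = ind (mem F (map full cl) ∧ any (λ d → mem F (map (cut 0 d) cl)) Δ)
      colour-by : ∀ {L : Set} {γ : L → Label} {p : Label → Bool} {q : L → Bool} → (∀ x → p (γ x) ≡ q x) → ∀ l → map q l ≡ map p (map γ l)
      colour-by e l = trans (sym (map-cong e l)) (map-∘ l)
      rel = relabel-template b M w (slack b) (v ∷ []) (singleton-⊆ vi)
      r′ = proj₁ rel
      fits : n ≡ b + (w + r′)
      fits = begin
        n ≡⟨ length-board bi ⟨
        length (board b) ≡⟨ length-map (relabel (v ∷ [])) (board b) ⟨
        length (map (relabel (v ∷ [])) (board b)) ≡⟨ ↭P.↭-length (proj₂ rel) ⟩
        length (replicate b out ++ segments w 1 ++ replicate r′ core) ≡⟨ cong length (iota-labels b w r′) ⟨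
        length (map (iota-label b w) (range 0 (b + (w + r′)))) ≡⟨ trans (length-map _ (range 0 (b + (w + r′)))) (length-range 0 _) ⟩
        b + (w + r′) ∎
      same : replicate b out ++ segments w 1 ++ replicate r′ core ↭ map (iota-label b w) iota
      same = ↭-reflexive (trans (sym (iota-labels b w r′)) (cong (λ m → map (iota-label b w) (range 0 m)) (sym fits)))

    configurations : List (ℕ × List Label)
    configurations = filterᵇ (λ x → mem F (map full (proj₂ x))) (concatMap (λ b → map (b ,_) (perms (board b))) (range lo (suc w)))

    ∑-configurations : ∀ f → ∑ configurations f ≡ ∑ (range lo (suc w)) (λ b → ∑ (perms (board b)) (λ l → ind (mem F (map full l)) * f (b , l)))
    ∑-configurations f = trans (∑-filterᵇ _ (concatMap (λ b → map (b ,_) (perms (board b))) (range lo (suc w))) f)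
      (trans (∑-concatMap (λ b → map (b ,_) (perms (board b))) (range lo (suc w)) g) (∑-cong (range lo (suc w)) (λ b → ∑-map (b ,_) (perms (board b)) g)))
      where
      g : ℕ × List Label → ℕ
      g x = ind (mem F (map full (proj₂ x))) * f x

    module _ (central : ∀ {t} → t ∈ F → lo ≤ falses t × falses t ≤ lo + w) where

      length-configurations : length configurations ≡ mass F
      length-configurations = begin
        length configurations ≡⟨ length≡∑1 configurations ⟩
        ∑ configurations (λ _ → 1) ≡⟨ ∑-configurations _ ⟩
        ∑ bs (λ b → ∑ (perms (board b)) (λ l → ind (mem F (map full l)) * 1))
          ≡⟨ ∑-cong∈ bs (λ {b} i → trans (∑-cong (perms (board b)) (λ l → *-identityʳ _)) (perms-layer (board b) full b (length-board i) (falses-board b))) ⟩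
        ∑ bs (layer F) ≡⟨ ≤-antisym (∑-layer-≤ F lo (suc w)) (∑-layer-≥ F lo (suc w) (λ {t} i → let a , b = central i in a , subst (falses t <_) (sym (+-suc lo w)) (s≤s b))) ⟩
        mass F ∎
        where
        open ≡-Reasoning
        bs = range lo (suc w)
        falses-board : ∀ b → falses (map full (board b)) ≡ b
        falses-board b = begin
          falses (map full (board b)) ≡⟨ cong falses (map-cong (full-colour [] []) (board b)) ⟨
          falses (map (λ x → full (colour [] (relabel [] x))) (board b)) ≡⟨ cong falses (map-∘ (board b)) ⟩
          falses (map full (map (colour [] ∘ relabel []) (board b))) ≡⟨ ∑-↭ (↭P.map⁺ full (proj₂ ct)) _ ⟩
          falses (map full (canonical b [] (proj₁ ct))) ≡⟨ falses-canonical-full b [] (proj₁ ct) ⟩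
          b ∎
          where ct = colour-template b M w (slack b) [] [] (minimum _) (λ ())

      -- Common neighbours in the bipartite graph between configurations and segments, where a
      -- configuration is joined to the segments along which it descends to a member by a gap in
      -- `Δ`. By `segment-hits` all segments have the same degree, and `M` is the number of segments
      -- that `common-neighbours` demands for t = k.
      many-edges : ∀ k r Δ .{{_ : NonZero k}} .{{_ : NonZero r}} → M ≡ 2 * k * r → (∀ {d} → d ∈ Δ → d ≤ w) →
        mass F ≤ r * hits lo w Δ →
        mass F ≤ κ k r * ∑ (range lo (suc w)) (λ b → ∑ (tuples Δ k) (edges b))
      many-edges k r Δ M≡ Δ≤w dense =
        let vs , vs⊆ , lvs , h = common-neighbours configurations (range 0 M) (λ x v → descends Δ (proj₂ x) v) k r inc (≤-reflexive (trans (sym M≡) (sym (length-range 0 M))))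
            us , us≡ = toVec vs lvs
        in begin
          mass F ≡⟨ length-configurations ⟨
          length configurations ≤⟨ h ⟩
          κ k r * ∑ configurations (λ x → ind (all (descends Δ (proj₂ x)) vs))
            ≤⟨ *-monoʳ-≤ (κ k r) (subst (λ vs → vs ⊆ range 0 M → ∑ configurations (λ x → ind (all (descends Δ (proj₂ x)) vs)) ≤ ∑ bs (λ b → ∑ (tuples Δ k) (edges b))) us≡ (upper us) vs⊆) ⟩
          κ k r * ∑ bs (λ b → ∑ (tuples Δ k) (edges b)) ∎
        where
        open ≤-Reasoning
        bs = range lo (suc w)
        inc : length configurations * length (range 0 M) ≤ r * ∑ configurations (λ x → ∑ (range 0 M) (λ v → ind (descends Δ (proj₂ x) v)))
        inc = begin
          length configurations * length (range 0 M) ≡⟨ cong₂ _*_ length-configurations (length-range 0 M) ⟩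
          mass F * M ≤⟨ *-monoˡ-≤ M dense ⟩
          r * hits lo w Δ * M ≡⟨ trans (*-assoc r _ M) (cong (r *_) (trans (*-comm _ M) (cong (_* hits lo w Δ) (sym (length-range 0 M))))) ⟩
          r * (length (range 0 M) * hits lo w Δ) ≡⟨ cong (r *_) (∑-const (range 0 M) _) ⟨
          r * ∑ (range 0 M) (λ _ → hits lo w Δ) ≡⟨ cong (r *_) (∑-cong∈ (range 0 M) (λ vi → ∑-cong∈ bs (λ bi → sym (segment-hits Δ Δ≤w bi vi)))) ⟩
          r * ∑ (range 0 M) (λ v → ∑ bs (λ b → ∑ (perms (board b)) (λ l → ind (mem F (map full l) ∧ descends Δ l v))))
            ≡⟨ cong (r *_) (∑-cong (range 0 M) (λ v → trans (∑-cong bs (λ b → ∑-cong (perms (board b)) (λ l → ind-∧ (mem F (map full l)) _))) (sym (∑-configurations (λ x → ind (descends Δ (proj₂ x) v)))))) ⟩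
          r * ∑ (range 0 M) (λ v → ∑ configurations (λ x → ind (descends Δ (proj₂ x) v))) ≡⟨ cong (r *_) (∑-swap (range 0 M) configurations _) ⟩
          r * ∑ configurations (λ x → ∑ (range 0 M) (λ v → ind (descends Δ (proj₂ x) v))) ∎
        upper : ∀ (us : Vec ℕ k) → toList us ⊆ range 0 M →
          ∑ configurations (λ x → ind (all (descends Δ (proj₂ x)) (toList us))) ≤ ∑ bs (λ b → ∑ (tuples Δ k) (edges b))
        upper us us⊆ = begin
          ∑ configurations (λ x → ind (all (descends Δ (proj₂ x)) (toList us))) ≡⟨ ∑-configurations _ ⟩
          ∑ bs (λ b → ∑ (perms (board b)) (λ l → ind (mem F (map full l)) * ind (all (descends Δ l) (toList us))))
            ≤⟨ ∑-mono bs (λ b → ∑-mono (perms (board b)) (λ l → *-monoʳ-≤ (ind (mem F (map full l))) (all-any-tuples Δ (λ v d → mem F (map (cut v d) l)) us))) ⟩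
          ∑ bs (λ b → ∑ (perms (board b)) (λ l → ind (mem F (map full l)) * ∑ (tuples Δ k) (λ ds → ind (good l ds))))
            ≡⟨ ∑-cong bs (λ b → trans (∑-cong (perms (board b)) (λ l → sym (∑-* (ind (mem F (map full l))) (tuples Δ k) _))) (∑-swap (perms (board b)) (tuples Δ k) _)) ⟩
          ∑ bs (λ b → ∑ (tuples Δ k) (λ ds → ∑ (perms (board b)) (λ l → ind (mem F (map full l)) * ind (good l ds))))
            ≡⟨ ∑-cong∈ bs (λ bi → ∑-cong∈ (tuples Δ k) (λ {ds} di → to-edges bi ds (λ j → Δ≤w (∈-tuples⁻ k di j)))) ⟩
          ∑ bs (λ b → ∑ (tuples Δ k) (edges b)) ∎
          where
          good : List Label → Vec ℕ k → Bool
          good l ds = all (λ j → mem F (map (cut (lookup us j) (lookup ds j)) l)) (fins k)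
          to-edges : ∀ {b} → b ∈ bs → ∀ ds → (∀ j → lookup ds j ≤ w) →
            ∑ (perms (board b)) (λ l → ind (mem F (map full l)) * ind (good l ds)) ≡ edges b ds
          to-edges {b} bi ds ds≤w = begin-equality
            ∑ (perms (board b)) (λ l → ind (mem F (map full l)) * ind (good l ds))
              ≡⟨ ∑-cong (perms (board b)) (λ l → trans (sym (ind-∧ (mem F (map full l)) (good l ds))) (cong ind (cong₂ _∧_
                   (cong (mem F) (trans (sym (map-cong (full-colour us ds) l)) (map-∘ l)))
                   (all-cong∈ (fins k) (λ {j} _ → cong (mem F) (trans (sym (map-cong (off-colour us ds (Unique-⊆ us⊆ (range-unique 0 M)) j) l)) (map-∘ l))))))) ⟩
            ∑ (perms (board b)) (λ l → ind (valid k (map (colour ds ∘ relabel us) l))) ≡⟨ ∑-perms-map _ (board b) _ ⟨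
            ∑ (perms (map (colour ds ∘ relabel us) (board b))) (ind ∘ valid k)
              ≡⟨ ∑-perms-↭ (↭-canonical b ds (trans (length-map _ (board b)) (length-board bi)) (proj₂ (colour-template b M w (slack b) us ds us⊆ ds≤w))) _ ⟩
            edges b ds ∎

      -- Summed over `b`, each shift of `layer F` is at most `mass F`, which `many-edges` bounds by
      -- the number of edges. Averaging over levels and over the `length Δ ^ k` gap vectors gives a
      -- pair with few shadows compared with its edges; the summand 1 in the constant makes the
      -- inequality strict.
      dense-level : ∀ k r Δ .{{_ : NonZero k}} .{{_ : NonZero r}} → M ≡ 2 * k * r → (∀ {d} → d ∈ Δ → d ≤ w) → 0 < length Δ →
        0 < mass F → mass F ≤ r * hits lo w Δ →
        ∃[ b ] b ∈ range lo (suc w) × ∃[ ds ] ds ∈ tuples Δ k ×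
          ∑ (fins k) (λ j → layer F (b + lookup ds j)) < (k * κ k r + 1) * length Δ ^ k * edges b ds
      dense-level k r Δ M≡ Δ≤w Δ>0 μ>0 dense =
        let b , bi , h = ∑-pigeonhole bs _ _ total
            ds , di , h′ = ∑-pigeonhole (tuples Δ k) _ _ h
        in b , bi , ds , di , h′
        where
        open ≤-Reasoning
        bs = range lo (suc w)
        R = length Δ ^ k
        G = (k * κ k r + 1) * R
        E = ∑ bs (λ b → ∑ (tuples Δ k) (edges b))
        E-bound : mass F ≤ κ k r * E
        E-bound = many-edges k r Δ M≡ Δ≤w dense
        E>0 : 0 < E
        E>0 with E in eq
        ... | suc _ = s≤s z≤n
        ... | zero = contradiction (subst (0 <_) (*-zeroʳ (κ k r)) (<-≤-trans μ>0 (subst (λ z → mass F ≤ κ k r * z) eq E-bound))) (λ ())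
        R>0 : 0 < R
        R>0 = >-nonZero⁻¹ R {{m^n≢0 (length Δ) k {{>-nonZero Δ>0}}}}
        shift-≤ : ∀ d → ∑ bs (λ b → layer F (b + d)) ≤ mass F
        shift-≤ d = ≤-trans (≤-reflexive (∑-range-+ lo (suc w) d (layer F))) (∑-layer-≤ F (lo + d) (suc w))
        total : ∑ bs (λ b → ∑ (tuples Δ k) (λ ds → ∑ (fins k) (λ j → layer F (b + lookup ds j)))) < ∑ bs (λ b → ∑ (tuples Δ k) (λ ds → G * edges b ds))
        total = begin-strict
          ∑ bs (λ b → ∑ (tuples Δ k) (λ ds → ∑ (fins k) (λ j → layer F (b + lookup ds j))))
            ≡⟨ trans (∑-swap bs (tuples Δ k) _) (∑-cong (tuples Δ k) (λ ds → ∑-swap bs (fins k) _)) ⟩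
          ∑ (tuples Δ k) (λ ds → ∑ (fins k) (λ j → ∑ bs (λ b → layer F (b + lookup ds j))))
            ≤⟨ ∑-bound (tuples Δ k) _ (length (fins k) * mass F) (λ ds → ∑-bound (fins k) _ (mass F) (λ j → shift-≤ (lookup ds j))) ⟩
          length (tuples Δ k) * (length (fins k) * mass F) ≡⟨ cong₂ (λ a c → a * (c * mass F)) (length-tuples Δ k) (length-fins k) ⟩
          R * (k * mass F) ≤⟨ *-monoʳ-≤ R (*-monoʳ-≤ k E-bound) ⟩
          R * (k * (κ k r * E)) <⟨ m<m+n _ (*-mono-≤ R>0 E>0) ⟩
          R * (k * (κ k r * E)) + R * E ≡⟨ e R k (κ k r) E ⟩
          G * E ≡⟨ ∑-* G bs _ ⟨
          ∑ bs (λ b → G * ∑ (tuples Δ k) (edges b)) ≡⟨ ∑-cong bs (λ b → sym (∑-* G (tuples Δ k) (edges b))) ⟩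
          ∑ bs (λ b → ∑ (tuples Δ k) (λ ds → G * edges b ds)) ∎
          where
          e : ∀ R k q E → R * (k * (q * E)) + R * E ≡ (k * q + 1) * R * E
          e = solve-∀

-- Blow-ups of a configuration and complete k-partite grids

AgreeOff : ∀ {k} → Fin k → (Fin k → A) → (Fin k → A) → Set
AgreeOff j φ ψ = ∀ i → i ≢ j → φ i ≡ ψ i

off≤full : ∀ j x → off j x ≡ true → full x ≡ true
off≤full j core _ = refl
off≤full j (seg _ _) _ = refl

full-bump : ∀ x → full (bump x) ≡ full x
full-bump out = refl
full-bump core = refl
full-bump (seg _ _) = refl

full-pick : ∀ {I : Set} {k} (φ : Vec I k) j h → full (pick φ (toℕ j) h) ≡ h (lookup φ j)
full-pick (a ∷ φ) zero h with h a
... | true = refl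
... | false = refl
full-pick (a ∷ φ) (suc j) h = trans (full-bump (pick φ (toℕ j) h)) (full-pick φ j h)

off-pick-same : ∀ {I : Set} {k} (φ : Vec I k) (j : Fin k) h → off (toℕ j) (pick φ (toℕ j) h) ≡ false
off-pick-same (a ∷ φ) zero h with h a
... | true = refl
... | false = refl
off-pick-same (a ∷ φ) (suc j) h = trans (off-suc-bump (toℕ j) (pick φ (toℕ j) h)) (off-pick-same φ j h)

off-pick-other : ∀ {I : Set} {k} (φ : Vec I k) i j h → i ≢ j → off (toℕ i) (pick φ (toℕ j) h) ≡ h (lookup φ j)
off-pick-other (a ∷ φ) zero zero h ne = ⊥-elim (ne refl)
off-pick-other (a ∷ φ) (suc i) zero h ne with h a
... | true = refl
... | false = refl
off-pick-other (a ∷ φ) zero (suc j) h ne = trans (off-zero-bump (pick φ (toℕ j) h)) (full-pick φ j h)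
off-pick-other (a ∷ φ) (suc i) (suc j) h ne = trans (off-suc-bump (toℕ i) (pick φ (toℕ j) h)) (off-pick-other φ i j h (ne ∘ cong suc))

full-pick-cong : ∀ {I : Set} {k} (φ ψ : Vec I k) → (∀ j → lookup φ j ≡ lookup ψ j) → ∀ m h → pick φ m h ≡ pick ψ m h
full-pick-cong [] [] e m h = refl
full-pick-cong (a ∷ φ) (b ∷ ψ) e zero h = cong (λ c → if h c then seg 0 0 else out) (e zero)
full-pick-cong (a ∷ φ) (b ∷ ψ) e (suc m) h = cong bump (full-pick-cong φ ψ (e ∘ suc) m h)

off-pick-cong : ∀ {I : Set} {k} (φ ψ : Vec I k) j → AgreeOff j (lookup φ) (lookup ψ) → ∀ m h → off (toℕ j) (pick φ m h) ≡ off (toℕ j) (pick ψ m h)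
off-pick-cong (a ∷ φ) (b ∷ ψ) zero e zero h with h a | h b
... | true | true = refl
... | true | false = refl
... | false | true = refl
... | false | false = refl
off-pick-cong (a ∷ φ) (b ∷ ψ) zero e (suc m) h = cong (off 0 ∘ bump) (full-pick-cong φ ψ (λ i → e (suc i) (λ ())) m h)
off-pick-cong (a ∷ φ) (b ∷ ψ) (suc j) e zero h = cong (λ c → off (suc (toℕ j)) (if h c then seg 0 0 else out)) (e zero (λ ()))
off-pick-cong (a ∷ φ) (b ∷ ψ) (suc j) e (suc m) h = trans (off-suc-bump (toℕ j) (pick φ m h))
  (trans (off-pick-cong φ ψ j (λ i ne → e (suc i) (λ { refl → ne refl })) m h) (sym (off-suc-bump (toℕ j) (pick ψ m h))))

-- An element of part `j` is absent from B minus D_j whether or not the chosen subset contains it.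
-- This is the shadow property that `dense-of-shadows` requires.
off-tint-cong : ∀ {I : Set} {k} (φ ψ : Vec I k) j → AgreeOff j (lookup φ) (lookup ψ) → ∀ x → off (toℕ j) (tint φ x) ≡ off (toℕ j) (tint ψ x)
off-tint-cong φ ψ j e out = refl
off-tint-cong φ ψ j e core = refl
off-tint-cong φ ψ j e (col m h) = off-pick-cong φ ψ j e m h

-- The subsets indexed by Vec (Fin g) x are the transversals of x blocks of size g.
cols : ∀ g x → List (Vec (Fin g) x → Bool)
cols g zero = []
cols g (suc x) = map (λ i φ → toℕ (Vec.head φ) ≡ᵇ toℕ i) (fins g) ++ map (λ h φ → h (Vec.tail φ)) (cols g x)

length-cols : ∀ g x → length (cols g x) ≡ x * g
length-cols g zero = refl
length-cols g (suc x) = trans (length-++ (map _ (fins g))) (cong₂ _+_ (trans (length-map _ (fins g)) (length-fins g)) (trans (length-map _ (cols g x)) (length-cols g x)))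

∑-fins-≡ᵇ : ∀ {g} (a : Fin g) → ∑ (fins g) (λ i → ind (toℕ a ≡ᵇ toℕ i)) ≡ 1
∑-fins-≡ᵇ {suc g} zero = cong suc (trans (∑-map suc (fins g) _) (∑-zero (fins g)))
∑-fins-≡ᵇ {suc g} (suc a) = trans (∑-map suc (fins g) _) (∑-fins-≡ᵇ a)

∑-cols : ∀ g x φ → ∑ (cols g x) (λ h → ind (h φ)) ≡ x
∑-cols g zero φ = refl
∑-cols g (suc x) (a ∷ φ) = trans (∑-++ (map _ (fins g)) _ _)
  (cong₂ _+_ (trans (∑-map _ (fins g) _) (∑-fins-≡ᵇ a)) (trans (∑-map _ (cols g x) _) (∑-cols g x φ)))

cols-separate : ∀ g x (φ ψ : Vec (Fin g) x) → (∀ {h} → h ∈ cols g x → h φ ≡ h ψ) → φ ≡ ψ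
cols-separate g zero [] [] _ = refl
cols-separate g (suc x) (a ∷ φ) (b ∷ ψ) e = cong₂ _∷_
  (sym (toℕ-injective (≡ᵇ-true (toℕ b) (toℕ a) (trans (sym (e (∈-++⁺ˡ (∈-map⁺ _ (∈-fins a))))) (≡ᵇ-refl (toℕ a))))))
  (cols-separate g x φ ψ (λ i → e (∈-++⁺ʳ (map _ (fins g)) (∈-map⁺ _ i))))

fins-unique : ∀ k → Unique (fins k)
fins-unique zero = []
fins-unique (suc k) = All.tabulate (λ i e → zero∉ i e) ∷ UniqueP.map⁺ (λ { refl → refl }) (fins-unique k)
  where
  zero∉ : ∀ {x : Fin (suc k)} → x ∈ map suc (fins k) → zero ≢ x
  zero∉ i e with ∈-map⁻ suc i
  zero∉ i () | _ , _ , refl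

tuples-unique : ∀ {V : List A} → Unique V → ∀ k → Unique (tuples V k)
tuples-unique u zero = [] ∷ []
tuples-unique {A = A} {V} u (suc k) = go u
  where
  go : ∀ {W : List A} → Unique W → Unique (concatMap (λ a → map (a ∷_) (tuples V k)) W)
  go [] = []
  go {a ∷ W} (a∉ ∷ u′) = UniqueP.++⁺ (UniqueP.map⁺ (λ { refl → refl }) (tuples-unique u k)) (go u′) (λ (i , j) → disj i j)
    where
    disj : ∀ {φ} → φ ∈ map (a ∷_) (tuples V k) → φ ∉ concatMap (λ a → map (a ∷_) (tuples V k)) W
    disj i j with ∈-map⁻ (a ∷_) i | find (∈-concatMap⁻ _ {xs = W} j)
    ... | _ , _ , refl | b , bi , q with ∈-map⁻ (b ∷_) q
    ...   | _ , _ , refl = All.lookup a∉ bi refl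

∈-columns : ∀ {I : Set} {k} (cs : Vec (List (I → Bool)) k) j {h} → h ∈ lookup cs j → col (toℕ j) h ∈ columns cs
∈-columns (c ∷ cs) zero i = ∈-++⁺ˡ (∈-map⁺ (col 0) i)
∈-columns (c ∷ cs) (suc j) i = ∈-++⁺ʳ (map (col 0) c) (∈-map⁺ wbump (∈-columns cs j i))

module _ (F : List (List Bool)) (n : ℕ) (uniq : Unique F) (len : ∀ {s} → s ∈ F → length s ≡ n) where

  -- Over all orderings of the blow-up, each `φ` is an edge as often as `edges` says and its `j`-th
  -- shadow is present as often as `layer` says, because its tinted labels form the canonical
  -- multiset. Hence a single ordering inherits the inequality between shadows and edges, and
  -- `dense-of-shadows` applies to it.
  localise : ∀ {I : Set} (V : List I) → 0 < length V → ∀ {k} (cs : Vec (List (I → Bool)) k) b (ds : Vec ℕ k) e G r →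
    (∀ j a → ∑ (lookup cs j) (λ h → ind (h a)) ≡ lookup ds j) → (∀ j → length (lookup cs j) ≡ lookup ds j + e) →
    length (wtemplate b cs r) ≡ n →
    ∑ (fins k) (λ j → layer F ((b + k * e) + lookup ds j)) < G * edges F n uniq len (b + k * e) ds →
    ∃[ l ] l ∈ perms (wtemplate b cs r) ×
      length V ^ k ≤ G ^ k * ∑ (tuples V k) (λ φ → ind (valid F n uniq len k (map (tint φ) l)))
  localise {I} V V>0 {k} cs b ds e G r count size lW h =
    let l , li , h′ = ∑-pigeonhole (perms W) _ _ total
    in l , li , dense-of-shadows k V G (Ed l) (λ j φ → Sh l j φ) (proj l) h′
    where
    W = wtemplate b cs r
    Ed : List (WLabel I) → Vec I k → Bool
    Ed l φ = valid F n uniq len k (map (tint φ) l)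
    Sh : List (WLabel I) → Fin k → Vec I k → Bool
    Sh l j φ = mem F (map (off (toℕ j)) (map (tint φ) l))
    proj : ∀ l j φ a → Ed l φ ≡ true → Sh l j (φ [ j ]≔ a) ≡ true
    proj l j φ a v = trans (cong (mem F) (trans (sym (map-∘ l)) (trans (map-cong (off-tint-cong (φ [ j ]≔ a) φ j (λ i ne → lookup∘update′ ne φ a)) l) (map-∘ l))))
      (all-∈ (λ j → mem F (map (off (toℕ j)) (map (tint φ) l))) (fins k) (∧-right (mem F (map full (map (tint φ) l))) v) (∈-fins j))
      where
      ∧-right : ∀ a {b} → a ∧ b ≡ true → b ≡ true
      ∧-right true e = e
    canon : List Label
    canon = canonical (b + k * e) ds (n ∸ ((b + k * e) + vsum ds))
    tinted : ∀ φ → map (tint φ) W ↭ canon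
    tinted φ = ↭-canonical F n uniq len (b + k * e) ds (trans (length-map (tint φ) W) lW) (tint-template b cs r φ ds e count size)
    ∑-tint : ∀ φ (f : List Label → ℕ) → ∑ (perms W) (λ l → f (map (tint φ) l)) ≡ ∑ (perms canon) f
    ∑-tint φ f = trans (sym (∑-perms-map (tint φ) W f)) (∑-perms-↭ (tinted φ) f)
    lcanon : ∀ φ → length canon ≡ n
    lcanon φ = trans (sym (↭P.↭-length (tinted φ))) (trans (length-map (tint φ) W) lW)
    open ≤-Reasoning
    N = length (tuples V k)
    N>0 : 0 < N
    N>0 = subst (0 <_) (sym (length-tuples V k)) (>-nonZero⁻¹ (length V ^ k) {{m^n≢0 (length V) k {{>-nonZero V>0}}}})
    total : ∑ (perms W) (λ l → ∑ (fins k) (λ j → ∑ (tuples V k) (ind ∘ Sh l j))) < ∑ (perms W) (λ l → G * ∑ (tuples V k) (ind ∘ Ed l))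
    total = begin-strict
      ∑ (perms W) (λ l → ∑ (fins k) (λ j → ∑ (tuples V k) (ind ∘ Sh l j)))
        ≡⟨ trans (∑-swap (perms W) (fins k) _) (∑-cong (fins k) (λ j → ∑-swap (perms W) (tuples V k) _)) ⟩
      ∑ (fins k) (λ j → ∑ (tuples V k) (λ φ → ∑ (perms W) (λ l → ind (Sh l j φ))))
        ≡⟨ ∑-cong (fins k) (λ j → trans (∑-cong (tuples V k) (λ φ → trans (∑-tint φ (λ cl → ind (mem F (map (off (toℕ j)) cl))))
             (perms-layer F n uniq len canon (off (toℕ j)) _ (lcanon φ) (falses-canonical-off (b + k * e) ds _ j)))) (∑-const (tuples V k) _)) ⟩
      ∑ (fins k) (λ j → N * layer F ((b + k * e) + lookup ds j)) ≡⟨ ∑-* N (fins k) _ ⟩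
      N * ∑ (fins k) (λ j → layer F ((b + k * e) + lookup ds j)) <⟨ *-monoʳ-< N {{>-nonZero N>0}} h ⟩
      N * (G * edges F n uniq len (b + k * e) ds) ≡⟨ rearr N G _ ⟩
      G * (N * edges F n uniq len (b + k * e) ds) ≡⟨ cong (G *_) (∑-const (tuples V k) _) ⟨
      G * ∑ (tuples V k) (λ _ → edges F n uniq len (b + k * e) ds) ≡⟨ cong (G *_) (∑-cong (tuples V k) (λ φ → ∑-tint φ (ind ∘ valid F n uniq len k))) ⟨
      G * ∑ (tuples V k) (λ φ → ∑ (perms W) (λ l → ind (Ed l φ))) ≡⟨ cong (G *_) (∑-swap (perms W) (tuples V k) _) ⟨
      G * ∑ (perms W) (λ l → ∑ (tuples V k) (ind ∘ Ed l)) ≡⟨ ∑-* G (perms W) _ ⟨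
      ∑ (perms W) (λ l → G * ∑ (tuples V k) (ind ∘ Ed l)) ∎
      where
      rearr : ∀ a b c → a * (b * c) ≡ b * (a * c)
      rearr = solve-∀

_⊑_ : List Bool → List Bool → Set
_⊑_ = Pointwise (λ a b → a ≡ true → b ≡ true)

-- A copy in F of the edges and of the (k-1)-subsets of edges of the complete k-partite
-- k-graph with parts of size t; bot j φ misses part j and does not depend on φ j.
record Grid (F : List (List Bool)) (k t : ℕ) : Set where
  field
    top : (Fin k → Fin t) → List Bool
    bot : Fin k → (Fin k → Fin t) → List Bool
    top∈ : ∀ φ → top φ ∈ F
    bot∈ : ∀ j φ → bot j φ ∈ F
    bot⊑top : ∀ j φ ψ → AgreeOff j φ ψ → bot j φ ⊑ top ψ
    top-injective : ∀ φ ψ → top φ ≡ top ψ → ∀ i → φ i ≡ ψ i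
    bot-injective : ∀ i j φ ψ → bot i φ ≡ bot j ψ → i ≡ j × AgreeOff i φ ψ
    bot≢top : ∀ j φ ψ → bot j φ ≢ top ψ

map-≡∈ : ∀ {p q : A → B} xs → map p xs ≡ map q xs → ∀ {x} → x ∈ xs → p x ≡ q x
map-≡∈ (x ∷ xs) e (here refl) = ∷-injectiveˡ e
map-≡∈ (x ∷ xs) e (there i) = map-≡∈ xs (∷-injectiveʳ e) i

map-⊑ : ∀ (p q : A → Bool) → (∀ x → p x ≡ true → q x ≡ true) → ∀ xs → map p xs ⊑ map q xs
map-⊑ p q h [] = []
map-⊑ p q h (x ∷ xs) = h x ∷ map-⊑ p q h xs

lookup-injective : ∀ {xs : List A} → Unique xs → ∀ i j → List.lookup xs i ≡ List.lookup xs j → i ≡ j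
lookup-injective (x∉ ∷ u) zero zero e = refl
lookup-injective {xs = x ∷ xs} (x∉ ∷ u) zero (suc j) e = ⊥-elim (All.lookup x∉ (∈-lookup j) e)
lookup-injective {xs = x ∷ xs} (x∉ ∷ u) (suc i) zero e = ⊥-elim (All.lookup x∉ (∈-lookup i) (sym e))
lookup-injective (x∉ ∷ u) (suc i) (suc j) e = cong suc (lookup-injective u i j e)

ind-witness : ∀ (xs : List (A → Bool)) a → 0 < ∑ xs (λ h → ind (h a)) → ∃[ h ] h ∈ xs × h a ≡ true
ind-witness (h ∷ xs) a p with h a in eq
... | true = h , here refl , eq
... | false = let h′ , i , e = ind-witness xs a p in h′ , there i , e

∧-left : ∀ a {b} → a ∧ b ≡ true → a ≡ true
∧-left true _ = refl

∧-right : ∀ a {b} → a ∧ b ≡ true → b ≡ true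
∧-right true e = e

module _ (F : List (List Bool)) (n : ℕ) (uniq : Unique F) (len : ∀ {s} → s ∈ F → length s ≡ n) where

  -- The sets come from `complete-partite`; it remains to see that they are distinct. Every column
  -- occurs in `l`, and columns separate transversals. As `x` is positive, the transversal chosen in
  -- part `j` has an element; bottoms missing part `j` lack it, while tops and other bottoms contain
  -- it.
  grid : ∀ {g x k} t r .{{_ : NonZero t}} .{{_ : NonZero r}} (l : List (WLabel (Vec (Fin g) x))) → 1 ≤ x →
    (∀ (j : Fin k) {h} → h ∈ cols g x → col (toℕ j) h ∈ l) →
    length (tuples (fins g) x) ^ k ≤ r * ∑ (tuples (tuples (fins g) x) k) (λ φ → ind (valid F n uniq len k (map (tint φ) l))) →
    2 * t * κ^ t k r ≤ length (tuples (fins g) x) → Grid F k t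
  grid {g} {x} {k} t r l x≥1 present dense big = record
    { top = top ; bot = bot
    ; top∈ = λ φ → mem-sound F (∧-left (mem F (top φ)) (ok φ))
    ; bot∈ = λ j φ → mem-sound F (all-∈ (λ j → mem F (bot j φ)) (fins k) (∧-right (mem F (top φ)) (ok φ)) (∈-fins j))
    ; bot⊑top = λ j φ ψ e → subst (_⊑ top ψ) (sym (bot-cong j φ ψ e)) (map-⊑ (off (toℕ j)) full (off≤full (toℕ j)) (map (tint (tup ψ)) l))
    ; top-injective = λ φ ψ e i → same {φ} {ψ} i (λ {h} hi → trans (sym (full-pick (tup φ) i h)) (trans (at full full (tup φ) (tup ψ) e (present i hi)) (full-pick (tup ψ) i h)))
    ; bot-injective = λ i j φ ψ e → let i≡j = bot-index i j φ ψ e in i≡j , λ i′ ne → same {φ} {ψ} i′ (λ {h} hi →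
        trans (sym (off-pick-other (tup φ) i i′ h (ne ∘ sym))) (trans (at (off (toℕ i)) (off (toℕ j)) (tup φ) (tup ψ) e (present i′ hi)) (off-pick-other (tup ψ) j i′ h (λ j≡i′ → ne (trans (sym j≡i′) (sym i≡j))))))
    ; bot≢top = λ j φ ψ e → let h , hi , ht = witness (lookup (tup ψ) j) in
        true≢false (trans (sym ht) (trans (sym (full-pick (tup ψ) j h)) (trans (sym (at (off (toℕ j)) full (tup φ) (tup ψ) e (present j hi))) (off-pick-same (tup φ) j h))))
    }
    where
    V = tuples (fins g) x
    V-unique : Unique V
    V-unique = tuples-unique (fins-unique g) x
    kp = complete-partite k V t r (λ φ → valid F n uniq len k (map (tint φ) l)) dense big
    Ts = proj₁ kp
    elem : ∀ j → Fin t → Vec (Fin g) x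
    elem j i = List.lookup (lookup Ts j) (Fin.cast (sym (proj₂ (proj₁ (proj₂ kp) j))) i)
    elem-injective : ∀ j i i′ → elem j i ≡ elem j i′ → i ≡ i′
    elem-injective j i i′ e = toℕ-injective (trans (sym (FinP.toℕ-cast c i)) (trans (cong toℕ (lookup-injective (Unique-⊆ (proj₁ (proj₁ (proj₂ kp) j)) V-unique) _ _ e)) (FinP.toℕ-cast c i′)))
      where c = sym (proj₂ (proj₁ (proj₂ kp) j))
    tup : (Fin k → Fin t) → Vec (Vec (Fin g) x) k
    tup φ = Vec.tabulate (λ j → elem j (φ j))
    top : (Fin k → Fin t) → List Bool
    top φ = map full (map (tint (tup φ)) l)
    bot : Fin k → (Fin k → Fin t) → List Bool
    bot j φ = map (off (toℕ j)) (map (tint (tup φ)) l)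
    ok : ∀ φ → valid F n uniq len k (map (tint (tup φ)) l) ≡ true
    ok φ = proj₂ (proj₂ kp) (tup φ) (λ j → subst (_∈ lookup Ts j) (sym (lookup∘tabulate (λ j → elem j (φ j)) j)) (∈-lookup _))
    bot-cong : ∀ j φ ψ → AgreeOff j φ ψ → bot j φ ≡ bot j ψ
    bot-cong j φ ψ e = trans (sym (map-∘ l)) (trans (map-cong (off-tint-cong (tup φ) (tup ψ) j (λ i ne →
      trans (lookup∘tabulate (λ j → elem j (φ j)) i) (trans (cong (elem i) (e i ne)) (sym (lookup∘tabulate (λ j → elem j (ψ j)) i))))) l) (map-∘ l))
    same : ∀ {φ ψ : Fin k → Fin t} i → (∀ {h} → h ∈ cols g x → h (lookup (tup φ) i) ≡ h (lookup (tup ψ) i)) → φ i ≡ ψ i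
    same {φ} {ψ} i e = elem-injective i (φ i) (ψ i) (trans (sym (lookup∘tabulate (λ j → elem j (φ j)) i)) (trans (cols-separate g x _ _ e) (lookup∘tabulate (λ j → elem j (ψ j)) i)))
    at : ∀ (p q : Label → Bool) (φ ψ : Vec (Vec (Fin g) x) k) → map p (map (tint φ) l) ≡ map q (map (tint ψ) l) → ∀ {y} → y ∈ l → p (tint φ y) ≡ q (tint ψ y)
    at p q φ ψ e = map-≡∈ l (trans (map-∘ l) (trans e (sym (map-∘ l))))
    witness : ∀ a → ∃[ h ] h ∈ cols g x × h a ≡ true
    witness a = ind-witness (cols g x) a (subst (0 <_) (sym (∑-cols g x a)) x≥1)
    true≢false : true ≢ false
    true≢false ()
    bot-index : ∀ i j φ ψ → bot i φ ≡ bot j ψ → i ≡ j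
    bot-index i j φ ψ e with i Fin.≟ j
    ... | yes i≡j = i≡j
    ... | no i≢j = let h , hi , ht = witness (lookup (tup ψ) i) in
      ⊥-elim (true≢false (trans (sym ht) (trans (sym (off-pick-other (tup ψ) j i h (i≢j ∘ sym))) (trans (sym (at (off (toℕ i)) (off (toℕ j)) (tup φ) (tup ψ) e (present i hi))) (off-pick-same (tup φ) i h)))))

  grid-from-level : ∀ {g x k} t b (ds : Vec ℕ k) G .{{_ : NonZero t}} .{{_ : NonZero G}} → 1 ≤ x →
    (∀ j → x ≤ lookup ds j) → k * (x * g) ≤ b → b + vsum ds ≤ n →
    ∑ (fins k) (λ j → layer F (b + lookup ds j)) < G * edges F n uniq len b ds →
    2 * t * κ^ t k (G ^ k) ≤ suc g ^ x → Grid F k t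
  grid-from-level {g} {x} {k} t b ds G x≥1 x≤ds room fits h big =
    grid t (G ^ k) {{it}} {{m^n≢0 G k}} l x≥1 present dense (subst (2 * t * κ^ t k (G ^ k) ≤_) (sym lV) big)
    where
    V = tuples (fins (suc g)) x
    lV : length V ≡ suc g ^ x
    lV = trans (length-tuples (fins (suc g)) x) (cong (_^ x) (length-fins (suc g)))
    -- Elements common to all candidates pad a transversal from size `x` to the prescribed size.
    column : ℕ → List (Vec (Fin (suc g)) x → Bool)
    column d = replicate (d ∸ x) (const true) ++ cols (suc g) x
    cs : Vec (List (Vec (Fin (suc g)) x → Bool)) k
    cs = Vec.map column ds
    cs-lookup : ∀ j → lookup cs j ≡ column (lookup ds j)
    cs-lookup j = lookup-map j column ds
    count : ∀ j a → ∑ (lookup cs j) (λ h → ind (h a)) ≡ lookup ds j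
    count j a = begin
      ∑ (lookup cs j) (λ h → ind (h a)) ≡⟨ cong (λ c → ∑ c (λ h → ind (h a))) (cs-lookup j) ⟩
      ∑ (column (lookup ds j)) (λ h → ind (h a)) ≡⟨ ∑-++ (replicate (lookup ds j ∸ x) (const true)) _ _ ⟩
      _ ≡⟨ cong₂ _+_ (trans (∑-replicate (lookup ds j ∸ x) _ _) (*-identityʳ _)) (∑-cols (suc g) x a) ⟩
      (lookup ds j ∸ x) + x ≡⟨ m∸n+n≡m (x≤ds j) ⟩
      lookup ds j ∎
      where open ≡-Reasoning
    widths : ∀ j → length (lookup cs j) ≡ lookup ds j + x * g
    widths j = begin
      length (lookup cs j) ≡⟨ cong length (cs-lookup j) ⟩
      length (column (lookup ds j)) ≡⟨ length-++ (replicate (lookup ds j ∸ x) (const true)) ⟩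
      _ ≡⟨ cong₂ _+_ (length-replicate (lookup ds j ∸ x)) (length-cols (suc g) x) ⟩
      (lookup ds j ∸ x) + x * suc g ≡⟨ cong ((lookup ds j ∸ x) +_) (*-suc x g) ⟩
      (lookup ds j ∸ x) + (x + x * g) ≡⟨ +-assoc (lookup ds j ∸ x) x (x * g) ⟨
      (lookup ds j ∸ x) + x + x * g ≡⟨ cong (_+ x * g) (m∸n+n≡m (x≤ds j)) ⟩
      lookup ds j + x * g ∎
      where open ≡-Reasoning
    -- Whatever is chosen, each part leaves x g of its elements outside, and these count towards the
    -- `b` elements of the complement.
    b₀ = b ∸ k * (x * g)
    b₀+ : b₀ + k * (x * g) ≡ b
    b₀+ = m∸n+n≡m room
    r₀ = n ∸ (b + vsum ds)
    W = wtemplate b₀ cs r₀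
    a₀ : Vec (Fin (suc g)) x
    a₀ = Vec.replicate x zero
    lW : length W ≡ n
    lW = begin
      length W ≡⟨ length-map (tint (Vec.replicate k a₀)) W ⟨
      length (map (tint (Vec.replicate k a₀)) W) ≡⟨ ↭P.↭-length (tint-template b₀ cs r₀ (Vec.replicate k a₀) ds (x * g) count widths) ⟩
      length (canonical (b₀ + k * (x * g)) ds r₀) ≡⟨ length-canonical (b₀ + k * (x * g)) ds r₀ ⟩
      (b₀ + k * (x * g)) + (vsum ds + r₀) ≡⟨ cong (_+ (vsum ds + r₀)) b₀+ ⟩
      b + (vsum ds + r₀) ≡⟨ +-assoc b (vsum ds) r₀ ⟨
      b + vsum ds + r₀ ≡⟨ m+[n∸m]≡n fits ⟩
      n ∎
      where open ≡-Reasoning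
    loc = localise F n uniq len V (subst (0 <_) (sym lV) (>-nonZero⁻¹ (suc g ^ x) {{m^n≢0 (suc g) x}})) cs b₀ ds (x * g) G r₀ count widths lW
      (subst (λ b → ∑ (fins k) (λ j → layer F (b + lookup ds j)) < G * edges F n uniq len b ds) (sym b₀+) h)
    l = proj₁ loc
    dense = proj₂ (proj₂ loc)
    present : ∀ (j : Fin k) {h} → h ∈ cols (suc g) x → col (toℕ j) h ∈ l
    present j {h} hi = ↭P.∈-resp-↭ (↭-sym (∈-perms-↭ {xs = W} (proj₁ (proj₂ loc)))) (∈-++⁺ʳ (replicate b₀ out) (∈-++⁺ˡ
      (∈-columns cs j (subst (h ∈_) (sym (cs-lookup j)) (∈-++⁺ʳ (replicate (lookup ds j ∸ x) (const true)) hi)))))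

-- Embedding the poset into a grid

⊑⇒⊆ : ∀ {n} (p q : Subset n) → toList p ⊑ toList q → p ⊆ₛ q
⊑⇒⊆ (true ∷ p) (y ∷ q) (h ∷ _) here with refl ← h refl = here
⊑⇒⊆ (_ ∷ p) (_ ∷ q) (_ ∷ hs) (there i) = there (⊑⇒⊆ p q hs i)

⊆ₛ∧∣≡∣⇒≡ : ∀ {n} {p q : Subset n} → p ⊆ₛ q → ∣ p ∣ ≡ ∣ q ∣ → p ≡ q
⊆ₛ∧∣≡∣⇒≡ {p = p} {q} p⊆q e = ⊆ₛ-antisym p⊆q q⊆p
  where
  q⊆p : q ⊆ₛ p
  q⊆p {x} x∈q with x ∈? p
  ... | yes x∈p = x∈p
  ... | no x∉p = ⊥-elim (<-irrefl e (p⊂q⇒∣p∣<∣q∣ (p⊆q , x , x∈q , x∉p)))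

↑ˡ≢↑ʳ : ∀ {m n} (i : Fin m) (j : Fin n) → i ↑ˡ n ≢ m ↑ʳ j
↑ˡ≢↑ʳ {m} {n} i j e with trans (sym (FinP.splitAt-↑ˡ m i n)) (trans (cong (Fin.splitAt m) e) (FinP.splitAt-↑ʳ m n j))
... | ()

module _ (P : FinPoset) (k′ : ℕ) (l : ℕ) (𝒫 : List (Subset l))
  (sizes : ∀ E → E ∈ 𝒫 → (∣ E ∣ ≡ k′) ⊎ (∣ E ∣ ≡ suc k′))
  (f : Fin (size P) → Subset l) (f-injective : Injective _≡_ _≡_ f) (f∈ : ∀ u → f u ∈ 𝒫) (f-mono : ∀ u v → _≤P_ P u v → f u ⊆ₛ f v)
  (c : Fin l → Fin (suc k′)) (partite : ∀ E → E ∈ 𝒫 → ∣ E ∣ ≡ suc k′ → ∀ j → Σ (Fin l) λ x → (x ∈ₛ E) × (c x ≡ j) × (∀ y → y ∈ₛ E → c y ≡ j → y ≡ x)) where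

  Rainbow : Subset l → Set
  Rainbow E = ∀ {y z} → y ∈ₛ E → z ∈ₛ E → c y ≡ c z → y ≡ z

  edge-rainbow : ∀ E → E ∈ 𝒫 → ∣ E ∣ ≡ suc k′ → Rainbow E
  edge-rainbow E E∈ ∣E∣ {y} {z} y∈ z∈ e = let x , _ , _ , only = partite E E∈ ∣E∣ (c y) in trans (only y y∈ refl) (sym (only z z∈ (sym e)))

  -- A set of size k - 1 inside an edge is rainbow and misses exactly one colour. If it lies in no
  -- edge, nothing is known of its colours, but then it is properly contained in no member of `𝒫`
  -- and properly contains none.
  data Kind (u : Fin (size P)) : Set where
    edge : ∣ f u ∣ ≡ suc k′ → Kind u
    punctured : ∀ E → E ∈ 𝒫 → ∣ E ∣ ≡ suc k′ → f u ⊆ₛ E → ∀ x → x ∈ₛ E → x ∉ₛ f u → (∀ {y} → y ∈ₛ E → y ≢ x → y ∈ₛ f u) → ∣ f u ∣ ≡ k′ → Kind u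
    isolated : (∀ E → E ∈ 𝒫 → ∣ E ∣ ≡ suc k′ → ¬ f u ⊆ₛ E) → ∣ f u ∣ ≡ k′ → Kind u

  kind : ∀ u → Kind u
  kind u with sizes (f u) (f∈ u)
  ... | inj₂ e = edge e
  ... | inj₁ e with Any.any? (λ E → (∣ E ∣ ≟ suc k′) ×-dec (f u ⊆? E)) 𝒫
  ...   | no none = isolated (λ E E∈ ∣E∣ sub → none (lose E∈ (∣E∣ , sub))) e
  ...   | yes some with find some
  ...     | E , E∈ , ∣E∣ , sub with FinP.any? (λ x → (x ∈? E) ×-dec ¬? (x ∈? f u))
  ...       | no none = ⊥-elim (<⇒≱ (n<1+n k′) (subst₂ _≤_ ∣E∣ e (p⊆q⇒∣p∣≤∣q∣ E⊆)))
    where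
    E⊆ : E ⊆ₛ f u
    E⊆ {x} x∈E with x ∈? f u
    ... | yes i = i
    ... | no ¬i = ⊥-elim (none (x , x∈E , ¬i))
  ...       | yes (x , x∈E , x∉) = punctured E E∈ ∣E∣ sub x x∈E x∉ rest e
    where
    rest : ∀ {y} → y ∈ₛ E → y ≢ x → y ∈ₛ f u
    rest {y} y∈E y≢x with y ∈? f u
    ... | yes i = i
    ... | no ¬i = ⊥-elim (<⇒≱ (p⊂q⇒∣p∣<∣q∣ q⊂E) (≤-trans (≤-reflexive (trans ∣E∣ (cong suc (sym e)))) (p⊂q⇒∣p∣<∣q∣ fu⊂q)))
      where
      q = f u ∪ ⁅ x ⁆
      fu⊂q : f u ⊂ q
      fu⊂q = p⊆p∪q ⁅ x ⁆ , x , q⊆p∪q (f u) ⁅ x ⁆ (x∈⁅x⁆ x) , x∉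
      q⊆E : q ⊆ₛ E
      q⊆E i with x∈p∪q⁻ (f u) ⁅ x ⁆ i
      ... | inj₁ j = sub j
      ... | inj₂ j = subst (_∈ₛ E) (sym (x∈⁅y⁆⇒x≡y x j)) x∈E
      y∉q : y ∉ₛ q
      y∉q i with x∈p∪q⁻ (f u) ⁅ x ⁆ i
      ... | inj₁ j = ¬i j
      ... | inj₂ j = y≢x (x∈⁅y⁆⇒x≡y x j)
      q⊂E : q ⊂ E
      q⊂E = q⊆E , y , y∈E , y∉q

  -- A colour absent from `f u` receives the vertex `l ↑ʳ u`, reserved for `u`. Reserved and real
  -- vertices never collide, so a real value certifies membership in `f u`, see `index-inv`.
  index : Fin (size P) → Fin (suc k′) → Fin (l + size P)
  index u j with FinP.any? (λ x → (x ∈? f u) ×-dec (c x Fin.≟ j))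
  ... | yes (x , _) = x ↑ˡ size P
  ... | no _ = l ↑ʳ u

  index-∈ : ∀ u → Rainbow (f u) → ∀ {y} → y ∈ₛ f u → index u (c y) ≡ y ↑ˡ size P
  index-∈ u rb {y} y∈ with FinP.any? (λ x → (x ∈? f u) ×-dec (c x Fin.≟ c y))
  ... | yes (x , x∈ , e) = cong (_↑ˡ size P) (rb x∈ y∈ e)
  ... | no none = ⊥-elim (none (y , y∈ , refl))

  index-at : ∀ u → Rainbow (f u) → ∀ {y j} → y ∈ₛ f u → c y ≡ j → index u j ≡ y ↑ˡ size P
  index-at u rb y∈ refl = index-∈ u rb y∈

  index-inv : ∀ u j {y} → index u j ≡ y ↑ˡ size P → y ∈ₛ f u
  index-inv u j {y} e with FinP.any? (λ x → (x ∈? f u) ×-dec (c x Fin.≟ j))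
  ... | yes (x , x∈ , _) = subst (_∈ₛ f u) (FinP.↑ˡ-injective (size P) x y e) x∈
  ... | no _ = ⊥-elim (↑ˡ≢↑ʳ y u (sym e))

  embed : ∀ {n} (𝓕 : List (Subset n)) {FL : List (List Bool)} → (∀ {s} → s ∈ FL → ∃[ S ] S ∈ 𝓕 × toList S ≡ s) →
    Grid FL (suc k′) (l + size P) → WeakSubposetOfFamily P n 𝓕
  embed {n} 𝓕 back G = g , g-injective , (λ u → proj₁ (proj₂ (back (code∈ u (kind u))))) , g-mono
    where
    open Grid G
    code : ∀ u → Kind u → List Bool
    code u (edge _) = top (index u)
    -- The bottom ignores coordinate `c x`, the only one at which `index u` is a reserved vertex.
    code u (punctured _ _ _ _ x _ _ _ _) = bot (c x) (index u)
    -- Any set used by no other element will do: edges have only real vertices, and `l ↑ʳ u` belongs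
    -- to `u` alone.
    code u (isolated _ _) = top (λ _ → l ↑ʳ u)
    code∈ : ∀ u κ → code u κ ∈ _
    code∈ u (edge _) = top∈ _
    code∈ u (punctured _ _ _ _ x _ _ _ _) = bot∈ _ _
    code∈ u (isolated _ _) = top∈ _
    g : Fin (size P) → Subset n
    g u = proj₁ (back (code∈ u (kind u)))
    g-code : ∀ u → toList (g u) ≡ code u (kind u)
    g-code u = proj₂ (proj₂ (back (code∈ u (kind u))))
    covers : ∀ u v → Rainbow (f u) → (∀ {y} → y ∈ₛ f u → index u (c y) ≡ index v (c y)) → f u ⊆ₛ f v
    covers u v rb e {y} y∈ = index-inv v (c y) (trans (sym (e y∈)) (index-∈ u rb y∈))
    code-injective : ∀ u v κ κ′ → code u κ ≡ code v κ′ → u ≡ v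
    code-injective u v (edge a) (edge b) e = f-injective (⊆ₛ-antisym
      (covers u v (edge-rainbow _ (f∈ u) a) (λ {y} _ → top-injective _ _ e (c y)))
      (covers v u (edge-rainbow _ (f∈ v) b) (λ {y} _ → sym (top-injective _ _ e (c y)))))
    code-injective u v (edge a) (punctured _ _ _ _ _ _ _ _ _) e = ⊥-elim (bot≢top _ _ _ (sym e))
    code-injective u v (edge a) (isolated _ _) e with partite (f u) (f∈ u) a zero
    ... | x , x∈ , cx , _ = ⊥-elim (↑ˡ≢↑ʳ x v (trans (sym (index-at u (edge-rainbow _ (f∈ u) a) x∈ cx)) (top-injective _ _ e zero)))
    code-injective u v (punctured _ _ _ _ _ _ _ _ _) (edge _) e = ⊥-elim (bot≢top _ _ _ e)
    code-injective u v (punctured E E∈ ∣E∣ sub x x∈ x∉ _ _) (punctured E′ E′∈ ∣E′∣ sub′ x′ x′∈ x′∉ _ _) e =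
      f-injective (⊆ₛ-antisym
        (covers u v (λ i j → edge-rainbow E E∈ ∣E∣ (sub i) (sub j)) (λ {y} y∈ → agree (c y) (λ q → x∉ (subst (_∈ₛ f u) (edge-rainbow E E∈ ∣E∣ (sub y∈) x∈ q) y∈))))
        (covers v u (λ i j → edge-rainbow E′ E′∈ ∣E′∣ (sub′ i) (sub′ j)) (λ {y} y∈ → sym (agree (c y) (λ q → x′∉ (subst (_∈ₛ f v) (edge-rainbow E′ E′∈ ∣E′∣ (sub′ y∈) x′∈ (trans q cx≡)) y∈))))))
      where
      cx≡ = proj₁ (bot-injective (c x) (c x′) (index u) (index v) e)
      agree = proj₂ (bot-injective (c x) (c x′) (index u) (index v) e)
    code-injective u v (punctured _ _ _ _ _ _ _ _ _) (isolated _ _) e = ⊥-elim (bot≢top _ _ _ e)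
    code-injective u v (isolated _ _) (edge b) e with partite (f v) (f∈ v) b zero
    ... | x , x∈ , cx , _ = ⊥-elim (↑ˡ≢↑ʳ x u (trans (sym (index-at v (edge-rainbow _ (f∈ v) b) x∈ cx)) (sym (top-injective _ _ e zero))))
    code-injective u v (isolated _ _) (punctured _ _ _ _ _ _ _ _ _) e = ⊥-elim (bot≢top _ _ _ (sym e))
    code-injective u v (isolated _ _) (isolated _ _) e = FinP.↑ʳ-injective l u v (top-injective _ _ e zero)
    g-injective : Injective _≡_ _≡_ g
    g-injective {u} {v} e = code-injective u v (kind u) (kind v) (trans (sym (g-code u)) (trans (cong toList e) (g-code v)))
    ∣f∣ : ∀ u → Kind u → ℕ
    ∣f∣ u (edge _) = (suc k′)
    ∣f∣ u _ = k′
    ∣f∣-correct : ∀ u κ → ∣ f u ∣ ≡ ∣f∣ u κ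
    ∣f∣-correct u (edge e) = e
    ∣f∣-correct u (punctured _ _ _ _ _ _ _ _ e) = e
    ∣f∣-correct u (isolated _ e) = e
    level : ∀ u v κ κ′ → f u ⊆ₛ f v → ∣f∣ u κ ≡ ∣f∣ v κ′ → u ≡ v
    level u v κ κ′ sub e = f-injective (⊆ₛ∧∣≡∣⇒≡ sub (trans (∣f∣-correct u κ) (trans e (sym (∣f∣-correct v κ′)))))
    descend : ∀ u v κ κ′ → f u ⊆ₛ f v → ∣f∣ u κ ≡ suc k′ → ∣f∣ v κ′ ≡ k′ → ⊥
    descend u v κ κ′ sub a b = <⇒≱ (n<1+n k′) (subst₂ _≤_ (trans (∣f∣-correct u κ) a) (trans (∣f∣-correct v κ′) b) (p⊆q⇒∣p∣≤∣q∣ sub))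
    -- Containment between sets of equal size is equality, so the case with content is a punctured
    -- set below an edge `f v`, which may differ from `E`. The edge `E` locates the vertices of
    -- `f u`, and these pass to `f v` by containment.
    order : ∀ u v κ κ′ → f u ⊆ₛ f v → u ≡ v ⊎ code u κ ⊑ code v κ′
    order u v κ@(edge _) κ′@(edge _) sub = inj₁ (level u v κ κ′ sub refl)
    order u v κ@(edge _) κ′@(punctured _ _ _ _ _ _ _ _ _) sub = ⊥-elim (descend u v κ κ′ sub refl refl)
    order u v κ@(edge _) κ′@(isolated _ _) sub = ⊥-elim (descend u v κ κ′ sub refl refl)
    order u v (punctured E E∈ ∣E∣ fu⊆E x x∈ x∉ rest _) (edge b) sub = inj₂ (bot⊑top (c x) (index u) (index v) agree)
      where
      agree : AgreeOff (c x) (index u) (index v)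
      agree i ne with partite E E∈ ∣E∣ i
      ... | y , y∈E , refl , _ = trans (index-∈ u (λ p q → edge-rainbow E E∈ ∣E∣ (fu⊆E p) (fu⊆E q)) y∈) (sym (index-∈ v (edge-rainbow _ (f∈ v) b) (sub y∈)))
        where
        y∈ : y ∈ₛ f u
        y∈ = rest y∈E (λ y≡x → ne (cong c y≡x))
    order u v κ@(punctured _ _ _ _ _ _ _ _ _) κ′@(punctured _ _ _ _ _ _ _ _ _) sub = inj₁ (level u v κ κ′ sub refl)
    order u v κ@(punctured _ _ _ _ _ _ _ _ _) κ′@(isolated _ _) sub = inj₁ (level u v κ κ′ sub refl)
    order u v (isolated none _) (edge b) sub = ⊥-elim (none (f v) (f∈ v) b sub)
    order u v κ@(isolated _ _) κ′@(punctured _ _ _ _ _ _ _ _ _) sub = inj₁ (level u v κ κ′ sub refl)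
    order u v κ@(isolated _ _) κ′@(isolated _ _) sub = inj₁ (level u v κ κ′ sub refl)
    g-mono : ∀ u v → _≤P_ P u v → g u ⊆ₛ g v
    g-mono u v u≤v with order u v (kind u) (kind v) (f-mono u v u≤v)
    ... | inj₁ refl = ⊆ₛ-refl
    ... | inj₂ h = ⊑⇒⊆ (g u) (g v) (subst₂ _⊑_ (sym (g-code u)) (sym (g-code v)) h)

-- Factorial estimates for central and distant levels

factorial-step : ∀ q a b → suc q * suc a ≤ q * suc b → suc q * (suc a ! * b !) ≤ q * (a ! * suc b !)
factorial-step q a b h = begin
  suc q * (suc a * a ! * b !) ≡⟨ e₁ (suc q) (suc a) (a !) (b !) ⟩
  suc q * suc a * (a ! * b !) ≤⟨ *-monoˡ-≤ (a ! * b !) h ⟩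
  q * suc b * (a ! * b !) ≡⟨ e₂ q (suc b) (a !) (b !) ⟩
  q * (a ! * (suc b * b !)) ∎
  where
  open ≤-Reasoning
  e₁ : ∀ q a x y → q * (a * x * y) ≡ q * a * (x * y)
  e₁ = solve-∀
  e₂ : ∀ q b x y → q * b * (x * y) ≡ q * (x * (b * y))
  e₂ = solve-∀

factorial-central-step : ∀ a b → a ≤ b → suc a ! * b ! ≤ a ! * suc b !
factorial-central-step a b h = begin
  suc a * a ! * b ! ≡⟨ *-assoc (suc a) (a !) (b !) ⟩
  suc a * (a ! * b !) ≤⟨ *-monoˡ-≤ (a ! * b !) (s≤s h) ⟩
  suc b * (a ! * b !) ≡⟨ e (suc b) (a !) (b !) ⟩
  a ! * (suc b * b !) ∎
  where
  open ≤-Reasoning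
  e : ∀ b x y → b * (x * y) ≡ x * (b * y)
  e = solve-∀

factorial-central : ∀ s a b → a + s ≤ suc b → (a + s) ! * b ! ≤ a ! * (b + s) !
factorial-central zero a b _ = ≤-reflexive (cong₂ (λ x y → x ! * y !) (+-identityʳ a) (sym (+-identityʳ b)))
factorial-central (suc s) a b h = begin
  (a + suc s) ! * b ! ≡⟨ cong (λ x → x ! * b !) (+-suc a s) ⟩
  suc (a + s) ! * b ! ≤⟨ factorial-central-step (a + s) b a+s≤b ⟩
  (a + s) ! * suc b ! ≤⟨ factorial-central s a (suc b) (≤-trans a+s≤b (m≤n+m b 2)) ⟩
  a ! * (suc b + s) ! ≡⟨ cong (λ x → a ! * x !) (+-suc b s) ⟨
  a ! * (b + suc s) ! ∎
  where
  open ≤-Reasoning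
  a+s≤b : a + s ≤ b
  a+s≤b = ≤-pred (subst (_≤ suc b) (+-suc a s) h)

-- Each of the `s` steps away from the middle gains at least a factor (q + 1) / q; the hypothesis
-- says so for the step nearest to the middle, where the gain is least.
factorial-tail : ∀ q s a b → suc q * (a + s) ≤ q * suc b → suc q ^ s * ((a + s) ! * b !) ≤ q ^ s * (a ! * (b + s) !)
factorial-tail q zero a b _ = ≤-reflexive (cong₂ (λ x y → 1 * (x ! * y !)) (+-identityʳ a) (sym (+-identityʳ b)))
factorial-tail q (suc s) a b h = begin
  suc q ^ suc s * ((a + suc s) ! * b !) ≡⟨ cong (λ x → suc q ^ suc s * (x ! * b !)) (+-suc a s) ⟩
  suc q * suc q ^ s * (suc (a + s) ! * b !) ≡⟨ e (suc q) (suc q ^ s) _ ⟩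
  suc q ^ s * (suc q * (suc (a + s) ! * b !)) ≤⟨ *-monoʳ-≤ (suc q ^ s) (factorial-step q (a + s) b h′) ⟩
  suc q ^ s * (q * ((a + s) ! * suc b !)) ≡⟨ e′ (suc q ^ s) q _ ⟩
  q * (suc q ^ s * ((a + s) ! * suc b !)) ≤⟨ *-monoʳ-≤ q (factorial-tail q s a (suc b) (≤-trans (*-monoʳ-≤ (suc q) (n≤1+n (a + s))) (≤-trans h′ (*-monoʳ-≤ q (n≤1+n (suc b)))))) ⟩
  q * (q ^ s * (a ! * (suc b + s) !)) ≡⟨ *-assoc q (q ^ s) _ ⟨
  q ^ suc s * (a ! * (suc b + s) !) ≡⟨ cong (λ x → q ^ suc s * (a ! * x !)) (+-suc b s) ⟨
  q ^ suc s * (a ! * (b + suc s) !) ∎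
  where
  open ≤-Reasoning
  h′ : suc q * suc (a + s) ≤ q * suc b
  h′ = subst (λ x → suc q * x ≤ q * suc b) (+-suc a s) h
  e : ∀ a b c → a * b * c ≡ b * (a * c)
  e = solve-∀
  e′ : ∀ a b c → a * (b * c) ≡ b * (a * c)
  e′ = solve-∀

-- Bernoulli's inequality for (1 + 1/q)^m, cleared of denominators.
bernoulli : ∀ q m → q ^ m * (q + m) ≤ q * suc q ^ m
bernoulli q zero = ≤-reflexive (e q)
  where
  e : ∀ q → 1 * (q + 0) ≡ q * 1
  e = solve-∀
bernoulli q (suc m) = begin
  q * q ^ m * (q + suc m) ≡⟨ e₁ q (q ^ m) m ⟩
  q * (q ^ m * (q + m)) + q ^ m * q ≤⟨ +-monoʳ-≤ _ (*-monoʳ-≤ (q ^ m) (m≤m+n q m)) ⟩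
  q * (q ^ m * (q + m)) + q ^ m * (q + m) ≡⟨ +-comm _ (q ^ m * (q + m)) ⟩
  suc q * (q ^ m * (q + m)) ≤⟨ *-monoʳ-≤ (suc q) (bernoulli q m) ⟩
  suc q * (q * suc q ^ m) ≡⟨ e₂ (suc q) q (suc q ^ m) ⟩
  q * suc q ^ suc m ∎
  where
  open ≤-Reasoning
  e₁ : ∀ q p m → q * p * (q + suc m) ≡ q * (p * (q + m)) + p * q
  e₁ = solve-∀
  e₂ : ∀ a b c → a * (b * c) ≡ b * (a * c)
  e₂ = solve-∀

double-power : ∀ q .{{_ : NonZero q}} → 2 * q ^ q ≤ suc q ^ q
double-power q = *-cancelˡ-≤ q (≤-trans (≤-reflexive (e q (q ^ q))) (bernoulli q q))
  where
  e : ∀ q p → q * (2 * p) ≡ p * (q + q)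
  e = solve-∀

^-distrib-* : ∀ a b m → (a * b) ^ m ≡ a ^ m * b ^ m
^-distrib-* a b zero = refl
^-distrib-* a b (suc m) = trans (cong (a * b *_) (^-distrib-* a b m)) (e a b (a ^ m) (b ^ m))
  where
  e : ∀ a b x y → a * b * (x * y) ≡ a * x * (b * y)
  e = solve-∀

power-gain : ∀ q e .{{_ : NonZero q}} → 2 ^ e * q ^ (q * e) ≤ suc q ^ (q * e)
power-gain q e = begin
  2 ^ e * q ^ (q * e) ≡⟨ cong (2 ^ e *_) (^-*-assoc q q e) ⟨
  2 ^ e * (q ^ q) ^ e ≡⟨ ^-distrib-* 2 (q ^ q) e ⟨
  (2 * q ^ q) ^ e ≤⟨ ^-monoˡ-≤ e (double-power q) ⟩
  (suc q ^ q) ^ e ≡⟨ ^-*-assoc (suc q) q e ⟩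
  suc q ^ (q * e) ∎
  where open ≤-Reasoning

central-minimum : ∀ h n a b → h ≤ n ∸ h → h ≤ n → a + b ≡ n → a ≤ h → h ! * (n ∸ h) ! ≤ a ! * b !
central-minimum h n a b h≤ h≤n a+b≡n a≤h with m≤n⇒∃[o]m+o≡n a≤h
... | s , refl = subst (λ z → (a + s) ! * (n ∸ (a + s)) ! ≤ a ! * z !) b≡ (factorial-central s a (n ∸ (a + s)) (m≤n⇒m≤1+n h≤))
  where
  b≡ : (n ∸ (a + s)) + s ≡ b
  b≡ = +-cancelˡ-≡ a _ _ (begin
    a + ((n ∸ (a + s)) + s) ≡⟨ e a (n ∸ (a + s)) s ⟩
    (a + s) + (n ∸ (a + s)) ≡⟨ m+[n∸m]≡n h≤n ⟩
    n ≡⟨ a+b≡n ⟨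
    a + b ∎)
    where
    open ≡-Reasoning
    e : ∀ a x s → a + (x + s) ≡ (a + s) + x
    e = solve-∀

-- Let s = q e. Of the levels between `a` and `h`, the s farthest from the middle gain a factor 1 +
-- 1/q each, in total at least 2^e, and the others at least do not lose. The far steps have ratio at
-- least (h + s) / (h - s), and `wide` is exactly the condition that this is no less than 1 + 1/q.
tail-gain : ∀ q e h n a b .{{_ : NonZero q}} → h ≤ n ∸ h → h ≤ n → a + b ≡ n →
  h ≤ (2 * q + 1) * (q * e) → a + 2 * (q * e) ≤ h → 2 ^ e * (h ! * (n ∸ h) !) ≤ a ! * b !
tail-gain q e h n a b h≤ h≤n a+b≡n wide far = *-cancelˡ-≤ (q ^ s) {{m^n≢0 q s}} (begin
  q ^ s * (2 ^ e * (h ! * (n ∸ h) !)) ≡⟨ e₁ (q ^ s) (2 ^ e) _ ⟩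
  2 ^ e * q ^ s * (h ! * (n ∸ h) !) ≤⟨ *-mono-≤ (power-gain q e) (central-minimum h n (a + s) b′ h≤ h≤n a+s+b′ (≤-trans (m≤m+n (a + s) s) near)) ⟩
  suc q ^ s * ((a + s) ! * b′ !) ≤⟨ factorial-tail q s a b′ ratio ⟩
  q ^ s * (a ! * (b′ + s) !) ≡⟨ cong (λ z → q ^ s * (a ! * z !)) (m∸n+n≡m s≤b) ⟩
  q ^ s * (a ! * b !) ∎)
  where
  open ≤-Reasoning
  s = q * e
  b′ = b ∸ s
  e₁ : ∀ a b c → a * (b * c) ≡ b * a * c
  e₁ = solve-∀
  near : a + s + s ≤ h
  near = ≤-trans (≤-reflexive (e₂ a s)) far
    where
    e₂ : ∀ a s → a + s + s ≡ a + 2 * s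
    e₂ = solve-∀
  s≤b : s ≤ b
  s≤b = +-cancelˡ-≤ a _ _ (≤-trans (≤-trans (m≤m+n (a + s) s) near) (≤-trans h≤n (≤-reflexive (sym a+b≡n))))
  a+s+b′ : a + s + b′ ≡ n
  a+s+b′ = trans (+-assoc a s b′) (trans (cong (a +_) (m+[n∸m]≡n s≤b)) a+b≡n)
  h+s≤b′ : h + s ≤ b′
  h+s≤b′ = +-cancelˡ-≤ (a + s) _ _ (begin
    a + s + (h + s) ≡⟨ e₃ a s h ⟩
    (a + s + s) + h ≤⟨ +-mono-≤ near h≤ ⟩
    h + (n ∸ h) ≡⟨ m+[n∸m]≡n h≤n ⟩
    n ≡⟨ a+s+b′ ⟨
    a + s + b′ ∎)
    where
    e₃ : ∀ a s h → a + s + (h + s) ≡ (a + s + s) + h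
    e₃ = solve-∀
  ratio : suc q * (a + s) ≤ q * suc b′
  ratio = +-cancelʳ-≤ (suc q * s) _ _ (begin
    suc q * (a + s) + suc q * s ≡⟨ *-distribˡ-+ (suc q) (a + s) s ⟨
    suc q * (a + s + s) ≤⟨ *-monoʳ-≤ (suc q) near ⟩
    h + q * h ≤⟨ +-monoˡ-≤ (q * h) wide ⟩
    (2 * q + 1) * s + q * h ≡⟨ e₄ q s h ⟩
    q * (h + s) + suc q * s ≤⟨ +-monoˡ-≤ (suc q * s) (*-monoʳ-≤ q (m≤n⇒m≤1+n h+s≤b′)) ⟩
    q * suc b′ + suc q * s ∎)
    where
    e₄ : ∀ q s h → (2 * q + 1) * s + q * h ≡ q * (h + s) + suc q * s
    e₄ = solve-∀

suc≤2^ : ∀ n → suc n ≤ 2 ^ n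
suc≤2^ zero = ≤-refl
suc≤2^ (suc n) = ≤-trans (s≤s (m≤n+m (suc n) n)) (≤-trans (≤-reflexive (cong (λ z → suc (n + suc z)) (sym (+-identityʳ n)))) (*-monoʳ-≤ 2 (suc≤2^ n)))

linear≤2^ : ∀ c j → c * (2 * c + 1 + j) ≤ 2 ^ (2 * c + 1 + j)
linear≤2^ c zero = begin
  c * (2 * c + 1 + 0) ≤⟨ m≤m+n _ (3 * c + 2) ⟩
  c * (2 * c + 1 + 0) + (3 * c + 2) ≡⟨ e c ⟩
  2 * (suc c * suc c) ≤⟨ *-monoʳ-≤ 2 (*-mono-≤ (suc≤2^ c) (suc≤2^ c)) ⟩
  2 * (2 ^ c * 2 ^ c) ≡⟨ cong (2 *_) (^-distribˡ-+-* 2 c c) ⟨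
  2 ^ suc (c + c) ≡⟨ cong (2 ^_) (e′ c) ⟩
  2 ^ (2 * c + 1 + 0) ∎
  where
  open ≤-Reasoning
  e : ∀ c → c * (2 * c + 1 + 0) + (3 * c + 2) ≡ 2 * (suc c * suc c)
  e = solve-∀
  e′ : ∀ c → suc (c + c) ≡ 2 * c + 1 + 0
  e′ = solve-∀
linear≤2^ c (suc j) = begin
  c * (2 * c + 1 + suc j) ≡⟨ e c j ⟩
  c * (2 * c + 1 + j) + c * 1 ≤⟨ +-monoʳ-≤ _ (*-monoʳ-≤ c (≤-trans (m≤n+m 1 (2 * c)) (m≤m+n (2 * c + 1) j))) ⟩
  c * (2 * c + 1 + j) + c * (2 * c + 1 + j) ≤⟨ +-mono-≤ (linear≤2^ c j) (linear≤2^ c j) ⟩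
  2 ^ (2 * c + 1 + j) + 2 ^ (2 * c + 1 + j) ≡⟨ cong (2 ^ (2 * c + 1 + j) +_) (+-identityʳ _) ⟨
  2 ^ suc (2 * c + 1 + j) ≡⟨ cong (2 ^_) (+-suc (2 * c + 1) j) ⟨
  2 ^ (2 * c + 1 + suc j) ∎
  where
  open ≤-Reasoning
  e : ∀ c j → c * (2 * c + 1 + suc j) ≡ c * (2 * c + 1 + j) + c * 1
  e = solve-∀

-- From a large family to a grid

binomial-factorials : ∀ n h → h ≤ n → (n C h) * (h ! * (n ∸ h) !) ≡ n !
binomial-factorials n h h≤n = trans (cong (_* (h ! * (n ∸ h) !)) (nCk≡n!/k![n-k]! h≤n)) (m/n*n≡m {{_}} (k![n∸k]!∣n! h≤n))

-- Each of the n + 1 levels is met at most once by each of the `n !` orderings.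
mass-≤ : ∀ F n → Unique F → (∀ {s} → s ∈ F → length s ≡ n) → mass F ≤ suc n * n !
mass-≤ F n uniq len = begin
  mass F ≤⟨ ∑-layer-≥ F 0 (suc n) (λ {t} i → z≤n , s≤s (≤-trans (m≤n+m (falses t) (trues t)) (≤-reflexive (trans (trues+falses t) (len i))))) ⟩
  ∑ (range 0 (suc n)) (layer F) ≡⟨ ∑-cong∈ (range 0 (suc n)) (λ {b} i → sym (upset-layer F n uniq len b (≤-pred (proj₂ (∈-range⁻ 0 (suc n) i))))) ⟩
  ∑ (range 0 (suc n)) (λ b → ∑ (perms (range 0 n)) (ind ∘ upset F n uniq len b))
    ≤⟨ ∑-bound (range 0 (suc n)) _ (n !) (λ b → ≤-trans (∑-bound (perms (range 0 n)) _ 1 (λ l → ind≤1 _))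
         (≤-reflexive (trans (*-identityʳ _) (trans (length-perms (range 0 n)) (cong _! (length-range 0 n)))))) ⟩
  length (range 0 (suc n)) * n ! ≡⟨ cong (_* n !) (length-range 0 (suc n)) ⟩
  suc n * n ! ∎
  where open ≤-Reasoning

κ-power : ∀ t c R m → κ t (c * R ^ m) ≡ κ t c * R ^ (m * suc t)
κ-power t c R m = begin
  2 * (c * R ^ m) * (2 * t * (c * R ^ m)) ^ t ≡⟨ cong (λ z → 2 * (c * R ^ m) * z ^ t) (*-assoc (2 * t) c (R ^ m)) ⟨
  2 * (c * R ^ m) * ((2 * t * c) * R ^ m) ^ t ≡⟨ cong (2 * (c * R ^ m) *_) (^-distrib-* (2 * t * c) (R ^ m) t) ⟩
  2 * (c * R ^ m) * ((2 * t * c) ^ t * (R ^ m) ^ t) ≡⟨ e c (R ^ m) ((2 * t * c) ^ t) _ ⟩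
  2 * c * (2 * t * c) ^ t * (R ^ m * (R ^ m) ^ t) ≡⟨ cong (2 * c * (2 * t * c) ^ t *_) (^-*-assoc R m (suc t)) ⟩
  κ t c * R ^ (m * suc t) ∎
  where
  open ≡-Reasoning
  e : ∀ c p q r → 2 * (c * p) * (q * r) ≡ 2 * c * q * (p * r)
  e = solve-∀

-- The iterated loss is a monomial: a factor R^m of the reciprocal density becomes R^(m (t + 1)^j).
-- With m = k k, from fixing k gaps and then raising `G` to the power k, this is the origin of `E`.
κ^-power : ∀ t j c R m → κ^ t j (c * R ^ m) ≡ κ^ t j c * R ^ (m * suc t ^ j)
κ^-power t zero c R m = cong (λ z → c * R ^ z) (sym (*-identityʳ m))
κ^-power t (suc j) c R m = begin
  κ^ t j (κ t (c * R ^ m)) ≡⟨ cong (κ^ t j) (κ-power t c R m) ⟩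
  κ^ t j (κ t c * R ^ (m * suc t)) ≡⟨ κ^-power t j (κ t c) R (m * suc t) ⟩
  κ^ t j (κ t c) * R ^ (m * suc t * suc t ^ j) ≡⟨ cong (λ z → κ^ t j (κ t c) * R ^ z) (*-assoc m (suc t) (suc t ^ j)) ⟩
  κ^ t (suc j) c * R ^ (m * (suc t * suc t ^ j)) ∎
  where open ≡-Reasoning

singletons : ∀ s m → concatMap (λ Δ → Δ) (map (_∷ []) (range s m)) ≡ range s m
singletons s zero = refl
singletons s (suc m) = cong (s ∷_) (singletons (suc s) m)

vsum-≤ : ∀ {k} (ds : Vec ℕ k) w → (∀ j → lookup ds j ≤ w) → vsum ds ≤ k * w
vsum-≤ [] w h = z≤n
vsum-≤ (d ∷ ds) w h = +-mono-≤ (h zero) (vsum-≤ ds w (h ∘ suc))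

module _ (F : List (List Bool)) (n : ℕ) (uniq : Unique F) (len : ∀ {s} → s ∈ F → length s ≡ n) where

  -- Either some single gap d ≤ E between members of a chain occurs often, which costs nothing
  -- in density, or gaps larger than E do; then fixing the gaps costs a power of y of bounded
  -- degree, but the parts have y^(E+1) vertices.
  grid-of-massive : ∀ a k t h y E r M c K .{{_ : NonZero a}} .{{_ : NonZero k}} .{{_ : NonZero t}} →
    E ≡ k * k * suc t ^ k → r ≡ 3 * a * suc E → M ≡ 2 * k * r → c ≡ k * κ k r + 1 → K ≡ 2 * t * κ^ t k (c ^ k) →
    K * 2 ^ E ≤ y → E < y → (k * suc E + 1) * y ≤ h → h + y + M * (2 * y) ≤ n →
    (∀ {s} → s ∈ F → h ∸ y ≤ falses s × falses s ≤ h + y) →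
    suc a * n ! ≤ a * mass F → mass F ≤ 3 * n ! → Grid F k t
  grid-of-massive a k t h y E r M c K E≡ r≡ M≡ c≡ K≡ K≤y E<y below above central heavy light =
    type-grid (proj₁ best) (proj₁ (proj₂ best)) (proj₂ (proj₂ best))
    where
    y′ = y ∸ E
    E+y′ : E + y′ ≡ y
    E+y′ = m+[n∸m]≡n (<⇒≤ E<y)
    lo = h ∸ y
    w = 2 * y
    w′ = y′ + y
    instance
      r≢0 : NonZero r
      r≢0 = subst NonZero (sym r≡) (m*n≢0 (3 * a) (suc E) {{m*n≢0 3 a}})
      c≢0 : NonZero c
      c≢0 = >-nonZero (subst (0 <_) (sym c≡) (m≤n+m 1 (k * κ k r)))
      y≢0 : NonZero y
      y≢0 = >-nonZero (≤-<-trans z≤n E<y)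
    y≤h : y ≤ h
    y≤h = ≤-trans (≤-trans (m≤n+m y (k * suc E * y)) (≤-reflexive (e (k * suc E) y))) below
      where
      e : ∀ x y → x * y + y ≡ (x + 1) * y
      e = solve-∀
    lo+w : lo + w ≡ h + y
    lo+w = trans (e lo y) (cong (_+ y) (m∸n+n≡m y≤h))
      where
      e : ∀ l y → l + 2 * y ≡ (l + y) + y
      e = solve-∀
    E+w′ : E + w′ ≡ w
    E+w′ = trans (sym (+-assoc E y′ y)) (trans (cong (_+ y) E+y′) (cong (y +_) (sym (+-identityʳ y))))
    central′ : ∀ {s} → s ∈ F → lo ≤ falses s × falses s ≤ lo + w
    central′ i = proj₁ (central i) , ≤-trans (proj₂ (central i)) (≤-reflexive (sym lo+w))
    room : lo + w + M * w ≤ n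
    room = ≤-trans (≤-reflexive (cong (_+ M * w) lo+w)) above
    -- One class for each gap up to `E` and one for all longer gaps, hence the factor `suc E` in the
    -- pigeonhole.
    Δs : List (List ℕ)
    Δs = map (_∷ []) (range 1 E) ++ range (suc E) w′ ∷ []
    split : concatMap (λ Δ → Δ) Δs ≡ range 1 w
    split = trans (sym (concat-++ (map (λ Δ → Δ) (map (_∷ []) (range 1 E))) _ ⟨≡⟩ cong List.concat (map-++ (λ Δ → Δ) (map (_∷ []) (range 1 E)) _)))
      (trans (cong₂ _++_ (singletons 1 E) (++-identityʳ (range (suc E) w′))) (trans (sym (range-++ 1 E w′)) (cong (range 1) E+w′)))
      where
      _⟨≡⟩_ : ∀ {A : Set} {x y z : A} → x ≡ y → z ≡ y → x ≡ z
      p ⟨≡⟩ q = trans p (sym q)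
    length-Δs : length Δs ≡ suc E
    length-Δs = trans (length-++ (map (_∷ []) (range 1 E))) (trans (cong (_+ 1) (trans (length-map _ (range 1 E)) (length-range 1 E))) (+-comm E 1))
    H : List ℕ → ℕ
    H = hits F n uniq len lo w
    open ≤-Reasoning
    surplus : n ! ≤ a * ∑ Δs H
    surplus = +-cancelʳ-≤ (a * n !) _ _ (begin
      suc a * n ! ≤⟨ heavy ⟩
      a * mass F ≤⟨ *-monoʳ-≤ a (mass≤hits F n uniq len lo w Δs (≤-trans (m≤m+n (lo + w) (M * w)) room) central′ split) ⟩
      a * (n ! + ∑ Δs H) ≡⟨ trans (*-distribˡ-+ a (n !) _) (+-comm (a * n !) _) ⟩
      a * ∑ Δs H + a * n ! ∎)
    best : ∃[ Δ ] Δ ∈ Δs × n ! ≤ suc E * a * H Δ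
    best = ∑-pigeonhole-≤ Δs (λ _ → n !) (λ Δ → suc E * a * H Δ) (subst (0 <_) (sym length-Δs) (s≤s z≤n)) (begin
      ∑ Δs (λ _ → n !) ≡⟨ ∑-const Δs _ ⟩
      length Δs * n ! ≤⟨ *-mono-≤ (≤-reflexive length-Δs) surplus ⟩
      suc E * (a * ∑ Δs H) ≡⟨ *-assoc (suc E) a _ ⟨
      suc E * a * ∑ Δs H ≡⟨ ∑-* (suc E * a) Δs H ⟨
      ∑ Δs (λ Δ → suc E * a * H Δ) ∎)
    mass>0 : 0 < mass F
    mass>0 = n≢0⇒n>0 (λ eq → <⇒≱ (>-nonZero⁻¹ (suc a * n !) {{m*n≢0 (suc a) (n !) {{it}} {{n !≢0}}}})
      (≤-trans heavy (≤-reflexive (trans (cong (a *_) eq) (*-zeroʳ a)))))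
    -- `x` bounds the gaps from below and becomes the number of blocks met by a transversal: the
    -- parts have y^x vertices, to be weighed against a loss of `length Δ ^ E`.
    from-type : ∀ Δ x → 1 ≤ x → x ≤ suc E → (∀ {d} → d ∈ Δ → x ≤ d × d ≤ w) → 0 < length Δ → K * length Δ ^ E ≤ y ^ x →
      n ! ≤ suc E * a * H Δ → Grid F k t
    from-type Δ x x≥1 x≤ Δ-bounds Δ>0 enough often = finish level
      where
      R = length Δ
      G = c * R ^ k
      -- The origin of `r`: 3 comes from `light`, `a` from the surplus and `suc E` from the choice
      -- of a class.
      many : mass F ≤ r * H Δ
      many = begin
        mass F ≤⟨ light ⟩
        3 * n ! ≤⟨ *-monoʳ-≤ 3 often ⟩
        3 * (suc E * a * H Δ) ≡⟨ e (suc E) a (H Δ) ⟩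
        3 * a * suc E * H Δ ≡⟨ cong (_* H Δ) r≡ ⟨
        r * H Δ ∎
        where
        e : ∀ E a H → 3 * (E * a * H) ≡ 3 * a * E * H
        e = solve-∀
      klo : k * (suc E * y) ≤ lo
      klo = +-cancelʳ-≤ y _ _ (begin
        k * (suc E * y) + y ≡⟨ e k (suc E) y ⟩
        (k * suc E + 1) * y ≤⟨ below ⟩
        h ≡⟨ m∸n+n≡m y≤h ⟨
        lo + y ∎)
        where
        e : ∀ k E y → k * (E * y) + y ≡ (k * E + 1) * y
        e = solve-∀
      k≤M : k ≤ M
      k≤M = ≤-trans (≤-trans (m≤n*m k 2) (m≤m*n (2 * k) r)) (≤-reflexive (sym M≡))
      size-ok : 2 * t * κ^ t k (G ^ k) ≤ y ^ x
      size-ok = begin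
        2 * t * κ^ t k ((c * R ^ k) ^ k) ≡⟨ cong (λ z → 2 * t * κ^ t k z) (trans (^-distrib-* c (R ^ k) k) (cong (c ^ k *_) (^-*-assoc R k k))) ⟩
        2 * t * κ^ t k (c ^ k * R ^ (k * k)) ≡⟨ cong (2 * t *_) (κ^-power t k (c ^ k) R (k * k)) ⟩
        2 * t * (κ^ t k (c ^ k) * R ^ (k * k * suc t ^ k)) ≡⟨ cong (λ z → 2 * t * (κ^ t k (c ^ k) * R ^ z)) E≡ ⟨
        2 * t * (κ^ t k (c ^ k) * R ^ E) ≡⟨ *-assoc (2 * t) _ _ ⟨
        2 * t * κ^ t k (c ^ k) * R ^ E ≡⟨ cong (_* R ^ E) K≡ ⟨
        K * R ^ E ≤⟨ enough ⟩
        y ^ x ∎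
      finish : (∃[ b ] b ∈ range lo (suc w) × ∃[ ds ] ds ∈ tuples Δ k ×
        ∑ (fins k) (λ j → layer F (b + lookup ds j)) < (k * κ k r + 1) * length Δ ^ k * edges F n uniq len b ds) → Grid F k t
      finish (b , bi , ds , di , sparse) =
        grid-from-level F n uniq len t b ds G {{it}} {{m*n≢0 c (length Δ ^ k) {{it}} {{m^n≢0 (length Δ) k {{>-nonZero Δ>0}}}}}} x≥1
          (λ j → proj₁ (Δ-bounds (∈-tuples⁻ k di j)))
          (≤-trans (≤-trans (*-monoʳ-≤ k (*-mono-≤ x≤ (pred[n]≤n {y}))) klo) (proj₁ (∈-range⁻ lo (suc w) bi)))
          (≤-trans (+-mono-≤ (≤-pred (subst (b <_) (+-suc lo w) (proj₂ (∈-range⁻ lo (suc w) bi)))) (≤-trans (vsum-≤ ds w (λ j → proj₂ (Δ-bounds (∈-tuples⁻ k di j)))) (*-monoˡ-≤ w k≤M))) room)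
          (subst (λ z → ∑ (fins k) (λ j → layer F (b + lookup ds j)) < z * length Δ ^ k * edges F n uniq len b ds) (sym c≡) sparse)
          (subst (λ z → 2 * t * κ^ t k (G ^ k) ≤ z ^ x) (sym (suc-pred y)) size-ok)
      level : ∃[ b ] b ∈ range lo (suc w) × ∃[ ds ] ds ∈ tuples Δ k ×
        ∑ (fins k) (λ j → layer F (b + lookup ds j)) < (k * κ k r + 1) * length Δ ^ k * edges F n uniq len b ds
      level = dense-level F n uniq len lo w M room central′ k r Δ M≡ (proj₂ ∘ Δ-bounds) Δ>0 mass>0 many
    type-grid : ∀ Δ → Δ ∈ Δs → n ! ≤ suc E * a * H Δ → Grid F k t
    type-grid Δ i often with ∈-++⁻ (map (_∷ []) (range 1 E)) i
    type-grid Δ i often | inj₁ j with ∈-map⁻ (_∷ []) j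
    ... | d , di , refl = from-type (d ∷ []) 1 ≤-refl (s≤s z≤n)
            (λ { (here refl) → proj₁ (∈-range⁻ 1 E di) , ≤-trans (≤-pred (proj₂ (∈-range⁻ 1 E di))) (≤-trans (<⇒≤ E<y) (m≤m+n y _)) })
            (s≤s z≤n) (≤-trans (*-monoʳ-≤ K (≤-trans (≤-reflexive (^-zeroˡ E)) (>-nonZero⁻¹ (2 ^ E) {{m^n≢0 2 E}}))) (≤-trans K≤y (≤-reflexive (sym (*-identityʳ y))))) often
    type-grid Δ i often | inj₂ (here refl) = from-type Δ (suc E) (s≤s z≤n) ≤-refl
            (λ di → proj₁ (∈-range⁻ (suc E) w′ di) , ≤-trans (≤-pred (proj₂ (∈-range⁻ (suc E) w′ di))) (≤-reflexive E+w′))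
            (subst (0 <_) (sym (length-range (suc E) w′)) (≤-trans (>-nonZero⁻¹ y) (m≤n+m y y′)))
            -- At most 2 y gaps occur, so the loss is at most K 2^E y^E, and K 2^E ≤ y fits this
            -- into y^(E + 1).
            (begin
              K * length Δ ^ E ≤⟨ *-monoʳ-≤ K (^-monoˡ-≤ E (≤-trans (≤-reflexive (length-range (suc E) w′)) (≤-trans (m≤n+m w′ E) (≤-reflexive E+w′)))) ⟩
              K * (2 * y) ^ E ≡⟨ trans (cong (K *_) (^-distrib-* 2 y E)) (sym (*-assoc K (2 ^ E) (y ^ E))) ⟩
              K * 2 ^ E * y ^ E ≤⟨ *-monoˡ-≤ (y ^ E) K≤y ⟩
              y ^ suc E ∎) often

-- Removing entries one at a time overshoots the target by at most one entry. The trimmed family has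
-- mass of order n!, so a surplus of order n! is a proportion of it that does not shrink with n.
trim : ∀ (xs : List A) (f : A → ℕ) T W → (∀ {x} → x ∈ xs → f x ≤ W) → T ≤ ∑ xs f → ∃[ ys ] ys ⊆ xs × T ≤ ∑ ys f × ∑ ys f ≤ T + W
trim [] f T W h p = [] , [] , p , z≤n
trim (x ∷ xs) f T W h p with T ≤? ∑ xs f
... | yes q = let ys , s , a , b = trim xs f T W (h ∘ there) q in ys , x ∷ʳ s , a , b
... | no q = x ∷ xs , ⊆-refl , p , ≤-trans (+-mono-≤ (h (here refl)) (<⇒≤ (≰⇒> q))) (≤-reflexive (+-comm W T))

length-filter-¬ : ∀ {P : A → Set} (P? : Decidable P) xs → length (filter P? xs) + length (filter (¬? ∘ P?) xs) ≡ length xs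
length-filter-¬ P? [] = refl
length-filter-¬ P? (x ∷ xs) with P? x
... | yes _ = cong suc (length-filter-¬ P? xs)
... | no _ = trans (+-suc _ _) (cong suc (length-filter-¬ P? xs))

Central : ℕ → ℕ → List Bool → Set
Central h y s = h ∸ y ≤ falses s × falses s ≤ h + y

central? : ∀ h y → Decidable (Central h y)
central? h y s = (h ∸ y ≤? falses s) ×-dec (falses s ≤? h + y)

module _ (F : List (List Bool)) (n : ℕ) (uniq : Unique F) (len : ∀ {s} → s ∈ F → length s ≡ n) where

  -- Members off the window weigh at least 2^e times the least weight `u`, while no family weighs
  -- more than (n + 1) n!. So they are few, and discarding them only halves the excess from 1/a to
  -- 1/(2a).
  grid-of-large : ∀ a k t q e E r M c K h y .{{_ : NonZero a}} .{{_ : NonZero k}} .{{_ : NonZero t}} .{{_ : NonZero q}} →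
    E ≡ k * k * suc t ^ k → r ≡ 3 * (2 * a) * suc E → M ≡ 2 * k * r → c ≡ k * κ k r + 1 → K ≡ 2 * t * κ^ t k (c ^ k) →
    h ≡ n / 2 → y ≡ 2 * (q * e) →
    K * 2 ^ E ≤ y → E < y → (k * suc E + 1) * y ≤ h → h + y + M * (2 * y) ≤ n →
    h ≤ (2 * q + 1) * (q * e) → 2 * a * suc n ≤ 2 ^ e →
    suc a * n ! ≤ a * (length F * (h ! * (n ∸ h) !)) → ∃[ F′ ] (∀ {s} → s ∈ F′ → s ∈ F) × Grid F′ k t
  grid-of-large a k t q e E r M c K h y E≡ r≡ M≡ c≡ K≡ h≡ y≡ K≤y E<y below above wide exponential large =
    -- Scaling the weights by 2 a makes the target (1 + 1/(2a)) n! an integer.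
    finish (trim inner (λ s → 2 * a * weight s) (suc (2 * a) * n !) (2 * a * n !) bound heavy)
    where
    open ≤-Reasoning
    e₀ : ∀ a x → 2 * a * x + 2 * a * x + 2 * a * x ≡ 2 * a * (3 * x)
    e₀ = solve-∀
    u = h ! * (n ∸ h) !
    h*2≤n : h * 2 ≤ n
    h*2≤n = subst (λ h → h * 2 ≤ n) (sym h≡) (m/n*n≤m n 2)
    h+h≤n : h + h ≤ n
    h+h≤n = ≤-trans (≤-reflexive (trans (cong (h +_) (sym (+-identityʳ h))) (*-comm 2 h))) h*2≤n
    h≤n : h ≤ n
    h≤n = ≤-trans (m≤m+n h h) h+h≤n
    h≤n∸h : h ≤ n ∸ h
    h≤n∸h = +-cancelˡ-≤ h _ _ (≤-trans h+h≤n (≤-reflexive (sym (m+[n∸m]≡n h≤n))))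
    n≤h+h+1 : n ≤ suc (h + h)
    n≤h+h+1 = ≤-trans (≤-reflexive (m≡m%n+[m/n]*n n 2)) (+-mono-≤ (≤-pred (m%n<n n 2)) (≤-reflexive (trans (cong (_* 2) (sym h≡)) (trans (*-comm h 2) (cong (h +_) (+-identityʳ h))))))
    inner = filter (central? h y) F
    outer = filter (¬? ∘ central? h y) F
    inner-unique : Unique inner
    inner-unique = UniqueP.filter⁺ (central? h y) uniq
    bound : ∀ {s} → s ∈ inner → 2 * a * weight s ≤ 2 * a * n !
    bound {s} i = *-monoʳ-≤ (2 * a) (≤-trans (weight≤! s) (≤-reflexive (cong _! (len (proj₁ (∈-filter⁻ (central? h y) i))))))
    inner-weight : ∀ {s} → s ∈ F → u ≤ weight s
    inner-weight {s} i with trues s ≤? h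
    ... | yes p = central-minimum h n (trues s) (falses s) h≤n∸h h≤n (trans (trues+falses s) (len i)) p
    ... | no p = ≤-trans (central-minimum h n (falses s) (trues s) h≤n∸h h≤n (trans (+-comm (falses s) (trues s)) (trans (trues+falses s) (len i))) f≤h)
                   (≤-reflexive (*-comm (falses s !) (trues s !)))
      where
      f≤h : falses s ≤ h
      f≤h = +-cancelˡ-≤ (suc h) _ _ (begin
        suc h + falses s ≤⟨ +-monoˡ-≤ (falses s) (≰⇒> p) ⟩
        trues s + falses s ≡⟨ trans (trues+falses s) (len i) ⟩
        n ≤⟨ n≤h+h+1 ⟩
        suc h + h ∎)
    far : ∀ {x} → x + y ≤ h → x + 2 * (q * e) ≤ h
    far {x} = subst (λ y → x + y ≤ h) y≡
    outer-weight : ∀ {s} → s ∈ outer → 2 ^ e * u ≤ weight s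
    outer-weight {s} i with ∈-filter⁻ (¬? ∘ central? h y) {xs = F} i
    ... | s∈F , ¬c with h ∸ y ≤? falses s
    ...   | no low = ≤-trans (tail-gain q e h n (falses s) (trues s) h≤n∸h h≤n (trans (+-comm (falses s) (trues s)) (trans (trues+falses s) (len s∈F))) wide
                      (far (<⇒≤ (subst (falses s + y <_) (m∸n+n≡m y≤h) (+-monoˡ-< y (≰⇒> low))))))
                      (≤-reflexive (*-comm (falses s !) (trues s !)))
      where
      y≤h : y ≤ h
      y≤h = ≤-trans (m≤n*m y (k * suc E + 1) {{>-nonZero (m≤n+m 1 _)}}) below
    ...   | yes low with falses s ≤? h + y
    ...     | yes high = ⊥-elim (¬c (low , high))
    ...     | no high = tail-gain q e h n (trues s) (falses s) h≤n∸h h≤n (trans (trues+falses s) (len s∈F)) wide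
                (far (+-cancelʳ-≤ (suc h) _ _ (begin
                  trues s + y + suc h ≡⟨ e₁ (trues s) y h ⟩
                  trues s + suc (h + y) ≤⟨ +-monoʳ-≤ (trues s) (≰⇒> high) ⟩
                  trues s + falses s ≡⟨ trans (trues+falses s) (len s∈F) ⟩
                  n ≤⟨ n≤h+h+1 ⟩
                  suc (h + h) ≡⟨ +-suc h h ⟨
                  h + suc h ∎)))
      where
      e₁ : ∀ x y h → x + y + suc h ≡ x + suc (h + y)
      e₁ = solve-∀
    ∑-≥-const : ∀ (G : List (List Bool)) c → (∀ {s} → s ∈ G → c ≤ weight s) → length G * c ≤ mass G
    ∑-≥-const G c p = ≤-trans (≤-reflexive (sym (∑-const G c))) (∑-mono∈ G p)
    outer-small : 2 * a * (length outer * u) ≤ n !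
    outer-small = *-cancelˡ-≤ (suc n) (begin
      suc n * (2 * a * (length outer * u)) ≡⟨ e₂ (suc n) (2 * a) (length outer) u ⟩
      length outer * (2 * a * suc n * u) ≤⟨ *-monoʳ-≤ (length outer) (*-monoˡ-≤ u exponential) ⟩
      length outer * (2 ^ e * u) ≤⟨ ∑-≥-const outer (2 ^ e * u) outer-weight ⟩
      mass outer ≤⟨ mass-≤ outer n (UniqueP.filter⁺ (¬? ∘ central? h y) uniq) (λ i → len (proj₁ (∈-filter⁻ (¬? ∘ central? h y) i))) ⟩
      suc n * n ! ∎)
      where
      e₂ : ∀ n a l u → n * (a * (l * u)) ≡ l * (a * n * u)
      e₂ = solve-∀
    heavy : suc (2 * a) * n ! ≤ ∑ inner (λ s → 2 * a * weight s)
    heavy = ≤-trans (+-cancelʳ-≤ (n !) _ _ (begin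
      suc (2 * a) * n ! + n ! ≡⟨ e₃ a (n !) ⟩
      2 * (suc a * n !) ≤⟨ *-monoʳ-≤ 2 large ⟩
      2 * (a * (length F * u)) ≡⟨ cong (λ z → 2 * (a * (z * u))) (length-filter-¬ (central? h y) F) ⟨
      2 * (a * ((length inner + length outer) * u)) ≡⟨ e₄ a (length inner) (length outer) u ⟩
      2 * a * (length inner * u) + 2 * a * (length outer * u)
        ≤⟨ +-mono-≤ (*-monoʳ-≤ (2 * a) (∑-≥-const inner u (λ i → inner-weight (proj₁ (∈-filter⁻ (central? h y) i))))) outer-small ⟩
      2 * a * mass inner + n ! ∎)) (≤-reflexive (sym (∑-* (2 * a) inner weight)))
      where
      e₃ : ∀ a x → suc (2 * a) * x + x ≡ 2 * (suc a * x)
      e₃ = solve-∀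
      e₄ : ∀ a i o u → 2 * (a * ((i + o) * u)) ≡ 2 * a * (i * u) + 2 * a * (o * u)
      e₄ = solve-∀
    finish : (∃[ F′ ] F′ ⊆ inner × suc (2 * a) * n ! ≤ ∑ F′ (λ s → 2 * a * weight s) × ∑ F′ (λ s → 2 * a * weight s) ≤ suc (2 * a) * n ! + 2 * a * n !) →
      ∃[ F′ ] (∀ {s} → s ∈ F′ → s ∈ F) × Grid F′ k t
    finish (F′ , F′⊆ , lower , upper) = F′ , F′⊆F ,
      grid-of-massive F′ n (Unique-⊆ F′⊆ inner-unique) (λ i → len (F′⊆F i)) (2 * a) k t h y E r M c K {{m*n≢0 2 a}} E≡ r≡ M≡ c≡ K≡
        K≤y E<y below above (λ i → proj₂ (∈-filter⁻ (central? h y) {xs = F} (Sub.lookup F′⊆ i)))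
        (≤-trans lower (≤-reflexive (∑-* (2 * a) F′ weight))) light
      where
      F′⊆F : ∀ {s} → s ∈ F′ → s ∈ F
      F′⊆F i = proj₁ (∈-filter⁻ (central? h y) (Sub.lookup F′⊆ i))
      light : mass F′ ≤ 3 * n !
      light = *-cancelˡ-≤ (2 * a) {{m*n≢0 2 a}} (begin
        2 * a * mass F′ ≡⟨ ∑-* (2 * a) F′ weight ⟨
        ∑ F′ (λ s → 2 * a * weight s) ≤⟨ upper ⟩
        suc (2 * a) * n ! + 2 * a * n ! ≤⟨ +-monoˡ-≤ (2 * a * n !) (+-monoˡ-≤ (2 * a * n !) (m≤n*m (n !) (2 * a) {{m*n≢0 2 a}})) ⟩
        2 * a * n ! + 2 * a * n ! + 2 * a * n ! ≡⟨ e₀ a (n !) ⟩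
        2 * a * (3 * n !) ∎)

toList-injective : ∀ {n} (xs ys : Subset n) → toList xs ≡ toList ys → xs ≡ ys
toList-injective [] [] e = refl
toList-injective (x ∷ xs) (y ∷ ys) e = cong₂ _∷_ (∷-injectiveˡ e) (toList-injective xs ys (∷-injectiveʳ e))

family : ∀ {n} → List (Subset n) → List (List Bool)
family = map toList

family-large : ∀ {n} (𝓕 : List (Subset n)) → Unique 𝓕 → ∀ m {k t} q e E r M c K .{{_ : NonZero k}} .{{_ : NonZero t}} .{{_ : NonZero q}} →
    E ≡ k * k * suc t ^ k → r ≡ 3 * (2 * suc m) * suc E → M ≡ 2 * k * r → c ≡ k * κ k r + 1 → K ≡ 2 * t * κ^ t k (c ^ k) →
    K * 2 ^ E ≤ 2 * (q * e) → E < 2 * (q * e) → (k * suc E + 1) * (2 * (q * e)) ≤ n / 2 → n / 2 + 2 * (q * e) + M * (2 * (2 * (q * e))) ≤ n →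
    n / 2 ≤ (2 * q + 1) * (q * e) → 2 * suc m * suc n ≤ 2 ^ e →
    ¬ (suc m * length 𝓕 ≤ (2 + m) * (n C (n / 2))) → ∃[ F′ ] (∀ {s} → s ∈ F′ → s ∈ family 𝓕) × Grid F′ k t
family-large {n} 𝓕 uniq m {k} {t} q e E r M c K E≡ r≡ M≡ c≡ K≡ K≤y E<y below above wide exponential large =
  grid-of-large (family 𝓕) n (UniqueP.map⁺ (λ {xs} {ys} → toList-injective xs ys) uniq) lengths (suc m) k t q e E r M c K (n / 2) (2 * (q * e))
    E≡ r≡ M≡ c≡ K≡ refl refl K≤y E<y below above wide exponential (begin
      suc (suc m) * n ! ≡⟨ cong (suc (suc m) *_) (binomial-factorials n h h≤n) ⟨
      (2 + m) * ((n C h) * u) ≡⟨ *-assoc (2 + m) (n C h) u ⟨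
      (2 + m) * (n C h) * u ≤⟨ *-monoˡ-≤ u (<⇒≤ (≰⇒> large)) ⟩
      suc m * length 𝓕 * u ≡⟨ *-assoc (suc m) (length 𝓕) u ⟩
      suc m * (length 𝓕 * u) ≡⟨ cong (λ z → suc m * (z * u)) (length-map toList 𝓕) ⟨
      suc m * (length (family 𝓕) * u) ∎)
  where
  open ≤-Reasoning
  h = n / 2
  u = h ! * (n ∸ h) !
  h≤n : h ≤ n
  h≤n = ≤-trans (m≤m*n h 2) (m/n*n≤m n 2)
  lengths : ∀ {s} → s ∈ family 𝓕 → length s ≡ n
  lengths i with ∈-map⁻ toList i
  ... | S , _ , refl = length-toList S

-- e is proportional to n and y = 2qe is the half-width of the window of central levels.
parameters : ∀ k E M K m → ∃[ N ] ∀ n → n ≥ N → ∃[ q ] ∃[ e ] NonZero q × K * 2 ^ E ≤ 2 * (q * e) × E < 2 * (q * e) ×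
  (k * suc E + 1) * (2 * (q * e)) ≤ n / 2 × n / 2 + 2 * (q * e) + M * (2 * (2 * (q * e))) ≤ n ×
  n / 2 ≤ (2 * q + 1) * (q * e) × 2 * suc m * suc n ≤ 2 ^ e
parameters k E M K m = E₀ * Q , λ n n≥N → conditions n (n / Q) (m/n*n≤m n Q)
    (≤-trans (s≤s (≤-reflexive (m≡m%n+[m/n]*n n Q))) (+-monoˡ-≤ (n / Q * Q) (m%n<n n Q)))
    (subst (_≤ n / Q) (m*n/n≡m E₀ Q) (/-monoˡ-≤ Q n≥N))
  where
  -- `c` exceeds k (E + 1) + 1 and 2 M + 1, for the two conditions on room. With e = n / Q and Q = 4
  -- c q one gets 2 c y = e Q ≤ n; as q = 2 c, also Q = 2 q q, which gives `wide`. `d` absorbs the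
  -- linear bound that 2^e must exceed, and `E₀` is the size of e from which everything holds.
  c q Q d E₀ : ℕ
  c = suc (k * suc E + 2 * M + 1)
  q = 2 * c
  Q = 4 * c * q
  d = 4 * suc m * Q
  E₀ = (2 * d + 1) + (K * 2 ^ E + suc E)
  open ≤-Reasoning
  conditions : ∀ n e → e * Q ≤ n → suc n ≤ Q + e * Q → E₀ ≤ e → ∃[ q ] ∃[ e ] NonZero q × K * 2 ^ E ≤ 2 * (q * e) × E < 2 * (q * e) ×
    (k * suc E + 1) * (2 * (q * e)) ≤ n / 2 × n / 2 + 2 * (q * e) + M * (2 * (2 * (q * e))) ≤ n ×
    n / 2 ≤ (2 * q + 1) * (q * e) × 2 * suc m * suc n ≤ 2 ^ e
  conditions n e Qe≤n n<Q+Qe E₀≤e = q , e , it ,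
    ≤-trans (≤-trans (m≤m+n (K * 2 ^ E) (suc E)) (≤-trans (m≤n+m _ (2 * d + 1)) E₀≤e)) e≤y ,
    ≤-trans (≤-trans (m≤n+m (suc E) (K * 2 ^ E)) (≤-trans (m≤n+m _ (2 * d + 1)) E₀≤e)) e≤y ,
    ≤-trans (*-monoˡ-≤ y (≤-trans (≤-reflexive (+-comm (k * suc E) 1)) (s≤s (≤-trans (m≤m+n (k * suc E) (2 * M)) (m≤m+n _ 1))))) cy≤h ,
    above , wide , exponential
    where
    h = n / 2
    y = 2 * (q * e)
    h*2≤n : h * 2 ≤ n
    h*2≤n = m/n*n≤m n 2
    e≤y : e ≤ y
    e≤y = ≤-trans (m≤n*m e q) (m≤n*m (q * e) 2)
    cy≤h : c * y ≤ h
    cy≤h = begin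
      c * y ≡⟨ m*n/n≡m (c * y) 2 ⟨
      c * y * 2 / 2 ≤⟨ /-monoˡ-≤ 2 (≤-trans (≤-reflexive (eq c q e)) Qe≤n) ⟩
      h ∎
      where
      eq : ∀ c q e → c * (2 * (q * e)) * 2 ≡ e * (4 * c * q)
      eq = solve-∀
    above : h + y + M * (2 * y) ≤ n
    above = begin
      h + y + M * (2 * y) ≡⟨ eq h y M ⟩
      h + (2 * M + 1) * y ≤⟨ +-monoʳ-≤ h (*-monoˡ-≤ y (≤-trans (≤-trans (m≤n+m (2 * M + 1) (k * suc E)) (≤-reflexive (sym (+-assoc (k * suc E) (2 * M) 1)))) (n≤1+n _))) ⟩
      h + c * y ≤⟨ +-monoʳ-≤ h cy≤h ⟩
      h + h ≡⟨ trans (cong (h +_) (sym (+-identityʳ h))) (*-comm 2 h) ⟩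
      h * 2 ≤⟨ h*2≤n ⟩
      n ∎
      where
      eq : ∀ h y M → h + y + M * (2 * y) ≡ h + (2 * M + 1) * y
      eq = solve-∀
    1≤e : 1 ≤ e
    1≤e = ≤-trans (≤-trans (m≤n+m 1 (2 * d)) (m≤m+n (2 * d + 1) _)) E₀≤e
    n<2Qe : suc n ≤ 2 * e * Q
    n<2Qe = begin
      suc n ≤⟨ n<Q+Qe ⟩
      Q + e * Q ≤⟨ +-monoˡ-≤ (e * Q) (m≤n*m Q e {{>-nonZero 1≤e}}) ⟩
      e * Q + e * Q ≡⟨ eq e Q ⟩
      2 * e * Q ∎
      where
      eq : ∀ e Q → e * Q + e * Q ≡ 2 * e * Q
      eq = solve-∀
    wide : h ≤ (2 * q + 1) * (q * e)
    wide = ≤-trans (*-cancelʳ-≤ h (2 * q * (q * e)) 2 (begin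
      h * 2 ≤⟨ ≤-trans h*2≤n (≤-trans (n≤1+n n) n<2Qe) ⟩
      2 * e * Q ≡⟨ eq c e ⟩
      2 * q * (q * e) * 2 ∎)) (*-monoˡ-≤ (q * e) (m≤m+n (2 * q) 1))
      where
      eq : ∀ c e → 2 * e * (4 * c * (2 * c)) ≡ 2 * (2 * c) * (2 * c * e) * 2
      eq = solve-∀
    exponential : 2 * suc m * suc n ≤ 2 ^ e
    exponential = begin
      2 * suc m * suc n ≤⟨ *-monoʳ-≤ (2 * suc m) n<2Qe ⟩
      2 * suc m * (2 * e * Q) ≡⟨ eq (suc m) e Q ⟩
      d * e ≡⟨ cong (d *_) (m+[n∸m]≡n 2d+1≤e) ⟨
      d * (2 * d + 1 + (e ∸ (2 * d + 1))) ≤⟨ linear≤2^ d (e ∸ (2 * d + 1)) ⟩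
      2 ^ (2 * d + 1 + (e ∸ (2 * d + 1))) ≡⟨ cong (2 ^_) (m+[n∸m]≡n 2d+1≤e) ⟩
      2 ^ e ∎
      where
      2d+1≤e : 2 * d + 1 ≤ e
      2d+1≤e = ≤-trans (m≤m+n _ _) E₀≤e
      eq : ∀ m e Q → 2 * m * (2 * e * Q) ≡ 4 * m * Q * e
      eq = solve-∀

-- The lower bound: a full level

subsets : ∀ (n j : ℕ) → List (Subset n)
subsets zero zero = [] ∷ []
subsets zero (suc j) = []
subsets (suc n) zero = map (outside ∷_) (subsets n zero)
subsets (suc n) (suc j) = map (inside ∷_) (subsets n j) ++ map (outside ∷_) (subsets n (suc j))

length-subsets : ∀ (n j : ℕ) → length (subsets n j) ≡ n C j
length-subsets zero zero = refl
length-subsets zero (suc j) = sym (k>n⇒nCk≡0 {zero} {suc j} (s≤s z≤n))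
length-subsets (suc n) zero = trans (length-map _ (subsets n zero)) (trans (length-subsets n zero) (trans (nC0≡1 n) (sym (nC0≡1 (suc n)))))
  where
  nC0≡1 : ∀ n → n C 0 ≡ 1
  nC0≡1 n = trans (nCk≡nC[n∸k] {0} {n} z≤n) (nCn≡1 n)
length-subsets (suc n) (suc j) = begin
  length (map (inside ∷_) (subsets n j) ++ map (outside ∷_) (subsets n (suc j))) ≡⟨ length-++ (map (inside ∷_) (subsets n j)) ⟩
  length (map (inside ∷_) (subsets n j)) + length (map (outside ∷_) (subsets n (suc j)))
    ≡⟨ cong₂ _+_ (trans (length-map _ (subsets n j)) (length-subsets n j)) (trans (length-map _ (subsets n (suc j))) (length-subsets n (suc j))) ⟩
  n C j + n C (suc j) ≡⟨ nCk+nC[k+1]≡[n+1]C[k+1] n j ⟩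
  suc n C suc j ∎
  where open ≡-Reasoning

∈-subsets : ∀ (n j : ℕ) {S} → S ∈ subsets n j → ∣ S ∣ ≡ j
∈-subsets zero zero (here refl) = refl
∈-subsets (suc n) zero i with ∈-map⁻ (outside ∷_) i
... | S , k , refl = ∈-subsets n zero k
∈-subsets (suc n) (suc j) i with ∈-++⁻ (map (inside ∷_) (subsets n j)) i
... | inj₁ i′ with ∈-map⁻ (inside ∷_) i′
...   | S , k , refl = cong suc (∈-subsets n j k)
∈-subsets (suc n) (suc j) i | inj₂ i′ with ∈-map⁻ (outside ∷_) i′
...   | S , k , refl = ∈-subsets n (suc j) k

subsets-unique : ∀ (n j : ℕ) → Unique (subsets n j)
subsets-unique zero zero = [] ∷ []
subsets-unique zero (suc j) = []
subsets-unique (suc n) zero = UniqueP.map⁺ (λ { refl → refl }) (subsets-unique n zero)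
subsets-unique (suc n) (suc j) = UniqueP.++⁺ (UniqueP.map⁺ (λ { refl → refl }) (subsets-unique n j))
  (UniqueP.map⁺ (λ { refl → refl }) (subsets-unique n (suc j))) λ (a , b) → disjoint a b
  where
  disjoint : ∀ {S} → S ∈ map (inside ∷_) (subsets n j) → S ∉ map (outside ∷_) (subsets n (suc j))
  disjoint a b with ∈-map⁻ (inside ∷_) a | ∈-map⁻ (outside ∷_) b
  disjoint a b | _ , _ , refl | _ , _ , ()

-- Height 2 supplies two distinct comparable elements, whereas inclusion inside one level is
-- equality.
subsets-free : ∀ P → HasHeight P 2 → ∀ n j → PFree P n (subsets n j)
subsets-free P ((f , f-injective , comparable) , _) n j (g , g-injective , g∈ , g-mono) = absurd (comparable zero (suc zero))
  where
  collapse : ∀ u v → _≤P_ P u v → u ≡ v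
  collapse u v u≤v = g-injective (⊆ₛ∧∣≡∣⇒≡ (g-mono u v u≤v) (trans (∈-subsets n j (g∈ u)) (sym (∈-subsets n j (g∈ v)))))
  absurd : _≤P_ P (f zero) (f (suc zero)) ⊎ _≤P_ P (f (suc zero)) (f zero) → ⊥
  absurd (inj₁ p) with f-injective (collapse _ _ p)
  ... | ()
  absurd (inj₂ p) with f-injective (collapse _ _ p)
  ... | ()

theorem2 : (P : FinPoset) → HasHeight P 2 → (k : ℕ) → k ≥ 2 →
    HasKPartiteRepresentation P k → LaAsymptoticallyMiddleBinomial P
theorem2 P height (suc k′) k≥2 (l , 𝒫 , sizes , (f , f-injective , f∈ , f-mono) , c , partite) m =
  proj₁ params , λ n n≥N → (λ 𝓕 uniq free → upper n n≥N 𝓕 uniq free) ,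
    subsets n (n / 2) , subsets-unique n (n / 2) , subsets-free P height n (n / 2) ,
    ≤-trans (*-monoˡ-≤ (n C (n / 2)) (n≤1+n m)) (≤-reflexive (cong (suc m *_) (sym (length-subsets n (n / 2)))))
  where
  k t E r M b K : ℕ
  k = suc k′
  -- One vertex for each element of [l] and one reserved for each element of P, as used by `index`.
  t = l + size P
  E = k * k * suc t ^ k
  r = 3 * (2 * suc m) * suc E
  M = 2 * k * r
  b = k * κ k r + 1
  K = 2 * t * κ^ t k (b ^ k)
  params = parameters k E M K m
  t≢0 : NonZero t
  -- The chain of size 2 shows that P has an element.
  t≢0 = FinP.nonZeroIndex (l ↑ʳ proj₁ (proj₁ height) zero)
  upper : ∀ n → n ≥ proj₁ params → (𝓕 : List (Subset n)) → Unique 𝓕 → PFree P n 𝓕 → suc m * length 𝓕 ≤ (2 + m) * (n C (n / 2))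
  upper n n≥N 𝓕 uniq free = decidable-stable (_ ≤? _) (λ large → free (contain (proj₂ params n n≥N) large))
    where
    contain : (∃[ q ] ∃[ e ] NonZero q × K * 2 ^ E ≤ 2 * (q * e) × E < 2 * (q * e) ×
      (k * suc E + 1) * (2 * (q * e)) ≤ n / 2 × n / 2 + 2 * (q * e) + M * (2 * (2 * (q * e))) ≤ n ×
      n / 2 ≤ (2 * q + 1) * (q * e) × 2 * suc m * suc n ≤ 2 ^ e) →
      ¬ (suc m * length 𝓕 ≤ (2 + m) * (n C (n / 2))) → WeakSubposetOfFamily P n 𝓕
    contain (q , e , q≢0 , p₁ , p₂ , p₃ , p₄ , p₅ , p₆) large =
      place (family-large 𝓕 uniq m {k} {t} q e E r M b K {{it}} {{t≢0}} {{q≢0}} refl refl refl refl refl p₁ p₂ p₃ p₄ p₅ p₆ large)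
      where
      place : (∃[ F′ ] (∀ {s} → s ∈ F′ → s ∈ family 𝓕) × Grid F′ k t) → WeakSubposetOfFamily P n 𝓕
      place (F′ , F′⊆ , G) = embed P k′ l 𝒫 sizes f f-injective f∈ f-mono c partite 𝓕 back G
        where
        back : ∀ {s} → s ∈ F′ → ∃[ S ] S ∈ 𝓕 × toList S ≡ s
        back i with ∈-map⁻ toList (F′⊆ i)
        ... | S , S∈ , refl = S , S∈ , refl
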